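{- Let $\Phi$ be a $\mathbf t$-module of dimension $d$ over $K$ with $\Phi_t=(\theta I+N_\Phi)+\sum_{j=1}^nA_j\tau^j$ where $A_n$ is an invertible matrix, and let $\psi$ be a Drinfeld module with $\psi_t=\theta+\sum_{j=1}^mb_j\tau^j$. If $\operatorname{rk}\Phi>\operatorname{rk}\psi$, then (i) $\operatorname{Ext}^1_\tau(\Phi,\psi)$ has a natural structure of a $\mathbf t$-module (i.e. it is, as an $\mathbb F_q[t]$-module, isomorphic to the Mordell–Weil module of a $\mathbf t$-module); (ii) there is a short exact sequence of $\mathbf t$-modules $$0\to\operatorname{Ext}_{0,\tau}(\Phi,\psi)\to\operatorname{Ext}^1_\tau(\Phi,\psi)\to\mathbb G_a^s\to0,$$ where $s$ is the number of zero rows of the matrix $A_n^{ -1}N_\Phi$, the Ext modules carry their natural $\mathbf t$-module structures (the first map inducing the natural inclusion), and $\mathbb G_a^s$ is the $\mathbf t$-module $t\mapsto\theta I_s$.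
   Context: $A=\mathbb F_q[t]$, $K$ a field of characteristic $p$ with $\mathbb F_q$-algebra map $\iota:A\to K$, $\theta=\iota(t)$; $K\{\tau\}$ twisted polynomials with $\tau x=x^q\tau$. A $\mathbf t$-module of dimension $d$: $\mathbb F_q$-algebra homomorphism $\Phi:\mathbb F_q[t]\to\mathrm{Mat}_d(K\{\tau\})$ with $\Phi_t=(\theta I+N)+\sum_{i\ge1}M_i\tau^i$, $N$ nilpotent; rank $=\deg_\tau\Phi_t$; Drinfeld module = dimension one; Mordell–Weil module: $K^d$ with $t$ acting via evaluation of $\Phi_t$. Morphisms from $\Psi$ (dim $e$) to $\Phi$ (dim $d$): $f\in\mathrm{Mat}_{d\times e}(K\{\tau\})$ with $f\Psi_t=\Phi_tf$; short exact sequence: composable morphisms whose underlying sequence of algebraic groups is short exact. $\mathrm{Der}(\Phi,\psi)$: $\mathbb F_q$-linear $\delta:\mathbb F_q[t]\to\mathrm{Mat}_{1\times d}(K\{\tau\})$ with $\delta(ab)=\psi_a\delta(b)+\delta(a)\Phi_b$; inner: $\delta^{(U)}(a)=U\Phi_a-\psi_aU$; $\operatorname{Ext}^1_\tau(\Phi,\psi)=\mathrm{Der}/\mathrm{Der}_{in}$ with $a*[\delta]=[\psi_a\delta]$; $\mathrm{Der}_0$ = those $\delta$ with $\delta(t)$ of zero constant term, $\operatorname{Ext}_{0,\tau}=\mathrm{Der}_0/(\mathrm{Der}_0\cap\mathrm{Der}_{in})$.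
   Formalization: In (ii), s counts the zero rows of A_n^{ -1}N_Φ after row reduction (its corank), since the literal count fails, e.g. for A_2=I, A_1=0, N_Φ with both rows (1,-1), ψ_t=θ+τ; the fields are assumed to have decidable equality, which is automatic classically. -}

module Defs where

open import Algebra.Bundles using (RawRing; Ring; CommutativeRing; AbelianGroup)
open import Algebra.Module.Bundles.Raw using (RawLeftModule)
open import Algebra.Module.Morphism.Structures using (module LeftModuleMorphisms)
open import Algebra.Morphism.Bundles using (RingHomomorphism)
import Algebra.Definitions.RawSemiring as RawSemiringDefs
import Algebra.Morphism.Construct.Composition as Composition
import Algebra.Morphism.Construct.Identity as Identity
import Algebra.Properties.AbelianGroup as AbelianGroupProperties
import Algebra.Properties.CommutativeSemigroup as CommutativeSemigroupProperties
import Algebra.Properties.CommutativeSemiring.Binomial as Binomial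
import Algebra.Properties.CommutativeSemiring.Exp as Exp
import Algebra.Properties.Ring as RingProperties
import Algebra.Properties.Semiring.Mult as Mult
import Algebra.Properties.Semiring.Sum as Sum
open import Data.Bool.Base using (if_then_else_; true; false)
open import Data.Fin.Base as Fin using (Fin; zero; suc; toℕ; fromℕ; inject₁)
import Data.Fin.Properties as Fin
open import Data.List.Base using (List; []; _∷_; map; length; filter; allFin)
open import Data.List.Relation.Unary.All using (all?)
open import Data.Nat.Base as ℕ using (ℕ; zero; suc; _<_; _!; _∸_)
open import Data.Nat.Combinatorics using (_C_; nCn≡1; nCk≡n!/k![n-k]!; k![n∸k]!∣n!)
open import Data.Nat.Divisibility using (_∣_; _∤_; divides; ∣⇒≤; m∣m*n)
open import Data.Nat.DivMod using (m/n*n≡m)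
open import Data.Nat.Primality using (Prime; euclidsLemma; prime⇒nonZero; prime⇒nonTrivial)
import Data.Nat.Properties as ℕ
open import Data.Product.Base using (Σ; ∃; _×_; _,_; proj₁; proj₂)
open import Data.Sum.Base using (inj₁; inj₂)
open import Data.Vec.Functional as Vector using (Vector)
open import Function.Base using (_∘_)
open import Function.Bundles using (Inverse; _⇔_)
open import Level as Level using (Level; _⊔_)
open import Relation.Binary.Bundles using (Setoid)
open import Relation.Binary.Core using (Rel)
open import Relation.Binary.Definitions using (Decidable)
open import Relation.Binary.PropositionalEquality as ≡ using (_≡_)
import Relation.Binary.Reasoning.Setoid as SetoidReasoning
open import Relation.Nullary using (does; contradiction)

private
  variable
    c ℓ c₁ ℓ₁ c₂ ℓ₂ m ℓm : Level

-- Decidability of equality is part of the notion of field: the degree of a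
-- twisted polynomial and the zero rows of a matrix are computed with it.
record Field c ℓ : Set (Level.suc (c ⊔ ℓ)) where
  infix 4 _≟_
  field
    commutativeRing : CommutativeRing c ℓ
  open CommutativeRing commutativeRing public
  field
    0≉1     : 0# ≉ 1#
    inverse : ∀ x → x ≉ 0# → ∃ λ y → x * y ≈ 1#
    _≟_     : Decidable _≈_

-- R{τ} with τ x = σ(x) τ.  The list a₀ ∷ a₁ ∷ … ∷ aₙ ∷ [] stands for
-- a₀ + a₁ τ + … + aₙ τⁿ; trailing zeros are allowed and ignored by ≈.

module SkewPolynomials (R : Ring c ℓ) (σ : RingHomomorphism (Ring.rawRing R) (Ring.rawRing R)) where
  private module R = Ring R
  open R using (_≈_; _+_; _*_; -_; 0#; 1#) renaming (Carrier to X)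
  open RingHomomorphism σ using () renaming
    (⟦_⟧ to s; ⟦⟧-cong to s-cong; +-homo to s-+; *-homo to s-*; 0#-homo to s-0; 1#-homo to s-1)
  open SetoidReasoning R.setoid

  Poly : Set c
  Poly = List X

  coeff : Poly → ℕ → X
  coeff []      _       = 0#
  coeff (a ∷ f) zero    = a
  coeff (a ∷ f) (suc n) = coeff f n

  infix 4 _≈ₚ_
  record _≈ₚ_ (f g : Poly) : Set ℓ where
    constructor mk
    field at : ∀ n → coeff f n ≈ coeff g n
  open _≈ₚ_ public

  infixl 6 _+ₚ_
  infixl 7 _*ₚ_ _·ₚ_
  infix  8 -ₚ_

  _+ₚ_ : Poly → Poly → Poly
  []      +ₚ g       = g
  (a ∷ f) +ₚ []      = a ∷ f
  (a ∷ f) +ₚ (b ∷ g) = (a + b) ∷ (f +ₚ g)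

  -ₚ_ : Poly → Poly
  -ₚ_ = map -_

  const : X → Poly
  const a = a ∷ []

  τ : Poly
  τ = 0# ∷ 1# ∷ []

  _·ₚ_ : X → Poly → Poly
  a ·ₚ f = map (a *_) f

  -- (a + f τ) g = a g + f σ(g) τ, where σ acts on coefficients
  _*ₚ_ : Poly → Poly → Poly
  []      *ₚ g = []
  (a ∷ f) *ₚ g = (a ·ₚ g) +ₚ (0# ∷ (f *ₚ map s g))

  coeff-+ : ∀ f g n → coeff (f +ₚ g) n ≈ coeff f n + coeff g n
  coeff-+ []      g       n       = R.sym (R.+-identityˡ _)
  coeff-+ (a ∷ f) []      n       = R.sym (R.+-identityʳ _)
  coeff-+ (a ∷ f) (b ∷ g) zero    = R.refl
  coeff-+ (a ∷ f) (b ∷ g) (suc n) = coeff-+ f g n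

  coeff-map : ∀ (h : X → X) → h 0# ≈ 0# → ∀ f n → coeff (map h f) n ≈ h (coeff f n)
  coeff-map h h0 []      n       = R.sym h0
  coeff-map h h0 (a ∷ f) zero    = R.refl
  coeff-map h h0 (a ∷ f) (suc n) = coeff-map h h0 f n

  coeff-neg : ∀ f n → coeff (-ₚ f) n ≈ - coeff f n
  coeff-neg = coeff-map -_ (RingProperties.-0#≈0# R)

  coeff-· : ∀ a f n → coeff (a ·ₚ f) n ≈ a * coeff f n
  coeff-· a = coeff-map (a *_) (R.zeroʳ a)

  coeff-σ : ∀ f n → coeff (map s f) n ≈ s (coeff f n)
  coeff-σ = coeff-map s s-0

  +ₚ-abelianGroup : AbelianGroup c ℓ
  +ₚ-abelianGroup = record
    { Carrier = Poly ; _≈_ = _≈ₚ_ ; _∙_ = _+ₚ_ ; ε = [] ; _⁻¹ = -ₚ_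
    ; isAbelianGroup = record
      { isGroup = record
        { isMonoid = record
          { isSemigroup = record
            { isMagma = record
              { isEquivalence = record
                { refl  = mk λ n → R.refl
                ; sym   = λ p → mk λ n → R.sym (at p n)
                ; trans = λ p q → mk λ n → R.trans (at p n) (at q n) }
              ; ∙-cong = λ {f} {f'} {g} {g'} p q → mk λ n → begin
                  coeff (f +ₚ g) n        ≈⟨ coeff-+ f g n ⟩
                  coeff f n + coeff g n   ≈⟨ R.+-cong (at p n) (at q n) ⟩
                  coeff f' n + coeff g' n ≈⟨ coeff-+ f' g' n ⟨
                  coeff (f' +ₚ g') n      ∎ }
            ; assoc = λ f g h → mk λ n → begin
                coeff (f +ₚ g +ₚ h) n                 ≈⟨ coeff-+ (f +ₚ g) h n ⟩
                coeff (f +ₚ g) n + coeff h n          ≈⟨ R.+-congʳ (coeff-+ f g n) ⟩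
                coeff f n + coeff g n + coeff h n     ≈⟨ R.+-assoc _ _ _ ⟩
                coeff f n + (coeff g n + coeff h n)   ≈⟨ R.+-congˡ (coeff-+ g h n) ⟨
                coeff f n + coeff (g +ₚ h) n          ≈⟨ coeff-+ f (g +ₚ h) n ⟨
                coeff (f +ₚ (g +ₚ h)) n               ∎ }
          ; identity = (λ f → mk λ n → R.refl)
                     , (λ f → mk λ n → R.trans (coeff-+ f [] n) (R.+-identityʳ _)) }
        ; inverse = (λ f → mk λ n → R.trans (coeff-+ (-ₚ f) f n)
                                   (R.trans (R.+-congʳ (coeff-neg f n)) (R.-‿inverseˡ _)))
                  , (λ f → mk λ n → R.trans (coeff-+ f (-ₚ f) n)
                                   (R.trans (R.+-congˡ (coeff-neg f n)) (R.-‿inverseʳ _)))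
        ; ⁻¹-cong = λ {f} {g} p → mk λ n → begin
            coeff (-ₚ f) n ≈⟨ coeff-neg f n ⟩
            - coeff f n    ≈⟨ R.-‿cong (at p n) ⟩
            - coeff g n    ≈⟨ coeff-neg g n ⟨
            coeff (-ₚ g) n ∎ }
      ; comm = λ f g → mk λ n → begin
          coeff (f +ₚ g) n      ≈⟨ coeff-+ f g n ⟩
          coeff f n + coeff g n ≈⟨ R.+-comm _ _ ⟩
          coeff g n + coeff f n ≈⟨ coeff-+ g f n ⟨
          coeff (g +ₚ f) n      ∎ } }

  private
    module G = AbelianGroup +ₚ-abelianGroup
    open CommutativeSemigroupProperties G.commutativeSemigroup using (interchange)

    ∷-cong : ∀ {a b f g} → a ≈ b → f ≈ₚ g → a ∷ f ≈ₚ b ∷ g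
    ∷-cong p q = mk λ { zero → p ; (suc n) → at q n }

    tail≈ : ∀ {a b f g} → a ∷ f ≈ₚ b ∷ g → f ≈ₚ g
    tail≈ p = mk λ n → at p (suc n)

    0∷[] : ∀ {f} → f ≈ₚ [] → 0# ∷ f ≈ₚ []
    0∷[] p = mk λ { zero → R.refl ; (suc n) → at p n }

    ·-cong : ∀ {a b f g} → a ≈ b → f ≈ₚ g → a ·ₚ f ≈ₚ b ·ₚ g
    ·-cong {a} {b} {f} {g} p q = mk λ n →
      R.trans (coeff-· a f n) (R.trans (R.*-cong p (at q n)) (R.sym (coeff-· b g n)))

    ·-zeroˡ : ∀ {a} → a ≈ 0# → ∀ f → a ·ₚ f ≈ₚ []
    ·-zeroˡ {a} p f = mk λ n → R.trans (coeff-· a f n) (R.trans (R.*-congʳ p) (R.zeroˡ _))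

    ·-distribˡ : ∀ a f g → a ·ₚ (f +ₚ g) ≈ₚ a ·ₚ f +ₚ a ·ₚ g
    ·-distribˡ a f g = mk λ n → begin
      coeff (a ·ₚ (f +ₚ g)) n               ≈⟨ coeff-· a (f +ₚ g) n ⟩
      a * coeff (f +ₚ g) n                  ≈⟨ R.*-congˡ (coeff-+ f g n) ⟩
      a * (coeff f n + coeff g n)           ≈⟨ R.distribˡ _ _ _ ⟩
      a * coeff f n + a * coeff g n         ≈⟨ R.+-cong (coeff-· a f n) (coeff-· a g n) ⟨
      coeff (a ·ₚ f) n + coeff (a ·ₚ g) n   ≈⟨ coeff-+ (a ·ₚ f) (a ·ₚ g) n ⟨
      coeff (a ·ₚ f +ₚ a ·ₚ g) n            ∎

    ·-distribʳ : ∀ a b f → (a + b) ·ₚ f ≈ₚ a ·ₚ f +ₚ b ·ₚ f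
    ·-distribʳ a b f = mk λ n → begin
      coeff ((a + b) ·ₚ f) n                ≈⟨ coeff-· (a + b) f n ⟩
      (a + b) * coeff f n                   ≈⟨ R.distribʳ _ _ _ ⟩
      a * coeff f n + b * coeff f n         ≈⟨ R.+-cong (coeff-· a f n) (coeff-· b f n) ⟨
      coeff (a ·ₚ f) n + coeff (b ·ₚ f) n   ≈⟨ coeff-+ (a ·ₚ f) (b ·ₚ f) n ⟨
      coeff (a ·ₚ f +ₚ b ·ₚ f) n            ∎

    ·-assoc : ∀ a b f → (a * b) ·ₚ f ≈ₚ a ·ₚ (b ·ₚ f)
    ·-assoc a b f = mk λ n → begin
      coeff ((a * b) ·ₚ f) n    ≈⟨ coeff-· (a * b) f n ⟩
      a * b * coeff f n         ≈⟨ R.*-assoc _ _ _ ⟩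
      a * (b * coeff f n)       ≈⟨ R.*-congˡ (coeff-· b f n) ⟨
      a * coeff (b ·ₚ f) n      ≈⟨ coeff-· a (b ·ₚ f) n ⟨
      coeff (a ·ₚ (b ·ₚ f)) n   ∎

    ·-identity : ∀ f → 1# ·ₚ f ≈ₚ f
    ·-identity f = mk λ n → R.trans (coeff-· 1# f n) (R.*-identityˡ _)

    σ-cong : ∀ {f g} → f ≈ₚ g → map s f ≈ₚ map s g
    σ-cong {f} {g} p = mk λ n →
      R.trans (coeff-σ f n) (R.trans (s-cong (at p n)) (R.sym (coeff-σ g n)))

    σ-+ : ∀ f g → map s (f +ₚ g) ≈ₚ map s f +ₚ map s g
    σ-+ f g = mk λ n → begin
      coeff (map s (f +ₚ g)) n                ≈⟨ coeff-σ (f +ₚ g) n ⟩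
      s (coeff (f +ₚ g) n)                    ≈⟨ s-cong (coeff-+ f g n) ⟩
      s (coeff f n + coeff g n)               ≈⟨ s-+ _ _ ⟩
      s (coeff f n) + s (coeff g n)           ≈⟨ R.+-cong (coeff-σ f n) (coeff-σ g n) ⟨
      coeff (map s f) n + coeff (map s g) n   ≈⟨ coeff-+ (map s f) (map s g) n ⟨
      coeff (map s f +ₚ map s g) n            ∎

    σ-· : ∀ a f → map s (a ·ₚ f) ≈ₚ s a ·ₚ map s f
    σ-· a f = mk λ n → begin
      coeff (map s (a ·ₚ f)) n     ≈⟨ coeff-σ (a ·ₚ f) n ⟩
      s (coeff (a ·ₚ f) n)         ≈⟨ s-cong (coeff-· a f n) ⟩
      s (a * coeff f n)            ≈⟨ s-* _ _ ⟩
      s a * s (coeff f n)          ≈⟨ R.*-congˡ (coeff-σ f n) ⟨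
      s a * coeff (map s f) n      ≈⟨ coeff-· (s a) (map s f) n ⟨
      coeff (s a ·ₚ map s f) n     ∎

    shift-+ : ∀ f g → 0# ∷ (f +ₚ g) ≈ₚ (0# ∷ f) +ₚ (0# ∷ g)
    shift-+ f g = ∷-cong (R.sym (R.+-identityʳ 0#)) G.refl

    ·-shift : ∀ a f → a ·ₚ (0# ∷ f) ≈ₚ 0# ∷ (a ·ₚ f)
    ·-shift a f = ∷-cong (R.zeroʳ a) G.refl

    *-congˡ : ∀ f {g h} → g ≈ₚ h → f *ₚ g ≈ₚ f *ₚ h
    *-congˡ []      p = G.refl
    *-congˡ (a ∷ f) p = G.∙-cong (·-cong R.refl p) (∷-cong R.refl (*-congˡ f (σ-cong p)))

    *-[]ˡ : ∀ f g → f ≈ₚ [] → f *ₚ g ≈ₚ []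
    *-[]ˡ []      g p = G.refl
    *-[]ˡ (a ∷ f) g p = G.∙-cong (·-zeroˡ (at p zero) g) (0∷[] (*-[]ˡ f (map s g) (mk λ n → at p (suc n))))

    *-congʳ : ∀ f f' g → f ≈ₚ f' → f *ₚ g ≈ₚ f' *ₚ g
    *-congʳ []      f'       g p = G.sym (*-[]ˡ f' g (G.sym p))
    *-congʳ (a ∷ f) []       g p = *-[]ˡ (a ∷ f) g p
    *-congʳ (a ∷ f) (b ∷ f') g p =
      G.∙-cong (·-cong (at p zero) G.refl) (∷-cong R.refl (*-congʳ f f' (map s g) (tail≈ p)))

    distribˡ : ∀ f g h → f *ₚ (g +ₚ h) ≈ₚ f *ₚ g +ₚ f *ₚ h
    distribˡ []      g h = G.refl
    distribˡ (a ∷ f) g h = G.trans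
      (G.∙-cong (·-distribˡ a g h)
        (G.trans (∷-cong R.refl (G.trans (*-congˡ f (σ-+ g h)) (distribˡ f (map s g) (map s h))))
                 (shift-+ (f *ₚ map s g) (f *ₚ map s h))))
      (interchange (a ·ₚ g) (a ·ₚ h) (0# ∷ (f *ₚ map s g)) (0# ∷ (f *ₚ map s h)))

    distribʳ : ∀ h f g → (f +ₚ g) *ₚ h ≈ₚ f *ₚ h +ₚ g *ₚ h
    distribʳ h []      g       = G.refl
    distribʳ h (a ∷ f) []      = G.sym (G.identityʳ _)
    distribʳ h (a ∷ f) (b ∷ g) = G.trans
      (G.∙-cong (·-distribʳ a b h)
        (G.trans (∷-cong R.refl (distribʳ (map s h) f g)) (shift-+ (f *ₚ map s h) (g *ₚ map s h))))
      (interchange (a ·ₚ h) (b ·ₚ h) (0# ∷ (f *ₚ map s h)) (0# ∷ (g *ₚ map s h)))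

    ·-*-assoc : ∀ a f g → (a ·ₚ f) *ₚ g ≈ₚ a ·ₚ (f *ₚ g)
    ·-*-assoc a []      g = G.refl
    ·-*-assoc a (b ∷ f) g = G.trans
      (G.∙-cong (·-assoc a b g)
        (G.trans (∷-cong R.refl (·-*-assoc a f (map s g))) (G.sym (·-shift a (f *ₚ map s g)))))
      (G.sym (·-distribˡ a (b ·ₚ g) (0# ∷ (f *ₚ map s g))))

    shift-* : ∀ f g → (0# ∷ f) *ₚ g ≈ₚ 0# ∷ (f *ₚ map s g)
    shift-* f g = G.∙-congʳ (·-zeroˡ R.refl g)

    σ-* : ∀ f g → map s (f *ₚ g) ≈ₚ map s f *ₚ map s g
    σ-* []      g = G.refl
    σ-* (a ∷ f) g = G.trans (σ-+ (a ·ₚ g) (0# ∷ (f *ₚ map s g)))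
      (G.∙-cong (σ-· a g) (∷-cong s-0 (σ-* f (map s g))))

    assoc : ∀ f g h → (f *ₚ g) *ₚ h ≈ₚ f *ₚ (g *ₚ h)
    assoc []      g h = G.refl
    assoc (a ∷ f) g h = G.trans (distribʳ h (a ·ₚ g) (0# ∷ (f *ₚ map s g)))
      (G.∙-cong (·-*-assoc a g h)
        (G.trans (shift-* (f *ₚ map s g) h)
          (∷-cong R.refl (G.trans (assoc f (map s g) (map s h)) (*-congˡ f (G.sym (σ-* g h)))))))

    identityˡ : ∀ f → const 1# *ₚ f ≈ₚ f
    identityˡ f = G.trans (G.∙-cong (·-identity f) (0∷[] G.refl)) (G.identityʳ f)

    identityʳ : ∀ f → f *ₚ const 1# ≈ₚ f
    identityʳ []      = G.refl
    identityʳ (a ∷ f) = ∷-cong (R.trans (R.+-identityʳ _) (R.*-identityʳ a))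
      (G.trans (*-congˡ f (∷-cong s-1 G.refl)) (identityʳ f))

  ring : Ring c ℓ
  ring = record
    { Carrier = Poly ; _≈_ = _≈ₚ_ ; _+_ = _+ₚ_ ; _*_ = _*ₚ_ ; -_ = -ₚ_ ; 0# = [] ; 1# = const 1#
    ; isRing = record
      { +-isAbelianGroup = G.isAbelianGroup
      ; *-cong = λ {f} {f'} {g} {g'} p q → G.trans (*-congʳ f f' g p) (*-congˡ f' q)
      ; *-assoc = assoc
      ; *-identity = identityˡ , identityʳ
      ; distrib = distribˡ , distribʳ } }

  coeff₀-* : ∀ f g → coeff (f *ₚ g) 0 ≈ coeff f 0 * coeff g 0
  coeff₀-* []      g = R.sym (R.zeroˡ _)
  coeff₀-* (a ∷ f) g = R.trans (coeff-+ (a ·ₚ g) (0# ∷ (f *ₚ map s g)) 0) (R.trans (R.+-identityʳ _) (coeff-· a g 0))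

  constHom : RingHomomorphism R.rawRing (Ring.rawRing ring)
  constHom = record
    { ⟦_⟧ = const
    ; isRingHomomorphism = record
      { isSemiringHomomorphism = record
        { isNearSemiringHomomorphism = record
          { +-isMonoidHomomorphism = record
            { isMagmaHomomorphism = record
              { isRelHomomorphism = record { cong = λ p → ∷-cong p G.refl }
              ; homo = λ a b → G.refl }
            ; ε-homo = 0∷[] G.refl }
          ; *-homo = λ a b → ∷-cong (R.sym (R.+-identityʳ _)) G.refl }
        ; 1#-homo = G.refl }
      ; -‿homo = λ a → G.refl } }

-- R[t] is R{τ} for σ = id.
module Polynomials (R : CommutativeRing c ℓ) where
  private
    module R = CommutativeRing R
    open R using (_*_)
  open SkewPolynomials R.ring (Identity.ringHomomorphism R.ring) public renaming (τ to t)
  private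
    module P = Ring ring

    map-id : ∀ f → map (λ a → a) f ≈ₚ f
    map-id []      = P.refl
    map-id (a ∷ f) = mk λ { zero → R.refl ; (suc n) → at (map-id f) n }

    *-∷ : ∀ f b g → f *ₚ (b ∷ g) ≈ₚ (b ·ₚ f) +ₚ (R.0# ∷ (f *ₚ g))
    *-∷ []      b g = mk λ { zero → R.refl ; (suc n) → R.refl }
    *-∷ (a ∷ f) b g = mk λ
      { zero    → R.+-congʳ (R.*-comm a b)
      ; (suc n) → at lemma n }
      where
      lemma : (a ·ₚ g) +ₚ (f *ₚ (b ∷ map (λ x → x) g)) ≈ₚ (b ·ₚ f) +ₚ ((a ∷ f) *ₚ g)
      lemma = P.trans
        (P.+-congˡ {x = a ·ₚ g} (P.trans (*-∷ f b (map (λ x → x) g)) P.refl))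
        (CommutativeSemigroupProperties.x∙yz≈y∙xz
          (AbelianGroup.commutativeSemigroup +ₚ-abelianGroup) (a ·ₚ g) (b ·ₚ f) _)

    *ₚ-comm : ∀ f g → f *ₚ g ≈ₚ g *ₚ f
    *ₚ-comm f []      = P.zeroʳ f
    *ₚ-comm f (b ∷ g) = P.trans (*-∷ f b g)
      (P.+-congˡ {x = b ·ₚ f} (mk λ
        { zero → R.refl
        ; (suc n) → at (P.trans (*ₚ-comm f g) (P.*-congˡ {x = g} (P.sym (map-id f)))) n }))

  commutativeRing : CommutativeRing c ℓ
  commutativeRing = record
    { isCommutativeRing = record { isRing = P.isRing ; *-comm = *ₚ-comm } }

module Matrices (R : Ring c ℓ) where
  private module R = Ring R
  open R using (_≈_; _+_; _*_; -_; 0#; 1#) renaming (Carrier to X)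
  open Sum R.semiring
  open SetoidReasoning R.setoid

  Mat : ℕ → ℕ → Set c
  Mat k l = Fin k → Fin l → X

  infix 4 _≈ᴹ_
  infixl 6 _+ᴹ_ _-ᴹ_
  infixl 7 _*ᴹ_ _·ᴹ_
  infix 8 -ᴹ_

  _≈ᴹ_ : ∀ {k l} → Rel (Mat k l) ℓ
  M ≈ᴹ N = ∀ i j → M i j ≈ N i j

  _+ᴹ_ : ∀ {k l} → Mat k l → Mat k l → Mat k l
  (M +ᴹ N) i j = M i j + N i j

  -ᴹ_ : ∀ {k l} → Mat k l → Mat k l
  (-ᴹ M) i j = - M i j

  _-ᴹ_ : ∀ {k l} → Mat k l → Mat k l → Mat k l
  M -ᴹ N = M +ᴹ (-ᴹ N)

  0ᴹ : ∀ {k l} → Mat k l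
  0ᴹ i j = 0#

  _*ᴹ_ : ∀ {k l n} → Mat k l → Mat l n → Mat k n
  (M *ᴹ N) i j = sum (λ h → M i h * N h j)

  _·ᴹ_ : ∀ {k l} → X → Mat k l → Mat k l
  (x ·ᴹ M) i j = x * M i j

  scalar : ∀ {k} → X → Mat k k
  scalar x i j = if does (i Fin.≟ j) then x else 0#

  1ᴹ : ∀ {k} → Mat k k
  1ᴹ = scalar 1#

  matRawRing : ℕ → RawRing c ℓ
  matRawRing k = record
    { Carrier = Mat k k ; _≈_ = _≈ᴹ_ ; _+_ = _+ᴹ_ ; _*_ = _*ᴹ_ ; -_ = -ᴹ_ ; 0# = 0ᴹ ; 1# = 1ᴹ }

  infixr 8 _^ᴹ_
  _^ᴹ_ : ∀ {k} → Mat k k → ℕ → Mat k k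
  _^ᴹ_ {k} = RawSemiringDefs._^_ (RawRing.rawSemiring (matRawRing k))

  matSetoid : ℕ → ℕ → Setoid c ℓ
  matSetoid k l = record
    { Carrier = Mat k l ; _≈_ = _≈ᴹ_
    ; isEquivalence = record
      { refl = λ i j → R.refl
      ; sym = λ p i j → R.sym (p i j)
      ; trans = λ p q i j → R.trans (p i j) (q i j) } }

  IsInverse : ∀ {k} → Mat k k → Mat k k → Set ℓ
  IsInverse M N = (M *ᴹ N ≈ᴹ 1ᴹ) × (N *ᴹ M ≈ᴹ 1ᴹ)

  *ᴹ-cong : ∀ {k l n} {M M' : Mat k l} {N N' : Mat l n} → M ≈ᴹ M' → N ≈ᴹ N' → M *ᴹ N ≈ᴹ M' *ᴹ N'
  *ᴹ-cong p q i j = sum-cong-≋ λ h → R.*-cong (p i h) (q h j)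

  *ᴹ-assoc : ∀ {k l m n} (M : Mat k l) (N : Mat l m) (P : Mat m n) → (M *ᴹ N) *ᴹ P ≈ᴹ M *ᴹ (N *ᴹ P)
  *ᴹ-assoc M N P i j = begin
    sum (λ h → sum (λ g → M i g * N g h) * P h j)
      ≈⟨ sum-cong-≋ (λ h → *-distribʳ-sum (P h j) (λ g → M i g * N g h)) ⟩
    sum (λ h → sum (λ g → M i g * N g h * P h j))
      ≈⟨ ∑-comm (λ h g → M i g * N g h * P h j) ⟩
    sum (λ g → sum (λ h → M i g * N g h * P h j))
      ≈⟨ sum-cong-≋ (λ g → sum-cong-≋ (λ h → R.*-assoc (M i g) (N g h) (P h j))) ⟩
    sum (λ g → sum (λ h → M i g * (N g h * P h j)))
      ≈⟨ sum-cong-≋ (λ g → *-distribˡ-sum (M i g) (λ h → N g h * P h j)) ⟨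
    sum (λ g → M i g * sum (λ h → N g h * P h j)) ∎

  *ᴹ-distribˡ : ∀ {k l n} (M : Mat k l) (N P : Mat l n) → M *ᴹ (N +ᴹ P) ≈ᴹ M *ᴹ N +ᴹ M *ᴹ P
  *ᴹ-distribˡ M N P i j = R.trans
    (sum-cong-≋ λ h → R.distribˡ (M i h) (N h j) (P h j))
    (∑-distrib-+ (λ h → M i h * N h j) (λ h → M i h * P h j))

  *ᴹ-distribʳ : ∀ {k l n} (P : Mat l n) (M N : Mat k l) → (M +ᴹ N) *ᴹ P ≈ᴹ M *ᴹ P +ᴹ N *ᴹ P
  *ᴹ-distribʳ P M N i j = R.trans
    (sum-cong-≋ λ h → R.distribʳ (P h j) (M i h) (N i h))
    (∑-distrib-+ (λ h → M i h * P h j) (λ h → N i h * P h j))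

  private
    sum-0 : ∀ {n} (f : Vector X n) → (∀ i → f i ≈ 0#) → sum f ≈ 0#
    sum-0 {n} f p = R.trans (sum-cong-≋ p) (sum-replicate-zero n)

    sum-neg : ∀ {n} (f : Vector X n) → sum (λ i → - f i) ≈ - sum f
    sum-neg f = RingProperties.+-inverseʳ-unique R (sum f) (sum (λ i → - f i)) (R.trans
      (R.sym (∑-distrib-+ f (λ i → - f i))) (sum-0 _ λ i → R.-‿inverseʳ (f i)))

  *ᴹ-zeroˡ : ∀ {k l n} (N : Mat l n) → 0ᴹ {k} *ᴹ N ≈ᴹ 0ᴹ
  *ᴹ-zeroˡ N i j = sum-0 (λ h → 0# * N h j) λ h → R.zeroˡ (N h j)

  *ᴹ-zeroʳ : ∀ {k l n} (M : Mat k l) → M *ᴹ 0ᴹ {l} {n} ≈ᴹ 0ᴹ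
  *ᴹ-zeroʳ M i j = sum-0 (λ h → M i h * 0#) λ h → R.zeroʳ (M i h)

  *ᴹ-negˡ : ∀ {k l n} (M : Mat k l) (N : Mat l n) → (-ᴹ M) *ᴹ N ≈ᴹ -ᴹ (M *ᴹ N)
  *ᴹ-negˡ M N i j = R.trans
    (sum-cong-≋ λ h → R.sym (RingProperties.-‿distribˡ-* R (M i h) (N h j)))
    (sum-neg (λ h → M i h * N h j))

  *ᴹ-negʳ : ∀ {k l n} (M : Mat k l) (N : Mat l n) → M *ᴹ (-ᴹ N) ≈ᴹ -ᴹ (M *ᴹ N)
  *ᴹ-negʳ M N i j = R.trans
    (sum-cong-≋ λ h → R.sym (RingProperties.-‿distribʳ-* R (M i h) (N h j)))
    (sum-neg (λ h → M i h * N h j))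

  scalar-*ᴹ : ∀ {k l} x (M : Mat k l) → scalar x *ᴹ M ≈ᴹ x ·ᴹ M
  scalar-*ᴹ {suc k} x M zero j = R.trans
    (R.+-congˡ (sum-0 (λ h → 0# * M (suc h) j) λ h → R.zeroˡ _)) (R.+-identityʳ _)
  scalar-*ᴹ {suc k} x M (suc i) j = R.trans
    (R.+-cong (R.zeroˡ _) (scalar-*ᴹ x (λ i → M (suc i)) i j)) (R.+-identityˡ _)

  private
    if-cong : ∀ {x y} b → x ≈ y → (if b then x else 0#) ≈ (if b then y else 0#)
    if-cong false _ = R.refl
    if-cong true  p = p

  scalarHom : ∀ k → RingHomomorphism R.rawRing (matRawRing k)
  scalarHom k = record
    { ⟦_⟧ = scalar
    ; isRingHomomorphism = record
      { isSemiringHomomorphism = record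
        { isNearSemiringHomomorphism = record
          { +-isMonoidHomomorphism = record
            { isMagmaHomomorphism = record
              { isRelHomomorphism = record { cong = λ p i j → if-cong (does (i Fin.≟ j)) p }
              ; homo = λ x y i j → homo-+ x y (does (i Fin.≟ j)) }
            ; ε-homo = λ i j → homo-0 (does (i Fin.≟ j)) }
          ; *-homo = λ x y i j → R.trans (homo-* x y (does (i Fin.≟ j))) (R.sym (scalar-*ᴹ x (scalar y) i j)) }
        ; 1#-homo = λ i j → R.refl }
      ; -‿homo = λ x i j → homo-neg x (does (i Fin.≟ j)) } }
    where
    homo-0 : ∀ b → (if b then 0# else 0#) ≈ 0#
    homo-0 false = R.refl
    homo-0 true  = R.refl
    homo-+ : ∀ x y b → (if b then x + y else 0#) ≈ (if b then x else 0#) + (if b then y else 0#)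
    homo-+ x y false = R.sym (R.+-identityʳ 0#)
    homo-+ x y true  = R.refl
    homo-* : ∀ x y b → (if b then x * y else 0#) ≈ x * (if b then y else 0#)
    homo-* x y false = R.sym (R.zeroʳ x)
    homo-* x y true  = R.refl
    homo-neg : ∀ x b → (if b then - x else 0#) ≈ - (if b then x else 0#)
    homo-neg x false = R.sym (RingProperties.-0#≈0# R)
    homo-neg x true  = R.refl

private
  p∤k! : ∀ {p} → Prime p → ∀ k → k < p → p ∤ k !
  p∤k! {p} pr zero k<p p∣1 =
    ℕ.<⇒≱ (ℕ.nonTrivial⇒n>1 p {{prime⇒nonTrivial pr}}) (∣⇒≤ p∣1)
  p∤k! pr (suc k) k<p p∣ with euclidsLemma (suc k) (k !) pr p∣
  ... | inj₁ d = ℕ.<⇒≱ k<p (∣⇒≤ d)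
  ... | inj₂ d = p∤k! pr k (ℕ.<-trans (ℕ.n<1+n k) k<p) d

  p∣pCk : ∀ {p} → Prime p → ∀ k → 0 < k → k < p → p ∣ p C k
  p∣pCk {p} pr k 0<k k<p with euclidsLemma (p C k) (k ! ℕ.* (p ∸ k) !) pr p∣prod
    where
    instance
      _ = k ℕ.!* (p ∸ k) !≢0
    p∣p! : ∀ n → 0 < n → n ∣ n !
    p∣p! (suc n) _ = m∣m*n (n !)
    p∣prod : p ∣ (p C k) ℕ.* (k ! ℕ.* (p ∸ k) !)
    p∣prod = ≡.subst (p ∣_)
      (≡.sym (≡.trans (≡.cong (ℕ._* (k ! ℕ.* (p ∸ k) !)) (nCk≡n!/k![n-k]! (ℕ.<⇒≤ k<p)))
                      (m/n*n≡m (k![n∸k]!∣n! (ℕ.<⇒≤ k<p)))))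
      (p∣p! p (ℕ.<-trans 0<k k<p))
  ... | inj₁ d = d
  ... | inj₂ d with euclidsLemma (k !) ((p ∸ k) !) pr d
  ...   | inj₁ e = contradiction e (p∤k! pr k k<p)
  ...   | inj₂ e = contradiction e (p∤k! pr (p ∸ k) (ℕ.∸-monoʳ-< 0<k (ℕ.<⇒≤ k<p)))

module Frobenius (R : CommutativeRing c ℓ) {p : ℕ} (p-prime : Prime p)
  (char : CommutativeRing._≈_ R (Mult._×_ (CommutativeRing.semiring R) p (CommutativeRing.1# R)) (CommutativeRing.0# R)) where
  open CommutativeRing R hiding (zero)
  open Exp commutativeSemiring
  private
    open Mult semiring renaming (_×_ to _⊗_)
    open Sum semiring using (sum; sum-init-last; sum-cong-≋; sum-replicate-zero)
    open Binomial commutativeSemiring using (theorem; binomialTerm)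
    open SetoidReasoning setoid

    p∣⇒⊗≈0 : ∀ {n} → p ∣ n → ∀ z → n ⊗ z ≈ 0#
    p∣⇒⊗≈0 (divides m ≡.refl) z = begin
      (m ℕ.* p) ⊗ z              ≈⟨ ×-congʳ (m ℕ.* p) (*-identityˡ z) ⟨
      (m ℕ.* p) ⊗ (1# * z)       ≈⟨ ×-assoc-* (m ℕ.* p) 1# z ⟨
      (m ℕ.* p) ⊗ 1# * z         ≈⟨ *-congʳ (×1-homo-* m p) ⟩
      m ⊗ 1# * (p ⊗ 1#) * z      ≈⟨ *-congʳ (trans (*-congˡ char) (zeroʳ _)) ⟩
      0# * z                     ≈⟨ zeroˡ z ⟩
      0#                         ∎

    freshman : ∀ p' → p ≡ suc p' → ∀ x y → (x + y) ^ p ≈ x ^ p + y ^ p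
    freshman p' ≡.refl x y = begin
      (x + y) ^ p                                       ≈⟨ theorem p x y ⟩
      term zero + sum (term ∘ suc)                      ≈⟨ +-congˡ (sum-init-last (term ∘ suc)) ⟩
      term zero + (sum (λ i → term (suc (inject₁ i))) + term (fromℕ p))
        ≈⟨ +-cong first (+-cong (trans (sum-cong-≋ middle) (sum-replicate-zero p')) last) ⟩
      y ^ p + (0# + x ^ p)                              ≈⟨ +-congˡ (+-identityˡ _) ⟩
      y ^ p + x ^ p                                     ≈⟨ +-comm _ _ ⟩
      x ^ p + y ^ p                                     ∎
      where
      term = binomialTerm x y p
      first : term zero ≈ y ^ p
      first = trans (+-identityʳ _) (*-identityˡ _)
      middle : ∀ i → term (suc (inject₁ i)) ≈ 0#
      middle i = p∣⇒⊗≈0 (p∣pCk p-prime (suc (toℕ (inject₁ i))) (ℕ.s≤s ℕ.z≤n)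
        (ℕ.s≤s (≡.subst (_< p') (≡.sym (Fin.toℕ-inject₁ i)) (Fin.toℕ<n i)))) _
      last : term (fromℕ p) ≈ x ^ p
      last rewrite Fin.toℕ-fromℕ p' | nCn≡1 p | ℕ.n∸n≡0 p' = trans (+-identityʳ _) (*-identityʳ _)

    ^p-+ : ∀ x y → (x + y) ^ p ≈ x ^ p + y ^ p
    ^p-+ = freshman (ℕ.pred p) (≡.sym (ℕ.suc-pred p {{prime⇒nonZero p-prime}}))

    ^q-+ : ∀ r x y → (x + y) ^ (p ℕ.^ r) ≈ x ^ (p ℕ.^ r) + y ^ (p ℕ.^ r)
    ^q-+ zero    x y = trans (*-identityʳ _) (sym (+-cong (*-identityʳ x) (*-identityʳ y)))
    ^q-+ (suc r) x y = begin
      (x + y) ^ (p ℕ.* q)           ≈⟨ ^-assocʳ (x + y) p q ⟨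
      ((x + y) ^ p) ^ q             ≈⟨ ^-congˡ q (^p-+ x y) ⟩
      (x ^ p + y ^ p) ^ q           ≈⟨ ^q-+ r (x ^ p) (y ^ p) ⟩
      (x ^ p) ^ q + (y ^ p) ^ q     ≈⟨ +-cong (^-assocʳ x p q) (^-assocʳ y p q) ⟩
      x ^ (p ℕ.* q) + y ^ (p ℕ.* q) ∎
      where q = p ℕ.^ r

    1^ : ∀ n → 1# ^ n ≈ 1#
    1^ zero    = refl
    1^ (suc n) = trans (*-identityˡ _) (1^ n)

  frobenius : ℕ → RingHomomorphism rawRing rawRing
  frobenius r = record
    { ⟦_⟧ = _^ q
    ; isRingHomomorphism = record
      { isSemiringHomomorphism = record
        { isNearSemiringHomomorphism = record
          { +-isMonoidHomomorphism = record
            { isMagmaHomomorphism = record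
              { isRelHomomorphism = record { cong = ^-congˡ q }
              ; homo = ^q-+ r }
            ; ε-homo = 0^q }
          ; *-homo = λ x y → ^-distrib-* x y q }
        ; 1#-homo = 1^ q }
      ; -‿homo = λ x → RingProperties.+-inverseʳ-unique ring (x ^ q) ((- x) ^ q)
          (trans (sym (^q-+ r x (- x))) (trans (^-congˡ q (-‿inverseʳ x)) 0^q)) } }
    where
    q = p ℕ.^ r
    0^q : 0# ^ q ≈ 0#
    0^q = RingProperties.x+x≈x⇒x≈0 ring (0# ^ q)
      (trans (sym (^q-+ r 0# 0#)) (^-congˡ q (+-identityˡ 0#)))

record Setting c₁ ℓ₁ c₂ ℓ₂ : Set (Level.suc (c₁ ⊔ ℓ₁ ⊔ c₂ ⊔ ℓ₂)) where
  field
    F : Field c₁ ℓ₁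
    K : Field c₂ ℓ₂
  module F = Field F
  module K = Field K
  field
    p r      : ℕ
    p-prime  : Prime p
    F-finite : Inverse F.setoid (≡.setoid (Fin (p ℕ.^ r)))
    K-char   : Mult._×_ K.semiring p K.1# K.≈ K.0#

  q : ℕ
  q = p ℕ.^ r

  module F[t] = Polynomials F.commutativeRing
  module K⟨τ⟩ = SkewPolynomials K.ring (Frobenius.frobenius K.commutativeRing p-prime K-char r)

  A : CommutativeRing c₁ ℓ₁
  A = F[t].commutativeRing
  module A = CommutativeRing A

  -- η makes K an F-algebra; with it ι is an F-algebra map.
  field
    η   : RingHomomorphism F.rawRing K.rawRing
    ι   : RingHomomorphism A.rawRing K.rawRing
    ι-η : ∀ x → RingHomomorphism.⟦_⟧ ι (F[t].const x) K.≈ RingHomomorphism.⟦_⟧ η x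

  θ : K.Carrier
  θ = RingHomomorphism.⟦_⟧ ι F[t].t

module TModules (S : Setting c₁ ℓ₁ c₂ ℓ₂) where
  open Setting S public
  open RingHomomorphism using (⟦_⟧)

  module MatK = Matrices K.ring
  module MatT = Matrices K⟨τ⟩.ring
  private module T = Ring K⟨τ⟩.ring

  open MatT using (_≈ᴹ_; _+ᴹ_; _-ᴹ_; _*ᴹ_; _·ᴹ_; -ᴹ_; 0ᴹ)

  coeffᴹ : ∀ {k l} → MatT.Mat k l → ℕ → MatK.Mat k l
  coeffᴹ M n i j = K⟨τ⟩.coeff (M i j) n

  -- Degree in τ, with deg 0 = 0.
  deg : K⟨τ⟩.Poly → ℕ
  deg []      = 0
  deg (a ∷ f) = if does (all? (K._≟ K.0#) f) then 0 else suc (deg f)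

  degᴹ : ∀ {k l} → MatT.Mat k l → ℕ
  degᴹ M = Vector.foldr ℕ._⊔_ 0 (λ i → Vector.foldr ℕ._⊔_ 0 (λ j → deg (M i j)))

  record TModule (d : ℕ) : Set (c₁ ⊔ ℓ₁ ⊔ c₂ ⊔ ℓ₂) where
    field
      hom    : RingHomomorphism A.rawRing (MatT.matRawRing d)
      linear : ∀ x → ⟦ hom ⟧ (F[t].const x) ≈ᴹ MatT.scalar (K⟨τ⟩.const (⟦ η ⟧ x))

    at : A.Carrier → MatT.Mat d d
    at = ⟦ hom ⟧

    at-t : MatT.Mat d d
    at-t = at F[t].t

    N : MatK.Mat d d
    N = coeffᴹ at-t 0 MatK.-ᴹ MatK.scalar θ

    rank : ℕ
    rank = degᴹ at-t

    field
      nilpotent : ∃ λ k → N MatK.^ᴹ k MatK.≈ᴹ MatK.0ᴹ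

  𝔾ₐ : ∀ s → TModule s
  𝔾ₐ s = record
    { hom = record
      { isRingHomomorphism = Composition.isRingHomomorphism
          (Setoid.trans (MatT.matSetoid s s))
          (RingHomomorphism.isRingHomomorphism ι)
          (Composition.isRingHomomorphism (Setoid.trans (MatT.matSetoid s s))
            (RingHomomorphism.isRingHomomorphism K⟨τ⟩.constHom)
            (RingHomomorphism.isRingHomomorphism (MatT.scalarHom s))) }
    ; linear = λ x → RingHomomorphism.⟦⟧-cong (MatT.scalarHom s)
        (RingHomomorphism.⟦⟧-cong K⟨τ⟩.constHom (ι-η x))
    ; nilpotent = 1 , MatK-trans (MatK.*ᴹ-cong N≈0 (λ i j → K.refl)) (MatK.*ᴹ-zeroˡ MatK.1ᴹ)
    }
    where
    open Setoid (MatK.matSetoid s s) using () renaming (trans to MatK-trans)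
    coeff-if : ∀ b x → K⟨τ⟩.coeff (if b then K⟨τ⟩.const x else []) 0 K.≈ (if b then x else K.0#)
    coeff-if false x = K.refl
    coeff-if true  x = K.refl
    N≈0 : (coeffᴹ (MatT.scalar {s} (K⟨τ⟩.const θ)) 0 MatK.-ᴹ MatK.scalar θ) MatK.≈ᴹ MatK.0ᴹ
    N≈0 i j = K.trans (K.+-congʳ (coeff-if (does (i Fin.≟ j)) θ)) (K.-‿inverseʳ _)

  IsMorphism : ∀ {d e} → TModule e → TModule d → MatT.Mat d e → Set ℓ₂
  IsMorphism Ψ Φ f = f *ᴹ TModule.at-t Ψ ≈ᴹ TModule.at-t Φ *ᴹ f

  record KAlgebra : Set (Level.suc (c₂ ⊔ ℓ₂)) where
    field
      commutativeRing : CommutativeRing c₂ ℓ₂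
    open CommutativeRing commutativeRing public
    field
      structure : RingHomomorphism K.rawRing rawRing

  -- Σ aᵢ τⁱ acts on R by x ↦ Σ aᵢ x^(qⁱ)
  module Points (R : KAlgebra) where
    open KAlgebra R
    open Exp commutativeSemiring using (_^_)
    open Sum semiring using (sum)

    infix 4 _≈ᵛ_
    _≈ᵛ_ : ∀ {n} → Rel (Vector Carrier n) ℓ₂
    x ≈ᵛ y = ∀ i → x i ≈ y i

    eval : K⟨τ⟩.Poly → Carrier → Carrier
    eval []      x = 0#
    eval (a ∷ f) x = ⟦ structure ⟧ a * x + eval f (x ^ q)

    evalᴹ : ∀ {k l} → MatT.Mat k l → Vector Carrier l → Vector Carrier k
    evalᴹ M x i = sum (λ j → eval (M i j) (x j))

  selfAlgebra : KAlgebra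
  selfAlgebra = record
    { commutativeRing = K.commutativeRing ; structure = Identity.ringHomomorphism K.ring }

  fieldExtension : (L : Field c₂ ℓ₂) → RingHomomorphism K.rawRing (Field.rawRing L) → KAlgebra
  fieldExtension L φ = record { commutativeRing = Field.commutativeRing L ; structure = φ }

  -- Exactness of 0 → 𝔾ₐᵃ → 𝔾ₐᵇ → 𝔾ₐˢ → 0 as a sequence of algebraic groups:
  -- f is the scheme-theoretic kernel of g (tested on all K-algebras), and g is
  -- a quotient map, that is, surjective as a morphism of schemes: every field-valued
  -- point lifts after a further field extension.
  record IsShortExact {a b s} (f : MatT.Mat b a) (g : MatT.Mat s b) : Set (Level.suc (c₂ ⊔ ℓ₂)) where
    field
      injective : ∀ (R : KAlgebra) → let open Points R in ∀ x y → evalᴹ f x ≈ᵛ evalᴹ f y → x ≈ᵛ y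
      kernel    : ∀ (R : KAlgebra) → let open Points R in ∀ y →
                  evalᴹ g y ≈ᵛ (λ _ → KAlgebra.0# R) ⇔ (∃ λ x → evalᴹ f x ≈ᵛ y)
      surjective : ∀ (L : Field c₂ ℓ₂) (φ : RingHomomorphism K.rawRing (Field.rawRing L)) (y : Vector (Field.Carrier L) s) →
        Σ (Field c₂ ℓ₂) λ L' → Σ (RingHomomorphism (Field.rawRing L) (Field.rawRing L')) λ χ →
        let open Points (fieldExtension L' (Composition.ringHomomorphism {M₁ = K.ring} {Field.ring L} {Field.ring L'} φ χ)) in
        ∃ λ x → evalᴹ g x ≈ᵛ (λ i → ⟦ χ ⟧ (y i))

  MordellWeil : ∀ {d} → TModule d → RawLeftModule A.Carrier c₂ ℓ₂
  MordellWeil {d} Φ = record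
    { Carrierᴹ = Vector K.Carrier d
    ; _≈ᴹ_     = _≈ᵛ_
    ; _+ᴹ_     = λ x y i → x i K.+ y i
    ; _*ₗ_     = λ a x → evalᴹ (TModule.at Φ a) x
    ; 0ᴹ       = λ _ → K.0#
    ; -ᴹ_      = λ x i → K.- x i
    }
    where open Points selfAlgebra

  record TModuleStructure (M : RawLeftModule A.Carrier m ℓm) : Set (c₁ ⊔ ℓ₁ ⊔ c₂ ⊔ ℓ₂ ⊔ m ⊔ ℓm) where
    field
      dim     : ℕ
      tModule : TModule dim
      iso     : RawLeftModule.Carrierᴹ M → Vector K.Carrier dim
      isIso   : LeftModuleMorphisms.IsLeftModuleIsomorphism M (MordellWeil tModule) iso

  module _ {d e} (Φ : TModule d) (Ψ : TModule e) where
    private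
      module Φ = TModule Φ
      module Ψ = TModule Ψ
      module S = Setoid (MatT.matSetoid e d)
      open SetoidReasoning (MatT.matSetoid e d)
      open CommutativeSemigroupProperties T.+-commutativeSemigroup using (interchange)
      open RingHomomorphism Ψ.hom using () renaming (*-homo to Ψ-*; ⟦⟧-cong to Ψ-cong)

    record Der : Set (c₁ ⊔ ℓ₁ ⊔ c₂ ⊔ ℓ₂) where
      field
        δ       : A.Carrier → MatT.Mat e d
        cong    : ∀ {a b} → a A.≈ b → δ a ≈ᴹ δ b
        +-homo  : ∀ a b → δ (a A.+ b) ≈ᴹ δ a +ᴹ δ b
        linear  : ∀ x a → δ (F[t].const x A.* a) ≈ᴹ K⟨τ⟩.const (⟦ η ⟧ x) ·ᴹ δ a
        leibniz : ∀ a b → δ (a A.* b) ≈ᴹ Ψ.at a *ᴹ δ b +ᴹ δ a *ᴹ Φ.at b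
    open Der

    IsInner : (A.Carrier → MatT.Mat e d) → Set (c₁ ⊔ c₂ ⊔ ℓ₂)
    IsInner δ = ∃ λ (U : MatT.Mat e d) → ∀ a → δ a ≈ᴹ U *ᴹ Φ.at a -ᴹ Ψ.at a *ᴹ U

    private
      Ψ-comm : ∀ a b (M : MatT.Mat e d) → Ψ.at a *ᴹ (Ψ.at b *ᴹ M) ≈ᴹ Ψ.at b *ᴹ (Ψ.at a *ᴹ M)
      Ψ-comm a b M = begin
        Ψ.at a *ᴹ (Ψ.at b *ᴹ M)   ≈⟨ MatT.*ᴹ-assoc (Ψ.at a) (Ψ.at b) M ⟨
        Ψ.at a *ᴹ Ψ.at b *ᴹ M     ≈⟨ MatT.*ᴹ-cong (Ψ-* a b) S.refl ⟨
        Ψ.at (a A.* b) *ᴹ M       ≈⟨ MatT.*ᴹ-cong (Ψ-cong (A.*-comm a b)) S.refl ⟩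
        Ψ.at (b A.* a) *ᴹ M       ≈⟨ MatT.*ᴹ-cong (Ψ-* b a) S.refl ⟩
        Ψ.at b *ᴹ Ψ.at a *ᴹ M     ≈⟨ MatT.*ᴹ-assoc (Ψ.at b) (Ψ.at a) M ⟩
        Ψ.at b *ᴹ (Ψ.at a *ᴹ M)   ∎

      Ψ-const : ∀ x (M : MatT.Mat e d) → Ψ.at (F[t].const x) *ᴹ M ≈ᴹ K⟨τ⟩.const (⟦ η ⟧ x) ·ᴹ M
      Ψ-const x M = S.trans (MatT.*ᴹ-cong (Ψ.linear x) S.refl) (MatT.scalar-*ᴹ _ M)

    0ᴰ : Der
    0ᴰ = record
      { δ       = λ _ → 0ᴹ
      ; cong    = λ _ → S.refl
      ; +-homo  = λ a b i j → T.refl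
      ; linear  = λ x a i j → T.sym (T.zeroʳ (K⟨τ⟩.const (⟦ η ⟧ x)))
      ; leibniz = λ a b i j → T.sym (T.trans
          (T.+-cong (MatT.*ᴹ-zeroʳ (Ψ.at a) i j) (MatT.*ᴹ-zeroˡ (Φ.at b) i j)) (T.+-identityˡ _)) }

    _+ᴰ_ : Der → Der → Der
    D +ᴰ D' = record
      { δ       = λ a → δ D a +ᴹ δ D' a
      ; cong    = λ p i j → T.+-cong (cong D p i j) (cong D' p i j)
      ; +-homo  = λ a b i j → T.trans (T.+-cong (+-homo D a b i j) (+-homo D' a b i j))
          (interchange (δ D a i j) (δ D b i j) (δ D' a i j) (δ D' b i j))
      ; linear  = λ x a i j → T.trans (T.+-cong (linear D x a i j) (linear D' x a i j))
          (T.sym (T.distribˡ (K⟨τ⟩.const (⟦ η ⟧ x)) (δ D a i j) (δ D' a i j)))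
      ; leibniz = λ a b i j → T.trans (T.+-cong (leibniz D a b i j) (leibniz D' a b i j))
          (T.trans (interchange ((Ψ.at a *ᴹ δ D b) i j) ((δ D a *ᴹ Φ.at b) i j)
                                ((Ψ.at a *ᴹ δ D' b) i j) ((δ D' a *ᴹ Φ.at b) i j))
            (T.sym (T.+-cong (MatT.*ᴹ-distribˡ (Ψ.at a) (δ D b) (δ D' b) i j)
                             (MatT.*ᴹ-distribʳ (Φ.at b) (δ D a) (δ D' a) i j)))) }

    -ᴰ_ : Der → Der
    -ᴰ D = record
      { δ       = λ a → -ᴹ δ D a
      ; cong    = λ p i j → T.-‿cong (cong D p i j)
      ; +-homo  = λ a b i j → T.trans (T.-‿cong (+-homo D a b i j)) (neg-+ (δ D a i j) (δ D b i j))
      ; linear  = λ x a i j → T.trans (T.-‿cong (linear D x a i j))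
          (RingProperties.-‿distribʳ-* K⟨τ⟩.ring (K⟨τ⟩.const (⟦ η ⟧ x)) (δ D a i j))
      ; leibniz = λ a b i j → T.trans (T.-‿cong (leibniz D a b i j))
          (T.trans (neg-+ ((Ψ.at a *ᴹ δ D b) i j) ((δ D a *ᴹ Φ.at b) i j))
            (T.sym (T.+-cong (MatT.*ᴹ-negʳ (Ψ.at a) (δ D b) i j)
                             (MatT.*ᴹ-negˡ (δ D a) (Φ.at b) i j)))) }
      where
      neg-+ : ∀ f g → T.- (f T.+ g) T.≈ T.- f T.+ T.- g
      neg-+ f g = T.sym (AbelianGroupProperties.⁻¹-∙-comm T.+-abelianGroup f g)

    _*ᴰ_ : A.Carrier → Der → Der
    c *ᴰ D = record
      { δ       = λ a → Ψ.at c *ᴹ δ D a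
      ; cong    = λ p → MatT.*ᴹ-cong {M = Ψ.at c} (λ i j → T.refl) (cong D p)
      ; +-homo  = λ a b → S.trans (MatT.*ᴹ-cong {M = Ψ.at c} (λ i j → T.refl) (+-homo D a b))
                                  (MatT.*ᴹ-distribˡ (Ψ.at c) (δ D a) (δ D b))
      ; linear  = λ x a → begin
          Ψ.at c *ᴹ δ D (F[t].const x A.* a)
            ≈⟨ MatT.*ᴹ-cong {M = Ψ.at c} (λ i j → T.refl) (linear D x a) ⟩
          Ψ.at c *ᴹ (K⟨τ⟩.const (⟦ η ⟧ x) ·ᴹ δ D a)
            ≈⟨ MatT.*ᴹ-cong {M = Ψ.at c} (λ i j → T.refl) (Ψ-const x (δ D a)) ⟨
          Ψ.at c *ᴹ (Ψ.at (F[t].const x) *ᴹ δ D a)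
            ≈⟨ Ψ-comm c (F[t].const x) (δ D a) ⟩
          Ψ.at (F[t].const x) *ᴹ (Ψ.at c *ᴹ δ D a)
            ≈⟨ Ψ-const x (Ψ.at c *ᴹ δ D a) ⟩
          K⟨τ⟩.const (⟦ η ⟧ x) ·ᴹ (Ψ.at c *ᴹ δ D a) ∎
      ; leibniz = λ a b → begin
          Ψ.at c *ᴹ δ D (a A.* b)
            ≈⟨ MatT.*ᴹ-cong {M = Ψ.at c} (λ i j → T.refl) (leibniz D a b) ⟩
          Ψ.at c *ᴹ (Ψ.at a *ᴹ δ D b +ᴹ δ D a *ᴹ Φ.at b)
            ≈⟨ MatT.*ᴹ-distribˡ (Ψ.at c) (Ψ.at a *ᴹ δ D b) (δ D a *ᴹ Φ.at b) ⟩
          Ψ.at c *ᴹ (Ψ.at a *ᴹ δ D b) +ᴹ Ψ.at c *ᴹ (δ D a *ᴹ Φ.at b)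
            ≈⟨ (λ i j → T.+-cong (Ψ-comm c a (δ D b) i j)
                                 (T.sym (MatT.*ᴹ-assoc (Ψ.at c) (δ D a) (Φ.at b) i j))) ⟩
          Ψ.at a *ᴹ (Ψ.at c *ᴹ δ D b) +ᴹ Ψ.at c *ᴹ δ D a *ᴹ Φ.at b ∎ }

    -- The quotient Der / Der_in is the setoid of derivations modulo inner ones.
    Ext : RawLeftModule A.Carrier (c₁ ⊔ ℓ₁ ⊔ c₂ ⊔ ℓ₂) (c₁ ⊔ c₂ ⊔ ℓ₂)
    Ext = record
      { Carrierᴹ = Der
      ; _≈ᴹ_     = λ D D' → IsInner (λ a → δ D a -ᴹ δ D' a)
      ; _+ᴹ_     = _+ᴰ_
      ; _*ₗ_     = _*ᴰ_
      ; 0ᴹ       = 0ᴰ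
      ; -ᴹ_      = -ᴰ_
      }

    InDer₀ : Der → Set ℓ₂
    InDer₀ D = coeffᴹ (δ D F[t].t) 0 MatK.≈ᴹ MatK.0ᴹ

    Der₀ : Set (c₁ ⊔ ℓ₁ ⊔ c₂ ⊔ ℓ₂)
    Der₀ = Σ Der InDer₀

    Ext₀ : RawLeftModule A.Carrier (c₁ ⊔ ℓ₁ ⊔ c₂ ⊔ ℓ₂) (c₁ ⊔ c₂ ⊔ ℓ₂)
    Ext₀ = record
      { Carrierᴹ = Der₀
      ; _≈ᴹ_     = λ D D' → IsInner (λ a → δ (proj₁ D) a -ᴹ δ (proj₁ D') a)
      ; _+ᴹ_     = λ (D , z) (D' , z') → D +ᴰ D' , λ i j →
          K.trans (K⟨τ⟩.coeff-+ (δ D F[t].t i j) (δ D' F[t].t i j) 0)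
                  (K.trans (K.+-cong (z i j) (z' i j)) (K.+-identityˡ K.0#))
      ; _*ₗ_     = λ c (D , z) → c *ᴰ D , λ i j →
          K.trans (coeff₀-sum (λ h → Ψ.at c i h) (λ h → δ D F[t].t h j) (λ h → z h j)) K.refl
      ; 0ᴹ       = 0ᴰ , λ i j → K.refl
      ; -ᴹ_      = λ (D , z) → -ᴰ D , λ i j →
          K.trans (K⟨τ⟩.coeff-neg (δ D F[t].t i j) 0)
                  (K.trans (K.-‿cong (z i j)) (RingProperties.-0#≈0# K.ring))
      }
      where
      open Sum T.semiring using (sum)
      coeff₀-sum : ∀ {n} (f g : Vector K⟨τ⟩.Poly n) → (∀ h → K⟨τ⟩.coeff (g h) 0 K.≈ K.0#) →
                   K⟨τ⟩.coeff (sum (λ h → f h T.* g h)) 0 K.≈ K.0#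
      coeff₀-sum {zero}  f g z = K.refl
      coeff₀-sum {suc n} f g z = K.trans
        (K⟨τ⟩.coeff-+ (f zero T.* g zero) (sum (λ h → f (suc h) T.* g (suc h))) 0)
        (K.trans (K.+-cong
            (K.trans (K⟨τ⟩.coeff₀-* (f zero) (g zero)) (K.trans (K.*-congˡ (z zero)) (K.zeroʳ _)))
            (coeff₀-sum (f ∘ suc) (g ∘ suc) (z ∘ suc)))
          (K.+-identityˡ K.0#))

    record ExtSequence (E₀ : TModuleStructure Ext₀) (E : TModuleStructure Ext)
                       {s} (G : TModule s) : Set (Level.suc (c₁ ⊔ ℓ₁ ⊔ c₂ ⊔ ℓ₂)) where
      private
        module E₀ = TModuleStructure E₀
        module E  = TModuleStructure E
      open Points selfAlgebra
      field
        f            : MatT.Mat E.dim E₀.dim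
        g            : MatT.Mat s E.dim
        f-isMorphism : IsMorphism E₀.tModule E.tModule f
        g-isMorphism : IsMorphism E.tModule G g
        isShortExact : IsShortExact f g
        inclusion    : ∀ (D : Der₀) → E.iso (proj₁ D) ≈ᵛ evalᴹ f (E₀.iso D)

  IsZeroRow : ∀ {k l} → MatK.Mat k l → Fin k → Set ℓ₂
  IsZeroRow M i = ∀ j → M i j K.≈ K.0#

  zeroRows : ∀ {k l} → MatK.Mat k l → ℕ
  zeroRows {k} M = length (filter (λ i → Fin.all? (λ j → M i j K.≟ K.0#)) (allFin k))

  -- Zero rows are to be counted after row reduction: R arises from M by invertible
  -- row operations and its nonzero rows are linearly independent, so zeroRows R is
  -- the corank of M.  R = M is allowed when the nonzero rows of M are already
  -- independent.  Without reduction the count can be too small: a matrix with both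
  -- rows (1, -1) has no zero row but corank 1.
  record IsRowReduction {k l} (M R : MatK.Mat k l) : Set (c₂ ⊔ ℓ₂) where
    open Sum K.semiring using (sum)
    field
      P P⁻¹          : MatK.Mat k k
      P-invertible   : MatK.IsInverse P P⁻¹
      P*M≈R          : P MatK.*ᴹ M MatK.≈ᴹ R
      rowIndependent : ∀ (x : Vector K.Carrier k) →
                       (∀ i → IsZeroRow R i → x i K.≈ K.0#) →
                       (∀ j → sum (λ i → x i K.* R i j) K.≈ K.0#) →
                       ∀ i → x i K.≈ K.0#

{-# OPTIONS --safe #-}

-- A derivation is determined by its value at t, an arbitrary row W over K{τ}, and it is inner iff
-- W = U Φ_t − ψ_t U for some U.  As Aₙ is invertible and deg ψ_t < n, dividing by Φ_t leaves a unique
-- representative of degree < n, so Ext¹ ≅ K^(nd).  The coordinates of the remainder of w τᵏ are given by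
-- a matrix Ρ k of twisted polynomials in w, and t acts through ψ_t, whose terms b_j τʲ with j ≥ 1 are
-- the only ones to be reduced: hence its matrix Π has constant term θ.
--
-- The inner derivation of a constant row v has constant term v N, so Ext₀ is the part of Ext¹
-- whose constant coefficient lies in the row space of N, and Ext¹ / Ext₀ ≅ coker N.  Row reduction
-- of Aₙ⁻¹ N, completed to an invertible matrix, splits Kᵈ accordingly, and both maps of the
-- sequence are matrices of constants.

module Submission where

open import Algebra.Bundles using (AbelianGroup; CommutativeMonoid; CommutativeRing; Ring)
open import Algebra.Morphism.Bundles using (RingHomomorphism)
import Algebra.Morphism.Construct.Composition as Composition
import Algebra.Morphism.Construct.Identity as Identity
import Algebra.Properties.AbelianGroup as AbelianGroupProperties
import Algebra.Properties.CommutativeMonoid.Sum as MonoidSum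
import Algebra.Properties.CommutativeSemigroup as CommutativeSemigroupProperties
import Algebra.Properties.CommutativeSemiring.Exp as Exp
import Algebra.Properties.Ring as RingProperties
import Algebra.Properties.Semiring.Mult as Mult
import Algebra.Properties.Semiring.Sum as Sum
open import Data.Bool.Base using (Bool; if_then_else_; true; false; _∨_)
import Data.Bool.Properties as Bool
open import Data.Fin.Base as Fin
  using (Fin; zero; suc; toℕ; fromℕ; fromℕ<; inject₁; combine; remQuot; splitAt; _↑ˡ_; _↑ʳ_)
open import Data.Fin.Permutation using (Permutation; permutation)
import Data.Fin.Properties as Fin
open import Data.List.Base as List using (List; []; _∷_; map; length; filter; allFin; tabulate)
import Data.List.Membership.Propositional.Properties as ∈
import Data.List.Properties as List
open import Data.List.Relation.Unary.All as All using (All; all?)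
import Data.List.Relation.Unary.All.Properties as All
open import Data.List.Relation.Unary.AllPairs.Core using (_∷_)
open import Data.List.Relation.Unary.Unique.Propositional using (Unique)
import Data.List.Relation.Unary.Unique.Propositional.Properties as Unique
open import Data.Nat.Base as ℕ using (ℕ; zero; suc; _<_; _≤_)
import Data.Nat.Properties as ℕ
open import Data.Product.Base using (∃; Σ; _×_; _,_; proj₁; proj₂)
open import Data.Sum.Base using (_⊎_; inj₁; inj₂; [_,_]′)
open import Data.Vec.Functional as Vector using (Vector)
open import Function.Base using (_∘_; id)
open import Function.Bundles using (Inverse; mk⇔)
open import Level using (Level; _⊔_)
open import Relation.Binary.Bundles using (Setoid)
open import Relation.Binary.PropositionalEquality as ≡ using (_≡_; _≢_)
import Relation.Binary.Reasoning.Setoid as SetoidReasoning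
open import Relation.Nullary using (Dec; yes; no; does; ¬_; ¬?; contradiction; _×-dec_)
open import Relation.Nullary.Decidable using (dec-true; dec-false)
open import Relation.Unary using (Pred; Decidable)
open import Defs

-- Division by Φ_t takes no q-th roots: the top coefficient of u τᵏ Φ_t is u times the k-fold
-- Frobenius twist of Aₙ, so u is found by linear algebra over K. The terms that replace w τ^(k+n)
-- involve Frobenius powers of u, so the remainder is additive but not K-linear in w; this is why
-- `Ρ` has entries in K{τ} and acts by evaluation. Uniqueness of the remainder is not argued by
-- degrees. The map `ρ` is defined from `Ρ`, and three facts about it suffice: it vanishes on the
-- values at t of inner derivations, it reads off the coefficients of a row of degree < n, and every
-- row is such a row plus an inner value. Morphisms are identities over K{τ}, and K may be finite,
-- when a twisted polynomial is not determined by its values on K. So the compatibility of `Π` with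
-- the quotient map is proved for the matrices themselves, by following Λ through the recurrence.
-- Zero rows enter because a row reduction of Aₙ⁻¹ N has the row space of N: its nonzero rows are a
-- basis of that space, and the zero rows count the dimension of coker N.

private
  variable
    c ℓ ℓp c₁ ℓ₁ c₂ ℓ₂ : Level

-- Finite sums in a commutative monoid, also read as products in a field.

module Sums (M : CommutativeMonoid c ℓ) where
  open CommutativeMonoid M renaming (_∙_ to _+_; ε to 0#)
  open MonoidSum M public
  open SetoidReasoning setoid

  sum-0 : ∀ {n} (f : Vector Carrier n) → (∀ i → f i ≈ 0#) → sum f ≈ 0#
  sum-0 {n} f p = trans (sum-cong-≋ p) (sum-replicate-zero n)

  sum-single : ∀ {n} (f : Vector Carrier n) i → (∀ j → j ≢ i → f j ≈ 0#) → sum f ≈ f i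
  sum-single f zero p =
    trans (∙-congˡ (sum-0 (f ∘ suc) (λ j → p (suc j) λ ()))) (identityʳ _)
  sum-single f (suc i) p = trans (∙-congʳ (p zero λ ()))
    (trans (identityˡ _) (sum-single (f ∘ suc) i λ j j≢i → p (suc j) (j≢i ∘ Fin.suc-injective)))

  sum-↑ : ∀ m {n} (f : Vector Carrier (m ℕ.+ n)) →
          sum f ≈ sum (λ i → f (i ↑ˡ n)) + sum (λ i → f (m ↑ʳ i))
  sum-↑ zero    f = sym (identityˡ _)
  sum-↑ (suc m) f = trans (∙-congˡ (sum-↑ m (f ∘ suc))) (sym (assoc _ _ _))

  sum-combine : ∀ n {d} (f : Vector Carrier (n ℕ.* d)) →
                sum f ≈ sum (λ i → sum (λ j → f (Fin.combine {n} {d} i j)))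
  sum-combine zero    {d} f = refl
  sum-combine (suc n) {d} f = trans (sum-↑ d f) (∙-congˡ {x = sum (λ i → f (i ↑ˡ n ℕ.* d))} (sum-combine n (λ i → f (d ↑ʳ i))))

-- Fermat's theorem for a field with q elements.

module FiniteField (F : Field c ℓ) {q : ℕ} (finite : Inverse (Field.setoid F) (≡.setoid (Fin q))) where
  open Field F hiding (zero)
  open Inverse finite using (to; from; to-cong; strictlyInverseˡ; strictlyInverseʳ)
  open Exp commutativeSemiring using (_^_; ^-congˡ)
  private
    open module Prod = Sums *-commutativeMonoid using () renaming (sum to product)
    open SetoidReasoning setoid

    -- An element of `Fin n` certifies n ≠ 0, without which the power would be 1.
    0^Fin : ∀ {n} → Fin n → 0# ^ n ≈ 0#
    0^Fin {suc n} _ = zeroˡ _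

    if-zero : Carrier → Carrier → Carrier → Carrier
    if-zero a b y = if does (y ≟ 0#) then a else b

    if-zero-yes : ∀ {a b y} → y ≈ 0# → if-zero a b y ≈ a
    if-zero-yes {y = y} p with y ≟ 0#
    ... | yes _ = refl
    ... | no ¬p = contradiction p ¬p

    if-zero-no : ∀ {a b y} → y ≉ 0# → if-zero a b y ≈ b
    if-zero-no {y = y} ¬p with y ≟ 0#
    ... | yes p = contradiction p ¬p
    ... | no _  = refl

    -- Replacing 0 by 1 makes the product over all of F the product of its nonzero elements, so that
    -- no subset has to be enumerated.
    unit : Carrier → Carrier
    unit y = if-zero 1# y y

    unit-cong : ∀ {y y'} → y ≈ y' → unit y ≈ unit y'
    unit-cong {y} {y'} p with y ≟ 0# | y' ≟ 0#
    ... | yes _ | yes _ = refl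
    ... | no _  | no _  = p
    ... | yes z | no z' = contradiction (trans (sym p) z) z'
    ... | no z  | yes z' = contradiction (trans p z') z

    unit-invertible : ∀ y → ∃ λ y⁻¹ → unit y * y⁻¹ ≈ 1#
    unit-invertible y with y ≟ 0#
    ... | yes _ = 1# , *-identityˡ 1#
    ... | no z  = inverse y z

    product-invertible : ∀ {n} (f : Vector Carrier n) → (∀ i → ∃ λ y → f i * y ≈ 1#) → ∃ λ y → product f * y ≈ 1#
    product-invertible {zero}  f inv = 1# , *-identityˡ 1#
    product-invertible {suc n} f inv with inv zero | product-invertible (f ∘ suc) (inv ∘ suc)
    ... | y , p | z , r = z * y , (begin
      f zero * Π * (z * y)     ≈⟨ *-assoc _ _ _ ⟩
      f zero * (Π * (z * y))   ≈⟨ *-congˡ (*-assoc _ _ _) ⟨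
      f zero * (Π * z * y)     ≈⟨ *-congˡ (trans (*-congʳ r) (*-identityˡ y)) ⟩
      f zero * y               ≈⟨ p ⟩
      1#                       ∎)
      where Π = product (f ∘ suc)

    product-replicate : ∀ n x → product {n} (λ _ → x) ≈ x ^ n
    product-replicate zero    x = refl
    product-replicate (suc n) x = *-congˡ (product-replicate n x)

  -- Multiplication by x ≠ 0 permutes F, so the product of the nonzero elements equals itself times x^(q-1).
  x^q≈x : ∀ x → x ^ q ≈ x
  x^q≈x x with x ≟ 0#
  ... | yes x≈0 = trans (^-congˡ q x≈0) (trans (0^Fin (to 0#)) (sym x≈0))
  ... | no x≉0 = begin
    x ^ q                                ≈⟨ product-replicate q x ⟨
    product {q} (λ _ → x)                ≈⟨ Prod.sum-cong-≋ (λ i → w*z (from i)) ⟨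
    product (λ i → w (from i) * z (from i)) ≈⟨ Prod.∑-distrib-+ (w ∘ from) (z ∘ from) ⟩
    product (w ∘ from) * product (z ∘ from) ≈⟨ *-cong Πw≈1 Πz≈x ⟩
    1# * x                               ≈⟨ *-identityˡ x ⟩
    x                                    ∎
    where
    x⁻¹ = proj₁ (inverse x x≉0)
    x*x⁻¹ : x * x⁻¹ ≈ 1#
    x*x⁻¹ = proj₂ (inverse x x≉0)
    -- At every y the factor x is w y times z y, with x placed in w for y ≠ 0 and in z for y = 0.
    -- The product of w is x^(q-1) = 1 and that of z is x.
    w z : Carrier → Carrier
    w = if-zero 1# x
    z = if-zero x 1#
    cancel : ∀ {a b} → a * b ≈ 1# → ∀ y → a * (b * y) ≈ y
    cancel ab y = trans (sym (*-assoc _ _ _)) (trans (*-congʳ ab) (*-identityˡ y))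
    w*z : ∀ y → w y * z y ≈ x
    w*z y with y ≟ 0#
    ... | yes _ = *-identityˡ x
    ... | no _  = *-identityʳ x
    unit-x* : ∀ y → unit (x * y) ≈ w y * unit y
    unit-x* y = unit-x*' (y ≟ 0#)
      where
      unit-x*' : Dec (y ≈ 0#) → unit (x * y) ≈ w y * unit y
      unit-x*' (yes p) = trans (if-zero-yes (trans (*-congˡ p) (zeroʳ x)))
        (sym (trans (*-cong (if-zero-yes p) (if-zero-yes p)) (*-identityˡ 1#)))
      unit-x*' (no ¬p) = trans (if-zero-no λ xy≈0 → ¬p (trans (sym (cancel (trans (*-comm _ _) x*x⁻¹) y)) (trans (*-congˡ xy≈0) (zeroʳ _))))
        (sym (*-cong (if-zero-no ¬p) (if-zero-no ¬p)))
    times : Carrier → Fin q → Fin q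
    times y i = to (y * from i)
    times-inverse : ∀ a b → a * b ≈ 1# → ∀ i → times a (times b i) ≡ i
    times-inverse a b ab i = ≡.trans
      (to-cong (trans (*-congˡ (strictlyInverseʳ (b * from i))) (cancel ab (from i)))) (strictlyInverseˡ i)
    π : Permutation q q
    π = permutation (times x) (times x⁻¹) (times-inverse x x⁻¹ x*x⁻¹) (times-inverse x⁻¹ x (trans (*-comm _ _) x*x⁻¹))
    Πunit = product (unit ∘ from)
    Πw*Πunit : product (w ∘ from) * Πunit ≈ Πunit
    Πw*Πunit = begin
      product (w ∘ from) * Πunit                        ≈⟨ Prod.∑-distrib-+ (w ∘ from) (unit ∘ from) ⟨
      product (λ i → w (from i) * unit (from i))        ≈⟨ Prod.sum-cong-≋ (λ i → unit-x* (from i)) ⟨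
      product (λ i → unit (x * from i))                 ≈⟨ Prod.sum-cong-≋ (λ i → unit-cong (strictlyInverseʳ (x * from i))) ⟨
      product (λ i → unit (from (times x i)))           ≈⟨ Prod.sum-permute (unit ∘ from) π ⟨
      Πunit                                             ∎
    Πw≈1 : product (w ∘ from) ≈ 1#
    Πw≈1 with product-invertible (unit ∘ from) (unit-invertible ∘ from)
    ... | y , p = begin
      product (w ∘ from)                ≈⟨ *-identityʳ _ ⟨
      product (w ∘ from) * 1#           ≈⟨ *-congˡ p ⟨
      product (w ∘ from) * (Πunit * y)  ≈⟨ *-assoc _ _ _ ⟨
      product (w ∘ from) * Πunit * y    ≈⟨ *-congʳ Πw*Πunit ⟩
      Πunit * y                         ≈⟨ p ⟩
      1#                                ∎
    Πz≈x : product (z ∘ from) ≈ x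
    Πz≈x = trans (Prod.sum-single (z ∘ from) (to 0#) λ j j≢ → if-zero-no λ p →
        j≢ (≡.trans (≡.sym (strictlyInverseˡ j)) (to-cong p)))
      (if-zero-yes (strictlyInverseʳ 0#))

-- Matrices over a noncommutative ring and their block forms.

module MatrixRing (R : Ring c ℓ) where
  open Ring R hiding (zero)
  open Matrices R
  open Sums +-commutativeMonoid

  module ≈ᴹ {k l} = Setoid (matSetoid k l)

  scalar-diagonal : ∀ {k} x (i : Fin k) → scalar x i i ≈ x
  scalar-diagonal x i with i Fin.≟ i
  ... | yes _  = refl
  ... | no i≢i = contradiction ≡.refl i≢i

  scalar-off : ∀ {k} x {i j : Fin k} → i ≢ j → scalar x i j ≈ 0#
  scalar-off x {i} {j} i≢j with i Fin.≟ j
  ... | yes i≡j = contradiction i≡j i≢j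
  ... | no _    = refl

  scalar-comm : ∀ {k} x (i j : Fin k) → scalar x i j ≈ scalar x j i
  scalar-comm x i j with i Fin.≟ j
  ... | yes ≡.refl = sym (scalar-diagonal x i)
  ... | no i≢j     = sym (scalar-off x (i≢j ∘ ≡.sym))

  1ᴹ-diagonal : ∀ {k} (i : Fin k) → 1ᴹ i i ≈ 1#
  1ᴹ-diagonal = scalar-diagonal 1#

  1ᴹ-off : ∀ {k} {i j : Fin k} → i ≢ j → 1ᴹ i j ≈ 0#
  1ᴹ-off = scalar-off 1#

  1ᴹ-comm : ∀ {k} (i j : Fin k) → 1ᴹ i j ≈ 1ᴹ j i
  1ᴹ-comm = scalar-comm 1#

  1ᴹ-injective : ∀ {k l} (e : Fin k → Fin l) → (∀ {i j} → e i ≡ e j → i ≡ j) → ∀ i j → 1ᴹ i j ≈ 1ᴹ (e i) (e j)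
  1ᴹ-injective e inj i j with i Fin.≟ j
  ... | yes ≡.refl = sym (1ᴹ-diagonal (e i))
  ... | no i≢j     = sym (1ᴹ-off (i≢j ∘ inj))

  *ᴹ-congˡ : ∀ {k l n} (M : Mat k l) {N N' : Mat l n} → N ≈ᴹ N' → M *ᴹ N ≈ᴹ M *ᴹ N'
  *ᴹ-congˡ M = *ᴹ-cong {M = M} {M} ≈ᴹ.refl

  *ᴹ-congʳ : ∀ {k l n} (N : Mat l n) {M M' : Mat k l} → M ≈ᴹ M' → M *ᴹ N ≈ᴹ M' *ᴹ N
  *ᴹ-congʳ N p = *ᴹ-cong {N = N} {N} p ≈ᴹ.refl

  *ᴹ-identityˡ : ∀ {k l} (M : Mat k l) → 1ᴹ *ᴹ M ≈ᴹ M
  *ᴹ-identityˡ M i j = trans (scalar-*ᴹ 1# M i j) (*-identityˡ _)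

  *ᴹ-identityʳ : ∀ {k l} (M : Mat k l) → M *ᴹ 1ᴹ ≈ᴹ M
  *ᴹ-identityʳ M i j = trans
    (sum-single (λ h → M i h * 1ᴹ h j) j λ h h≢j → trans (*-congˡ (1ᴹ-off h≢j)) (zeroʳ _))
    (trans (*-congˡ (1ᴹ-diagonal j)) (*-identityʳ _))

  +ᴹ-cong : ∀ {k l} {M M' N N' : Mat k l} → M ≈ᴹ M' → N ≈ᴹ N' → M +ᴹ N ≈ᴹ M' +ᴹ N'
  +ᴹ-cong p q i j = +-cong (p i j) (q i j)

  matRing : ℕ → Ring c ℓ
  matRing k = record
    { Carrier = Mat k k ; _≈_ = _≈ᴹ_ ; _+_ = _+ᴹ_ ; _*_ = _*ᴹ_ ; -_ = -ᴹ_ ; 0# = 0ᴹ ; 1# = 1ᴹ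
    ; isRing = record
      { +-isAbelianGroup = record
        { isGroup = record
          { isMonoid = record
            { isSemigroup = record
              { isMagma = record { isEquivalence = ≈ᴹ.isEquivalence ; ∙-cong = +ᴹ-cong }
              ; assoc = λ L M N i j → +-assoc _ _ _ }
            ; identity = (λ M i j → +-identityˡ _) , (λ M i j → +-identityʳ _) }
          ; inverse = (λ M i j → -‿inverseˡ _) , (λ M i j → -‿inverseʳ _)
          ; ⁻¹-cong = λ p i j → -‿cong (p i j) }
        ; comm = λ M N i j → +-comm _ _ }
      ; *-cong = *ᴹ-cong
      ; *-assoc = *ᴹ-assoc
      ; *-identity = *ᴹ-identityˡ , *ᴹ-identityʳ
      ; distrib = *ᴹ-distribˡ , *ᴹ-distribʳ } }

  -- The block matrices X ⊕ 1, (X | 0) and its analogue for columns.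
  extend : ∀ m {k l} → Mat k l → Mat (k ℕ.+ m) (l ℕ.+ m)
  extend m {k} {l} X i j = [ (λ i' → [ X i' , (λ _ → 0#) ]′ (splitAt l j)) , (λ i' → [ (λ _ → 0#) , 1ᴹ i' ]′ (splitAt l j)) ]′ (splitAt k i)

  padRight : ∀ m {k l} → Mat k l → Mat k (l ℕ.+ m)
  padRight m {l = l} X i j = [ X i , (λ _ → 0#) ]′ (splitAt l j)

  padDown : ∀ m {k l} → Mat k l → Mat (k ℕ.+ m) l
  padDown m {k} X i j = [ (λ i' → X i' j) , (λ _ → 0#) ]′ (splitAt k i)

  ↑-elim : ∀ k {m} {P : Fin (k ℕ.+ m) → Set ℓ} → (∀ i → P (i ↑ˡ m)) → (∀ i → P (k ↑ʳ i)) → ∀ i → P i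
  ↑-elim k {m} {P} l r i = ≡.subst P (Fin.join-splitAt k m i) (by (splitAt k i))
    where
    by : ∀ s → P (Fin.join k m s)
    by (inj₁ i) = l i
    by (inj₂ i) = r i

  private
    module _ (m : ℕ) {k l} (X : Mat k l) where
      extendˡˡ : ∀ i j → extend m X (i ↑ˡ m) (j ↑ˡ m) ≡ X i j
      extendˡˡ i j rewrite Fin.splitAt-↑ˡ k i m | Fin.splitAt-↑ˡ l j m = ≡.refl

      extendˡʳ : ∀ i j → extend m X (i ↑ˡ m) (l ↑ʳ j) ≡ 0#
      extendˡʳ i j rewrite Fin.splitAt-↑ˡ k i m | Fin.splitAt-↑ʳ l m j = ≡.refl

      extendʳˡ : ∀ i j → extend m X (k ↑ʳ i) (j ↑ˡ m) ≡ 0#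
      extendʳˡ i j rewrite Fin.splitAt-↑ʳ k m i | Fin.splitAt-↑ˡ l j m = ≡.refl

      extendʳʳ : ∀ i j → extend m X (k ↑ʳ i) (l ↑ʳ j) ≡ 1ᴹ i j
      extendʳʳ i j rewrite Fin.splitAt-↑ʳ k m i | Fin.splitAt-↑ʳ l m j = ≡.refl

      padDownˡ : ∀ i j → padDown m X (i ↑ˡ m) j ≡ X i j
      padDownˡ i j rewrite Fin.splitAt-↑ˡ k i m = ≡.refl

      padDownʳ : ∀ i j → padDown m X (k ↑ʳ i) j ≡ 0#
      padDownʳ i j rewrite Fin.splitAt-↑ʳ k m i = ≡.refl

  module _ (m : ℕ) {k l} (X : Mat k l) where
    padRightˡ : ∀ i j → padRight m X i (j ↑ˡ m) ≡ X i j
    padRightˡ i j rewrite Fin.splitAt-↑ˡ l j m = ≡.refl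

    padRightʳ : ∀ i j → padRight m X i (l ↑ʳ j) ≡ 0#
    padRightʳ i j rewrite Fin.splitAt-↑ʳ l m j = ≡.refl

  private
    block-* : ∀ l m {k n} (X : Mat k (l ℕ.+ m)) (Y : Mat (l ℕ.+ m) n) i j →
      (X *ᴹ Y) i j ≈ sum (λ h → X i (h ↑ˡ m) * Y (h ↑ˡ m) j) + sum (λ h → X i (l ↑ʳ h) * Y (l ↑ʳ h) j)
    block-* l m X Y i j = sum-↑ l (λ h → X i h * Y h j)

    *0 : ∀ {n} (f g : Vector Carrier n) → (∀ h → g h ≡ 0#) → sum (λ h → f h * g h) ≈ 0#
    *0 f g p = sum-0 (λ h → f h * g h) λ h → trans (*-congˡ (reflexive (p h))) (zeroʳ _)

    0* : ∀ {n} (f g : Vector Carrier n) → (∀ h → f h ≡ 0#) → sum (λ h → f h * g h) ≈ 0#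
    0* f g p = sum-0 (λ h → f h * g h) λ h → trans (*-congʳ (reflexive (p h))) (zeroˡ _)

    same : ∀ {n} {f f' g g' : Vector Carrier n} → (∀ h → f h ≡ f' h) → (∀ h → g h ≡ g' h) →
      sum (λ h → f h * g h) ≈ sum (λ h → f' h * g' h)
    same {n} p q = sum-cong-≋ {n} λ h → *-cong (reflexive (p h)) (reflexive (q h))

  extend-* : ∀ m {k l n} (X : Mat k l) (Y : Mat l n) → extend m X *ᴹ extend m Y ≈ᴹ extend m (X *ᴹ Y)
  extend-* m {k} {l} {n} X Y = ↑-elim k
    (λ i → ↑-elim n
      (λ j → trans (block-* l m (extend m X) (extend m Y) (i ↑ˡ m) (j ↑ˡ m)) (trans
        (+-cong (same (extendˡˡ m X i) (λ h → extendˡˡ m Y h j)) (0* (λ h → extend m X (i ↑ˡ m) (l ↑ʳ h)) (λ h → extend m Y (l ↑ʳ h) (j ↑ˡ m)) (extendˡʳ m X i)))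
        (trans (+-identityʳ _) (reflexive (≡.sym (extendˡˡ m (X *ᴹ Y) i j))))))
      (λ j → trans (block-* l m (extend m X) (extend m Y) (i ↑ˡ m) (n ↑ʳ j)) (trans
        (+-cong (*0 (λ h → extend m X (i ↑ˡ m) (h ↑ˡ m)) (λ h → extend m Y (h ↑ˡ m) (n ↑ʳ j)) (λ h → extendˡʳ m Y h j)) (0* (λ h → extend m X (i ↑ˡ m) (l ↑ʳ h)) (λ h → extend m Y (l ↑ʳ h) (n ↑ʳ j)) (extendˡʳ m X i)))
        (trans (+-identityʳ _) (reflexive (≡.sym (extendˡʳ m (X *ᴹ Y) i j)))))))
    (λ i → ↑-elim n
      (λ j → trans (block-* l m (extend m X) (extend m Y) (k ↑ʳ i) (j ↑ˡ m)) (trans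
        (+-cong (0* (λ h → extend m X (k ↑ʳ i) (h ↑ˡ m)) (λ h → extend m Y (h ↑ˡ m) (j ↑ˡ m)) (extendʳˡ m X i)) (*0 (λ h → extend m X (k ↑ʳ i) (l ↑ʳ h)) (λ h → extend m Y (l ↑ʳ h) (j ↑ˡ m)) (λ h → extendʳˡ m Y h j)))
        (trans (+-identityʳ _) (reflexive (≡.sym (extendʳˡ m (X *ᴹ Y) i j))))))
      (λ j → trans (block-* l m (extend m X) (extend m Y) (k ↑ʳ i) (n ↑ʳ j)) (trans
        (+-cong (0* (λ h → extend m X (k ↑ʳ i) (h ↑ˡ m)) (λ h → extend m Y (h ↑ˡ m) (n ↑ʳ j)) (extendʳˡ m X i)) (same (extendʳʳ m X i) (λ h → extendʳʳ m Y h j)))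
        (trans (+-identityˡ _) (trans (*ᴹ-identityˡ 1ᴹ i j) (reflexive (≡.sym (extendʳʳ m (X *ᴹ Y) i j))))))))

  extend-cong : ∀ m {k l} {X Y : Mat k l} → X ≈ᴹ Y → extend m X ≈ᴹ extend m Y
  extend-cong m {k} {l} {X} {Y} p = ↑-elim k
    (λ i → ↑-elim l (λ j → trans (reflexive (extendˡˡ m X i j)) (trans (p i j) (reflexive (≡.sym (extendˡˡ m Y i j)))))
                    (λ j → reflexive (≡.trans (extendˡʳ m X i j) (≡.sym (extendˡʳ m Y i j)))))
    (λ i → ↑-elim l (λ j → reflexive (≡.trans (extendʳˡ m X i j) (≡.sym (extendʳˡ m Y i j))))
                    (λ j → reflexive (≡.trans (extendʳʳ m X i j) (≡.sym (extendʳʳ m Y i j)))))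

  extend-1 : ∀ m {k} → extend m {k} 1ᴹ ≈ᴹ 1ᴹ
  extend-1 m {k} = ↑-elim k
    (λ i → ↑-elim k
      (λ j → trans (reflexive (extendˡˡ m {k} 1ᴹ i j)) (1ᴹ-injective (_↑ˡ m) (Fin.↑ˡ-injective m _ _) i j))
      (λ j → trans (reflexive (extendˡʳ m {k} 1ᴹ i j)) (sym (1ᴹ-off (↑ˡ≢↑ʳ i j)))))
    (λ i → ↑-elim k
      (λ j → trans (reflexive (extendʳˡ m {k} 1ᴹ i j)) (sym (1ᴹ-off (↑ˡ≢↑ʳ j i ∘ ≡.sym))))
      (λ j → trans (reflexive (extendʳʳ m {k} 1ᴹ i j)) (1ᴹ-injective (k ↑ʳ_) (Fin.↑ʳ-injective k _ _) i j)))
    where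
    ↑ˡ≢↑ʳ : ∀ i j → i ↑ˡ m ≢ k ↑ʳ j
    ↑ˡ≢↑ʳ i j e with ≡.trans (≡.sym (Fin.splitAt-↑ˡ k i m)) (≡.trans (≡.cong (splitAt k) e) (Fin.splitAt-↑ʳ k m j))
    ... | ()

  padRight-padDown : ∀ m {k l n} (X : Mat k l) (Y : Mat l n) → padRight m X *ᴹ padDown m Y ≈ᴹ X *ᴹ Y
  padRight-padDown m {k} {l} {n} X Y i j = trans (block-* l m (padRight m X) (padDown m Y) i j) (trans
    (+-cong (same (padRightˡ m X i) (λ h → padDownˡ m Y h j)) (0* (λ h → padRight m X i (l ↑ʳ h)) (λ h → padDown m Y (l ↑ʳ h) j) (padRightʳ m X i)))
    (+-identityʳ _))

  padRight-extend : ∀ m {k l n} (X : Mat k l) (Y : Mat l n) → X *ᴹ Y ≈ᴹ 0ᴹ → padRight m X *ᴹ extend m Y ≈ᴹ 0ᴹ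
  padRight-extend m {k} {l} {n} X Y p i = ↑-elim n
    (λ j → trans (block-* l m (padRight m X) (extend m Y) i (j ↑ˡ m)) (trans
      (+-cong (trans (same (padRightˡ m X i) (λ h → extendˡˡ m Y h j)) (p i j)) (0* (λ h → padRight m X i (l ↑ʳ h)) (λ h → extend m Y (l ↑ʳ h) (j ↑ˡ m)) (padRightʳ m X i)))
      (+-identityʳ 0#)))
    (λ j → trans (block-* l m (padRight m X) (extend m Y) i (n ↑ʳ j)) (trans
      (+-cong (*0 (λ h → padRight m X i (h ↑ˡ m)) (λ h → extend m Y (h ↑ˡ m) (n ↑ʳ j)) (λ h → extendˡʳ m Y h j)) (0* (λ h → padRight m X i (l ↑ʳ h)) (λ h → extend m Y (l ↑ʳ h) (n ↑ʳ j)) (padRightʳ m X i)))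
      (+-identityʳ 0#)))

  -- The padded factors vanish on the last m indices, where `extend` already supplies the identity.
  -- A decomposition of the identity on the constant coefficients thus passes to all coordinates.
  extend-+ : ∀ m {k l} (X : Mat k k) (Y : Mat k l) (Z : Mat l k) → X +ᴹ Y *ᴹ Z ≈ᴹ 1ᴹ →
    extend m X +ᴹ padDown m Y *ᴹ padRight m Z ≈ᴹ 1ᴹ
  extend-+ m {k} {l} X Y Z p i j = trans (by i j) (trans (extend-cong m p i j) (extend-1 m i j))
    where
    by : extend m X +ᴹ padDown m Y *ᴹ padRight m Z ≈ᴹ extend m (X +ᴹ Y *ᴹ Z)
    by = ↑-elim k
      (λ i → ↑-elim k
        (λ j → trans (+-cong (reflexive (extendˡˡ m X i j)) (same (padDownˡ m Y i) (λ h → padRightˡ m Z h j)))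
          (reflexive (≡.sym (extendˡˡ m (X +ᴹ Y *ᴹ Z) i j))))
        (λ j → trans (+-cong (reflexive (extendˡʳ m X i j)) (*0 (λ h → padDown m Y (i ↑ˡ m) h) (λ h → padRight m Z h (k ↑ʳ j)) (λ h → padRightʳ m Z h j)))
          (trans (+-identityʳ 0#) (reflexive (≡.sym (extendˡʳ m (X +ᴹ Y *ᴹ Z) i j))))))
      (λ i → ↑-elim k
        (λ j → trans (+-cong (reflexive (extendʳˡ m X i j)) (0* (λ h → padDown m Y (k ↑ʳ i) h) (λ h → padRight m Z h (j ↑ˡ m)) (padDownʳ m Y i)))
          (trans (+-identityʳ 0#) (reflexive (≡.sym (extendʳˡ m (X +ᴹ Y *ᴹ Z) i j)))))
        (λ j → trans (+-cong (reflexive (extendʳʳ m X i j)) (0* (λ h → padDown m Y (k ↑ʳ i) h) (λ h → padRight m Z h (k ↑ʳ j)) (padDownʳ m Y i)))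
          (trans (+-identityʳ _) (reflexive (≡.sym (extendʳʳ m (X +ᴹ Y *ᴹ Z) i j))))))

-- Cutting the index set of a sum along a decidable predicate.

module Enumeration (M : CommutativeMonoid c ℓ) where
  open CommutativeMonoid M renaming (_∙_ to _+_; ε to 0#)
  open Sums M
  private
    listSum : ∀ {A : Set} → (A → Carrier) → List A → Carrier
    listSum f []       = 0#
    listSum f (x ∷ xs) = f x + listSum f xs

    sum-lookup : ∀ {A : Set} (f : A → Carrier) xs → sum (f ∘ List.lookup xs) ≈ listSum f xs
    sum-lookup f []       = refl
    sum-lookup f (x ∷ xs) = ∙-congˡ (sum-lookup f xs)

    listSum-tabulate : ∀ {A : Set} {n} (f : A → Carrier) (g : Fin n → A) → listSum f (tabulate g) ≈ sum (f ∘ g)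
    listSum-tabulate {n = zero}  f g = refl
    listSum-tabulate {n = suc n} f g = ∙-congˡ (listSum-tabulate f (g ∘ suc))

    listSum-filter : ∀ {A : Set} {P : Pred A ℓp} (P? : Decidable P) (f : A → Carrier) xs →
      listSum f (filter (¬? ∘ P?) xs) + listSum f (filter P? xs) ≈ listSum f xs
    listSum-filter P? f []       = identityˡ _
    listSum-filter P? f (x ∷ xs) with does (P? x)
    ... | false = trans (assoc _ _ _) (∙-congˡ (listSum-filter P? f xs))
    ... | true  = trans (sym (assoc _ _ _)) (trans (∙-congʳ (comm _ _)) (trans (assoc _ _ _) (∙-congˡ (listSum-filter P? f xs))))

  -- `zeroRows` is the length of a filtered list, so both halves of the index set are enumerated by
  -- looking up in filtered lists.
  sum-filter : ∀ {n} {P : Pred (Fin n) ℓp} (P? : Decidable P) (f : Vector Carrier n) →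
    sum (f ∘ List.lookup (filter (¬? ∘ P?) (allFin n))) + sum (f ∘ List.lookup (filter P? (allFin n))) ≈ sum f
  sum-filter {n = n} P? f = trans
    (∙-cong (sum-lookup f (filter (¬? ∘ P?) (allFin n))) (sum-lookup f (filter P? (allFin n))))
    (trans (listSum-filter P? f (allFin n)) (listSum-tabulate f id))

private
  unique-lookup-injective : ∀ {A : Set} {xs : List A} → Unique xs → ∀ i j → List.lookup xs i ≡ List.lookup xs j → i ≡ j
  unique-lookup-injective (_ ∷ _) zero    zero    _ = ≡.refl
  unique-lookup-injective (p ∷ _) zero    (suc j) e = contradiction e (All.lookup p (∈.∈-lookup j))
  unique-lookup-injective (p ∷ _) (suc i) zero    e = contradiction (≡.sym e) (All.lookup p (∈.∈-lookup i))
  unique-lookup-injective (_ ∷ u) (suc i) (suc j) e = ≡.cong suc (unique-lookup-injective u i j e)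

module _ {n} {P : Pred (Fin n) ℓp} (P? : Decidable P) where
  lookup-filter-injective : ∀ i j → List.lookup (filter P? (allFin n)) i ≡ List.lookup (filter P? (allFin n)) j → i ≡ j
  lookup-filter-injective = unique-lookup-injective (Unique.filter⁺ P? (Unique.allFin⁺ n))

  lookup-filter : ∀ i → P (List.lookup (filter P? (allFin n)) i)
  lookup-filter = λ i → All.lookup (All.all-filter P? (allFin n)) (∈.∈-lookup i)

-- Linear algebra over K: exchange of rows, row reduction, cokernels.

module LinearAlgebra (K : Field c ℓ) where
  open Field K hiding (zero)
  open Matrices ring
  open MatrixRing ring
  open Sums +-commutativeMonoid
  open RingProperties ring using (-‿distribˡ-*)
  open SetoidReasoning setoid

  infixl 7 _ᵛ*_
  _ᵛ*_ : ∀ {k l} → Vector Carrier k → Mat k l → Vector Carrier l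
  x ᵛ* M = ((λ (_ : Fin 1) → x) *ᴹ M) zero

  ᵛ*-assoc : ∀ {k l m} (x : Vector Carrier k) (M : Mat k l) (N : Mat l m) j → (x ᵛ* M ᵛ* N) j ≈ (x ᵛ* (M *ᴹ N)) j
  ᵛ*-assoc x M N = *ᴹ-assoc (λ (_ : Fin 1) → x) M N zero

  ᵛ*-congˡ : ∀ {k l} (x : Vector Carrier k) {M N : Mat k l} → M ≈ᴹ N → ∀ j → (x ᵛ* M) j ≈ (x ᵛ* N) j
  ᵛ*-congˡ x p = *ᴹ-congˡ (λ (_ : Fin 1) → x) p zero

  record GL (d : ℕ) : Set (c ⊔ ℓ) where
    field
      mat mat⁻¹ : Mat d d
      isInverse : IsInverse mat mat⁻¹
  open GL

  module _ {d} {A A⁻¹ B B⁻¹ : Mat d d} where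
    inverse-* : IsInverse A A⁻¹ → IsInverse B B⁻¹ → IsInverse (A *ᴹ B) (B⁻¹ *ᴹ A⁻¹)
    inverse-* (AA⁻¹ , A⁻¹A) (BB⁻¹ , B⁻¹B) = middle A B B⁻¹ A⁻¹ BB⁻¹ AA⁻¹ , middle B⁻¹ A⁻¹ A B A⁻¹A B⁻¹B
      where
      middle : ∀ (W X Y Z : Mat d d) → X *ᴹ Y ≈ᴹ 1ᴹ → W *ᴹ Z ≈ᴹ 1ᴹ → W *ᴹ X *ᴹ (Y *ᴹ Z) ≈ᴹ 1ᴹ
      middle W X Y Z XY WZ = ≈ᴹ.trans (*ᴹ-assoc W X (Y *ᴹ Z)) (≈ᴹ.trans
        (*ᴹ-congˡ W (≈ᴹ.trans (≈ᴹ.sym (*ᴹ-assoc X Y Z)) (≈ᴹ.trans (*ᴹ-congʳ Z XY) (*ᴹ-identityˡ Z)))) WZ)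

  1ᴳ : ∀ {d} → GL d
  1ᴳ = record { mat = 1ᴹ ; mat⁻¹ = 1ᴹ ; isInverse = *ᴹ-identityˡ 1ᴹ , *ᴹ-identityˡ 1ᴹ }

  _*ᴳ_ : ∀ {d} → GL d → GL d → GL d
  P *ᴳ Q = record { isInverse = inverse-* (isInverse P) (isInverse Q) }

  private
    outer : ∀ {d} → Fin d → Vector Carrier d → Mat d d
    outer l v i j = 1ᴹ i l * v j

    outer-*ᴹ : ∀ {d} l v (M : Mat d d) → outer l v *ᴹ M ≈ᴹ outer l (v ᵛ* M)
    outer-*ᴹ l v M i j = trans
      (sum-cong-≋ λ h → *-assoc (1ᴹ i l) (v h) (M h j)) (sym (Sum.*-distribˡ-sum semiring (1ᴹ i l) (λ h → v h * M h j)))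

    -- With e the l-th unit column, (1 + e v)(1 + e w) = 1 + e (v + w + v_l w), because v e = v_l.
    -- The hypothesis says that the bracket vanishes.
    1+outer-* : ∀ {d} l (v w : Vector Carrier d) → (∀ j → v j + (1# + v l) * w j ≈ 0#) →
                (1ᴹ +ᴹ outer l v) *ᴹ (1ᴹ +ᴹ outer l w) ≈ᴹ 1ᴹ
    1+outer-* l v w p i j = begin
      ((1ᴹ +ᴹ outer l v) *ᴹ (1ᴹ +ᴹ outer l w)) i j
        ≈⟨ *ᴹ-distribʳ (1ᴹ +ᴹ outer l w) 1ᴹ (outer l v) i j ⟩
      (1ᴹ *ᴹ (1ᴹ +ᴹ outer l w)) i j + (outer l v *ᴹ (1ᴹ +ᴹ outer l w)) i j
        ≈⟨ +-cong (*ᴹ-identityˡ (1ᴹ +ᴹ outer l w) i j) (outer-*ᴹ l v (1ᴹ +ᴹ outer l w) i j) ⟩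
      1ᴹ i j + e * w j + e * (v ᵛ* (1ᴹ +ᴹ outer l w)) j
        ≈⟨ +-assoc _ _ _ ⟩
      1ᴹ i j + (e * w j + e * (v ᵛ* (1ᴹ +ᴹ outer l w)) j)
        ≈⟨ +-congˡ (distribˡ _ _ _) ⟨
      1ᴹ i j + e * (w j + (v ᵛ* (1ᴹ +ᴹ outer l w)) j)
        ≈⟨ +-congˡ (trans (*-congˡ inner) (zeroʳ e)) ⟩
      1ᴹ i j + 0#
        ≈⟨ +-identityʳ _ ⟩
      1ᴹ i j ∎
      where
      e = 1ᴹ i l
      v*outer : (v ᵛ* outer l w) j ≈ v l * w j
      v*outer = trans (sum-single (λ h → v h * (1ᴹ h l * w j)) l λ h h≢l →
          trans (*-congˡ (trans (*-congʳ (1ᴹ-off h≢l)) (zeroˡ _))) (zeroʳ _))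
        (*-congˡ (trans (*-congʳ (1ᴹ-diagonal l)) (*-identityˡ _)))
      inner : w j + (v ᵛ* (1ᴹ +ᴹ outer l w)) j ≈ 0#
      inner = begin
        w j + (v ᵛ* (1ᴹ +ᴹ outer l w)) j
          ≈⟨ +-congˡ (*ᴹ-distribˡ (λ (_ : Fin 1) → v) 1ᴹ (outer l w) zero j) ⟩
        w j + ((v ᵛ* 1ᴹ) j + (v ᵛ* outer l w) j)
          ≈⟨ +-congˡ (+-cong (*ᴹ-identityʳ (λ (_ : Fin 1) → v) zero j) v*outer) ⟩
        w j + (v j + v l * w j)       ≈⟨ +-assoc _ _ _ ⟨
        w j + v j + v l * w j         ≈⟨ +-congʳ (+-comm _ _) ⟩
        v j + w j + v l * w j         ≈⟨ +-assoc _ _ _ ⟩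
        v j + (w j + v l * w j)       ≈⟨ +-congˡ (+-congʳ (*-identityˡ _)) ⟨
        v j + (1# * w j + v l * w j)  ≈⟨ +-congˡ (distribʳ _ _ _) ⟨
        v j + (1# + v l) * w j        ≈⟨ p j ⟩
        0# ∎

  -- The Sherman-Morrison formula: 1 + e v has inverse 1 - y e v with y = 1/(1 + v_l).
  -- Multiplication by it from the left adds v M to row l of M, so this one family covers scaling,
  -- row addition and replacement of a row.
  elementary : ∀ {d} (l : Fin d) (v : Vector Carrier d) y → (1# + v l) * y ≈ 1# → GL d
  elementary l v y p = record
    { mat = 1ᴹ +ᴹ outer l v ; mat⁻¹ = 1ᴹ +ᴹ outer l (λ j → - y * v j)
    ; isInverse = 1+outer-* l v _ left , 1+outer-* l _ v right }
    where
    left : ∀ j → v j + (1# + v l) * (- y * v j) ≈ 0#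
    left j = begin
      v j + (1# + v l) * (- y * v j)   ≈⟨ +-congˡ (*-assoc _ _ _) ⟨
      v j + (1# + v l) * - y * v j     ≈⟨ +-congˡ (*-congʳ (RingProperties.-‿distribʳ-* ring _ _)) ⟨
      v j + - ((1# + v l) * y) * v j   ≈⟨ +-congˡ (*-congʳ (-‿cong p)) ⟩
      v j + - 1# * v j                 ≈⟨ +-congˡ (RingProperties.-1*x≈-x ring _) ⟩
      v j + - v j                      ≈⟨ -‿inverseʳ _ ⟩
      0#                               ∎
    y-y*v : 1# + - y * v l ≈ y
    y-y*v = begin
      1# + - y * v l                   ≈⟨ +-congʳ p ⟨
      (1# + v l) * y + - y * v l       ≈⟨ +-cong (*-comm _ _) (sym (-‿distribˡ-* _ _)) ⟩
      y * (1# + v l) + - (y * v l)     ≈⟨ +-congʳ (trans (distribˡ _ _ _) (+-congʳ (*-identityʳ y))) ⟩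
      y + y * v l + - (y * v l)        ≈⟨ +-assoc _ _ _ ⟩
      y + (y * v l + - (y * v l))      ≈⟨ +-congˡ (-‿inverseʳ _) ⟩
      y + 0#                           ≈⟨ +-identityʳ y ⟩
      y                                ∎
    right : ∀ j → - y * v j + (1# + - y * v l) * v j ≈ 0#
    right j = begin
      - y * v j + (1# + - y * v l) * v j ≈⟨ +-congˡ (*-congʳ y-y*v) ⟩
      - y * v j + y * v j                ≈⟨ distribʳ _ _ _ ⟨
      (- y + y) * v j                    ≈⟨ *-congʳ (-‿inverseˡ y) ⟩
      0# * v j                           ≈⟨ zeroˡ _ ⟩
      0#                                 ∎

  module _ {d} (l : Fin d) (v : Vector Carrier d) y (p : (1# + v l) * y ≈ 1#) where
    private E = elementary l v y p

    elementary-* : ∀ (M : Mat d d) i j → (mat E *ᴹ M) i j ≈ M i j + 1ᴹ i l * (v ᵛ* M) j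
    elementary-* M i j = trans (*ᴹ-distribʳ M 1ᴹ (outer l v) i j)
      (+-cong (*ᴹ-identityˡ M i j) (outer-*ᴹ l v M i j))

    elementary-row : ∀ (M : Mat d d) j → (mat E *ᴹ M) l j ≈ M l j + (v ᵛ* M) j
    elementary-row M j = trans (elementary-* M l j)
      (+-congˡ (trans (*-congʳ (1ᴹ-diagonal l)) (*-identityˡ _)))

    elementary-rows : ∀ (M : Mat d d) {i} → i ≢ l → ∀ j → (mat E *ᴹ M) i j ≈ M i j
    elementary-rows M i≢l j = trans (elementary-* M _ j)
      (trans (+-congˡ (trans (*-congʳ (1ᴹ-off i≢l)) (zeroˡ _))) (+-identityʳ _))

  -- An invertible matrix is read as the basis formed by its rows.
  coordinates : ∀ {d} → GL d → Vector Carrier d → Vector Carrier d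
  coordinates Q u = u ᵛ* mat⁻¹ Q

  coordinates-* : ∀ {d} (Q : GL d) u j → (coordinates Q u ᵛ* mat Q) j ≈ u j
  coordinates-* Q u j = trans (ᵛ*-assoc u (mat⁻¹ Q) (mat Q) j)
    (trans (ᵛ*-congˡ u (proj₂ (isInverse Q)) j) (*ᴹ-identityʳ (λ (_ : Fin 1) → u) zero j))

  private
    unit-row : ∀ {d} (i : Fin d) (M : Mat d d) j → (1ᴹ i ᵛ* M) j ≈ M i j
    unit-row i M j = *ᴹ-identityˡ M i j

    minus-row : ∀ {d} (x : Vector Carrier d) i (M : Mat d d) j →
                ((λ h → x h + - 1ᴹ i h) ᵛ* M) j ≈ (x ᵛ* M) j + - M i j
    minus-row x i M j = trans (*ᴹ-distribʳ M (λ (_ : Fin 1) → x) (λ _ h → - 1ᴹ i h) zero j)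
      (+-congˡ (trans (*ᴹ-negˡ (λ (_ : Fin 1) → 1ᴹ i) M zero j) (-‿cong (unit-row i M j))))

    1+[x-1] : ∀ x y → y ≈ 1# → 1# + (x + - y) ≈ x
    1+[x-1] x y p = begin
      1# + (x + - y) ≈⟨ +-congˡ (+-comm _ _) ⟩
      1# + (- y + x) ≈⟨ +-assoc _ _ _ ⟨
      1# + - y + x   ≈⟨ +-congʳ (trans (+-congʳ (sym p)) (-‿inverseʳ y)) ⟩
      0# + x         ≈⟨ +-identityˡ x ⟩
      x              ∎

  -- Steinitz exchange. If x is the coordinate row of u, adding (x - eᵢ) Q to row i turns that row
  -- into u; the factor to be inverted is 1 + (xᵢ - 1) = xᵢ.
  exchange₁ : ∀ {d} (Q : GL d) u i → coordinates Q u i ≉ 0# →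
    ∃ λ Q' → (∀ j → mat Q' i j ≈ u j) × (∀ h → h ≢ i → ∀ j → mat Q' h j ≈ mat Q h j)
  exchange₁ {d} Q u i xi≉0 = E *ᴳ Q , row , λ h h≢i → elementary-rows i v y p (mat Q) h≢i
    where
    x = coordinates Q u
    v : Vector Carrier d
    v h = x h + - 1ᴹ i h
    y = proj₁ (inverse (x i) xi≉0)
    p : (1# + v i) * y ≈ 1#
    p = trans (*-congʳ (1+[x-1] (x i) (1ᴹ i i) (1ᴹ-diagonal i))) (proj₂ (inverse (x i) xi≉0))
    E = elementary i v y p
    row : ∀ j → mat (E *ᴳ Q) i j ≈ u j
    row j = begin
      mat (E *ᴳ Q) i j                    ≈⟨ elementary-row i v y p (mat Q) j ⟩
      mat Q i j + (v ᵛ* mat Q) j          ≈⟨ +-congˡ (minus-row x i (mat Q) j) ⟩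
      mat Q i j + ((x ᵛ* mat Q) j + - mat Q i j) ≈⟨ +-congˡ (+-congʳ (coordinates-* Q u j)) ⟩
      mat Q i j + (u j + - mat Q i j)     ≈⟨ +-congˡ (+-comm _ _) ⟩
      mat Q i j + (- mat Q i j + u j)     ≈⟨ +-assoc _ _ _ ⟨
      mat Q i j + - mat Q i j + u j       ≈⟨ +-congʳ (-‿inverseʳ _) ⟩
      0# + u j                            ≈⟨ +-identityˡ _ ⟩
      u j                                 ∎

  private
    true≢false : ∀ {b} → b ≡ true → b ≡ false → ∀ {a} {A : Set a} → A
    true≢false ≡.refl ()

    separate : ∀ {d} (S : Fin d → Bool) {h l} → S h ≡ true → S l ≡ false → h ≢ l
    separate S Sh Sl ≡.refl = true≢false Sh Sl

  -- If the coordinate of u at i vanishes but the one at l does not, subtracting row i from row l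
  -- moves the latter to i.
  exchange : ∀ {d} (Q : GL d) u i (S : Fin d → Bool) → S i ≡ false →
    (∀ l → S l ≡ false → coordinates Q u l ≈ 0#) ⊎
    ∃ λ Q' → (∀ j → mat Q' i j ≈ u j) × (∀ h → S h ≡ true → ∀ j → mat Q' h j ≈ mat Q h j)
  -- `S` marks the rows to be kept: either u lies in their span, or an unmarked row has a nonzero
  -- coordinate and gives way to u.
  exchange {d} Q u i S Si with Fin.any? (λ l → (S l Bool.≟ false) ×-dec ¬? (coordinates Q u l ≟ 0#))
  ... | no ¬∃ = inj₁ vanish
    where
    vanish : ∀ l → S l ≡ false → coordinates Q u l ≈ 0#
    vanish l Sl with coordinates Q u l ≟ 0#
    ... | yes z = z
    ... | no ¬z = contradiction (l , Sl , ¬z) ¬∃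
  ... | yes (l , Sl , xl≉0) with coordinates Q u i ≟ 0#
  ...   | no xi≉0 = let Q' , r , rs = exchange₁ Q u i xi≉0 in
    inj₂ (Q' , r , λ h Sh → rs h (separate S Sh Si))
  ...   | yes xi≈0 = let Q' , r , rs = exchange₁ (E *ᴳ Q) u i moved in
    inj₂ (Q' , r , λ h Sh j → trans (rs h (separate S Sh Si) j)
      (elementary-rows l v 1# p (mat Q) (separate S Sh Sl) j))
    where
    x = coordinates Q u
    i≢l : i ≢ l
    i≢l ≡.refl = xl≉0 xi≈0
    v : Vector Carrier d
    v h = - 1ᴹ i h
    p : (1# + v l) * 1# ≈ 1#
    p = trans (*-identityʳ _) (trans (+-congˡ (trans (-‿cong (1ᴹ-off i≢l)) (RingProperties.-0#≈0# ring))) (+-identityʳ 1#))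
    E = elementary l v 1# p
    w : Vector Carrier d
    w j = - 1# * v j
    wi : w i ≈ 1#
    wi = trans (RingProperties.-1*x≈-x ring _) (trans (RingProperties.-‿involutive ring _) (1ᴹ-diagonal i))
    -- The inverse of `E` adds row i to row l, so the new coordinate at i is xᵢ + x_l, where xᵢ = 0
    -- and x_l ≠ 0.
    moved : coordinates (E *ᴳ Q) u i ≉ 0#
    moved z = xl≉0 (begin
      x l                                     ≈⟨ trans (sym (*-identityʳ _)) (*-congˡ (sym wi)) ⟩
      x l * w i                               ≈⟨ *-congˡ (trans (*-congʳ (1ᴹ-diagonal l)) (*-identityˡ _)) ⟨
      x l * outer l w l i                     ≈⟨ sum-single (λ h → x h * outer l w h i) l (λ h h≢l →
          trans (*-congˡ (trans (*-congʳ (1ᴹ-off h≢l)) (zeroˡ _))) (zeroʳ _)) ⟨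
      (x ᵛ* outer l w) i                      ≈⟨ +-identityˡ _ ⟨
      0# + (x ᵛ* outer l w) i                 ≈⟨ +-congʳ (trans (*ᴹ-identityʳ (λ (_ : Fin 1) → x) zero i) xi≈0) ⟨
      (x ᵛ* 1ᴹ) i + (x ᵛ* outer l w) i        ≈⟨ *ᴹ-distribˡ (λ (_ : Fin 1) → x) 1ᴹ (outer l w) zero i ⟨
      (x ᵛ* mat⁻¹ E) i                        ≈⟨ ᵛ*-assoc u (mat⁻¹ Q) (mat⁻¹ E) i ⟩
      coordinates (E *ᴳ Q) u i                ≈⟨ z ⟩
      0#                                      ∎)

  ZeroRow : ∀ {k l} → Mat k l → Fin k → Set ℓ
  ZeroRow M i = ∀ j → M i j ≈ 0#

  zeroRow? : ∀ {k l} (M : Mat k l) → Decidable (ZeroRow M)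
  zeroRow? M i = Fin.all? (λ j → M i j ≟ 0#)

  private
    ≤-split : ∀ {d k} (k<d : k < d) (i : Fin d) → toℕ i < suc k → toℕ i < k ⊎ i ≡ fromℕ< k<d
    ≤-split k<d i i≤k with ℕ.m≤n⇒m<n∨m≡n (ℕ.s≤s⁻¹ i≤k)
    ... | inj₁ i<k = inj₁ i<k
    ... | inj₂ i≡k = inj₂ (Fin.toℕ-injective (≡.trans i≡k (≡.sym (Fin.toℕ-fromℕ< k<d))))

    ᵛ*-zero : ∀ {k l} (x : Vector Carrier k) (M : Mat k l) → (∀ i → x i ≈ 0#) → ∀ j → (x ᵛ* M) j ≈ 0#
    ᵛ*-zero x M p j = sum-0 (λ i → x i * M i j) λ i → trans (*-congʳ (p i)) (zeroˡ _)

    ᵛ*-support : ∀ {k l} (x : Vector Carrier k) (M N : Mat k l) →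
      (∀ i → x i ≈ 0# ⊎ (∀ j → M i j ≈ N i j)) → ∀ j → (x ᵛ* M) j ≈ (x ᵛ* N) j
    ᵛ*-support {k} x M N p j = sum-cong-≋ {k} λ i → term i (p i)
      where
      term : ∀ i → x i ≈ 0# ⊎ (∀ j → M i j ≈ N i j) → x i * M i j ≈ x i * N i j
      term i (inj₁ z) = trans (trans (*-congʳ z) (zeroˡ _)) (sym (trans (*-congʳ z) (zeroˡ _)))
      term i (inj₂ e) = *-congˡ (e j)

  RowIndependent : ∀ {d} → Mat d d → Set (c ⊔ ℓ)
  RowIndependent R = ∀ x → (∀ i → ZeroRow R i → x i ≈ 0#) → (∀ j → (x ᵛ* R) j ≈ 0#) → ∀ i → x i ≈ 0#

  module _ {d} (R : Mat d d) (independent : RowIndependent R) where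
    private
      -- The nonzero rows of R are exchanged one by one into the identity matrix, each step keeping
      -- those already placed. A failing step would make the next row a combination of the earlier
      -- ones.
      complete : ∀ k → k ℕ.≤ d →
        ∃ λ (Q : GL d) → ∀ i → toℕ i < k → ¬ ZeroRow R i → ∀ j → mat Q i j ≈ R i j
      complete zero    _   = 1ᴳ , λ i ()
      complete (suc k) k<d with complete k (ℕ.<⇒≤ k<d) | zeroRow? R (fromℕ< k<d)
      ... | Q , rows | yes z = Q , λ i i≤k ¬z → grow i (≤-split k<d i i≤k) ¬z
        where
        grow : ∀ i → toℕ i < k ⊎ i ≡ fromℕ< k<d → ¬ ZeroRow R i → ∀ j → mat Q i j ≈ R i j
        grow i (inj₁ i<k)    ¬z = rows i i<k ¬z
        grow i (inj₂ ≡.refl) ¬z = contradiction z ¬z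
      ... | Q , rows | no ¬z₀ with exchange Q (R i₀) i₀ S S-i₀
        where
        i₀ = fromℕ< k<d
        S? : ∀ j → Dec (toℕ j < k × ¬ ZeroRow R j)
        S? j = (toℕ j ℕ.<? k) ×-dec ¬? (zeroRow? R j)
        S : Fin d → Bool
        S j = does (S? j)
        S-i₀ : S i₀ ≡ false
        S-i₀ = dec-false (S? i₀) λ (i₀<k , _) → ℕ.<-irrefl (Fin.toℕ-fromℕ< k<d) i₀<k
      ...   | inj₂ (Q' , new , old) = Q' , λ i i≤k → grow i (≤-split k<d i i≤k)
        where
        grow : ∀ i → toℕ i < k ⊎ i ≡ fromℕ< k<d → ¬ ZeroRow R i → ∀ j → mat Q' i j ≈ R i j
        grow i (inj₁ i<k)    ¬z j = trans
          (old i (dec-true ((toℕ i ℕ.<? k) ×-dec ¬? (zeroRow? R i)) (i<k , ¬z)) j) (rows i i<k ¬z j)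
        grow i (inj₂ ≡.refl) ¬z j = new j
      ...   | inj₁ vanish = contradiction (sym 1≈0) 0≉1
        where
        i₀ = fromℕ< k<d
        S? : ∀ j → Dec (toℕ j < k × ¬ ZeroRow R j)
        S? j = (toℕ j ℕ.<? k) ×-dec ¬? (zeroRow? R j)
        x y : Vector Carrier d
        x = coordinates Q (R i₀)
        -- The relation among the rows of R that independence forbids: it vanishes on the zero rows
        -- but equals -1 at `i₀`.
        y j = x j + - 1ᴹ i₀ j
        x-i₀ : x i₀ ≈ 0#
        x-i₀ = vanish i₀ (dec-false (S? i₀) λ (i₀<k , _) → ℕ.<-irrefl (Fin.toℕ-fromℕ< k<d) i₀<k)
        support : ∀ j → x j ≈ 0# ⊎ (∀ l → R j l ≈ mat Q j l)
        support j with S? j in eq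
        ... | no _ = inj₁ (vanish j (≡.cong does eq))
        ... | yes (j<k , ¬z) = inj₂ λ l → sym (rows j j<k ¬z l)
        y-zero : ∀ j → ZeroRow R j → y j ≈ 0#
        y-zero j z = trans (+-cong (vanish j (dec-false (S? j) λ (_ , ¬z) → ¬z z))
            (trans (-‿cong (1ᴹ-off λ i₀≡j → ¬z₀ (≡.subst (ZeroRow R) (≡.sym i₀≡j) z))) (RingProperties.-0#≈0# ring)))
          (+-identityˡ 0#)
        y*R : ∀ l → (y ᵛ* R) l ≈ 0#
        y*R l = begin
          (y ᵛ* R) l                  ≈⟨ minus-row x i₀ R l ⟩
          (x ᵛ* R) l + - R i₀ l       ≈⟨ +-congʳ (ᵛ*-support x R (mat Q) support l) ⟩
          (x ᵛ* mat Q) l + - R i₀ l   ≈⟨ +-congʳ (coordinates-* Q (R i₀) l) ⟩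
          R i₀ l + - R i₀ l           ≈⟨ -‿inverseʳ _ ⟩
          0#                          ∎
        1≈0 : 1# ≈ 0#
        1≈0 = begin
          1#                 ≈⟨ RingProperties.-‿involutive ring 1# ⟨
          - - 1#             ≈⟨ -‿cong (trans (+-identityˡ _) (-‿cong (1ᴹ-diagonal i₀))) ⟨
          - (0# + - 1ᴹ i₀ i₀) ≈⟨ -‿cong (+-congʳ x-i₀) ⟨
          - y i₀             ≈⟨ -‿cong (independent y y-zero y*R i₀) ⟩
          - 0#               ≈⟨ RingProperties.-0#≈0# ring ⟩
          0#                 ∎

    completion : ∃ λ (Q : GL d) → ∀ i → ¬ ZeroRow R i → ∀ j → mat Q i j ≈ R i j
    completion with complete d ℕ.≤-refl
    ... | Q , rows = Q , λ i → rows i (Fin.toℕ<n i)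

  module _ {d} (M : Mat d d) where
    private
      -- The invariant of the elimination. Independence of the rows marked by S is recorded by
      -- making them rows of an invertible matrix Q, which avoids any counting of dimensions.
      Reduced : ℕ → Set (c ⊔ ℓ)
      Reduced k = ∃ λ (P : GL d) → ∃ λ (Q : GL d) → ∃ λ (S : Fin d → Bool) →
        (∀ i → S i ≡ true → toℕ i < k × (∀ j → (mat P *ᴹ M) i j ≈ mat Q i j)) ×
        (∀ i → toℕ i < k → S i ≡ false → ZeroRow (mat P *ᴹ M) i)

      -- The next row of P M is either exchanged into Q and marked, or it lies in the span of the
      -- marked rows and is cleared by subtracting its own coordinates. Its coordinate at `i₀` is
      -- zero, so that subtraction is invertible.
      reduce : ∀ k → k ℕ.≤ d → Reduced k
      reduce zero    _   = 1ᴳ , 1ᴳ , (λ _ → false) , (λ i ()) , λ i ()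
      reduce (suc k) k<d with reduce k (ℕ.<⇒≤ k<d)
      ... | P , Q , S , inS , outS with exchange Q ((mat P *ᴹ M) (fromℕ< k<d)) (fromℕ< k<d) S S-i₀
        where
        S-i₀ : S (fromℕ< k<d) ≡ false
        S-i₀ with S (fromℕ< k<d) in eq
        ... | false = ≡.refl
        ... | true  = contradiction (proj₁ (inS _ eq)) (ℕ.<-irrefl (Fin.toℕ-fromℕ< k<d))
      ...   | inj₂ (Q' , new , old) = P , Q' , S' , inS' , outS'
        where
        i₀ = fromℕ< k<d
        S' : Fin d → Bool
        S' i = does (i Fin.≟ i₀) ∨ S i
        inS' : ∀ i → S' i ≡ true → toℕ i < suc k × (∀ j → (mat P *ᴹ M) i j ≈ mat Q' i j)
        inS' i S'i with i Fin.≟ i₀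
        ... | yes ≡.refl = ℕ.s≤s (ℕ.≤-reflexive (Fin.toℕ-fromℕ< k<d)) , λ j → sym (new j)
        ... | no _ = ℕ.m<n⇒m<1+n (proj₁ (inS i S'i)) , λ j → trans (proj₂ (inS i S'i) j) (sym (old i S'i j))
        outS' : ∀ i → toℕ i < suc k → S' i ≡ false → ZeroRow (mat P *ᴹ M) i
        outS' i i≤k S'i with i Fin.≟ i₀ | ≤-split k<d i i≤k
        ... | no _    | inj₁ i<k = outS i i<k S'i
        ... | no i≢i₀ | inj₂ e   = contradiction e i≢i₀
      ...   | inj₁ vanish = E *ᴳ P , Q , S , inS' , outS'
        where
        i₀ = fromℕ< k<d
        x v : Vector Carrier d
        x = coordinates Q ((mat P *ᴹ M) i₀)
        v j = - x j
        S-i₀ : S i₀ ≡ false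
        S-i₀ with S i₀ in eq
        ... | false = ≡.refl
        ... | true  = contradiction (proj₁ (inS _ eq)) (ℕ.<-irrefl (Fin.toℕ-fromℕ< k<d))
        p : (1# + v i₀) * 1# ≈ 1#
        p = trans (*-identityʳ _) (trans (+-congˡ (trans (-‿cong (vanish i₀ S-i₀)) (RingProperties.-0#≈0# ring))) (+-identityʳ 1#))
        E = elementary i₀ v 1# p
        other : ∀ i → i ≢ i₀ → ∀ j → (mat (E *ᴳ P) *ᴹ M) i j ≈ (mat P *ᴹ M) i j
        other i i≢i₀ j = trans (*ᴹ-assoc (mat E) (mat P) M i j) (elementary-rows i₀ v 1# p (mat P *ᴹ M) i≢i₀ j)
        inS' : ∀ i → S i ≡ true → toℕ i < suc k × (∀ j → (mat (E *ᴳ P) *ᴹ M) i j ≈ mat Q i j)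
        inS' i Si = ℕ.m<n⇒m<1+n (proj₁ (inS i Si)) , λ j →
          trans (other i (separate S Si S-i₀) j) (proj₂ (inS i Si) j)
        support : ∀ i → x i ≈ 0# ⊎ (∀ j → (mat P *ᴹ M) i j ≈ mat Q i j)
        support i with S i in eq
        ... | false = inj₁ (vanish i eq)
        ... | true  = inj₂ (proj₂ (inS i eq))
        outS' : ∀ i → toℕ i < suc k → S i ≡ false → ZeroRow (mat (E *ᴳ P) *ᴹ M) i
        outS' i i≤k Si j = case (≤-split k<d i i≤k)
          where
          case : toℕ i < k ⊎ i ≡ i₀ → (mat (E *ᴳ P) *ᴹ M) i j ≈ 0#
          case (inj₁ i<k) = trans (other i (λ { ≡.refl → ℕ.<-irrefl (Fin.toℕ-fromℕ< k<d) i<k }) j) (outS i i<k Si j)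
          case (inj₂ ≡.refl) = begin
            (mat (E *ᴳ P) *ᴹ M) i₀ j                        ≈⟨ *ᴹ-assoc (mat E) (mat P) M i₀ j ⟩
            (mat E *ᴹ (mat P *ᴹ M)) i₀ j                    ≈⟨ elementary-row i₀ v 1# p (mat P *ᴹ M) j ⟩
            (mat P *ᴹ M) i₀ j + (v ᵛ* (mat P *ᴹ M)) j       ≈⟨ +-congˡ (*ᴹ-negˡ (λ (_ : Fin 1) → x) (mat P *ᴹ M) zero j) ⟩
            (mat P *ᴹ M) i₀ j + - (x ᵛ* (mat P *ᴹ M)) j     ≈⟨ +-congˡ (-‿cong (ᵛ*-support x (mat P *ᴹ M) (mat Q) support j)) ⟩
            (mat P *ᴹ M) i₀ j + - (x ᵛ* mat Q) j            ≈⟨ +-congˡ (-‿cong (coordinates-* Q ((mat P *ᴹ M) i₀) j)) ⟩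
            (mat P *ᴹ M) i₀ j + - (mat P *ᴹ M) i₀ j         ≈⟨ -‿inverseʳ _ ⟩
            0#                                              ∎

    -- A relation x (P M) = 0 that ignores the zero rows is a relation x Q = 0, since P M and Q
    -- agree wherever x is supported; and Q is invertible.
    rowReduction : ∃ λ (P : GL d) → RowIndependent (mat P *ᴹ M)
    rowReduction with reduce d ℕ.≤-refl
    ... | P , Q , S , inS , outS = P , independent
      where
      independent : RowIndependent (mat P *ᴹ M)
      independent x x-zero x*PM i = begin
        x i                                ≈⟨ *ᴹ-identityʳ (λ (_ : Fin 1) → x) zero i ⟨
        (x ᵛ* 1ᴹ) i                        ≈⟨ ᵛ*-congˡ x (proj₁ (isInverse Q)) i ⟨
        (x ᵛ* (mat Q *ᴹ mat⁻¹ Q)) i        ≈⟨ ᵛ*-assoc x (mat Q) (mat⁻¹ Q) i ⟨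
        (x ᵛ* mat Q ᵛ* mat⁻¹ Q) i          ≈⟨ ᵛ*-zero (x ᵛ* mat Q) (mat⁻¹ Q)
            (λ j → trans (sym (ᵛ*-support x (mat P *ᴹ M) (mat Q) support j)) (x*PM j)) i ⟩
        0#                                 ∎
        where
        support : ∀ i → x i ≈ 0# ⊎ (∀ j → (mat P *ᴹ M) i j ≈ mat Q i j)
        support i with S i in eq
        ... | false = inj₁ (x-zero i (outS i (Fin.toℕ<n i) eq))
        ... | true  = inj₂ (proj₂ (inS i eq))

  infix 9 _ᵀ
  _ᵀ : ∀ {k l} → Mat k l → Mat l k
  (M ᵀ) i j = M j i

  *ᴹ-ᵀ : ∀ {k l m} (M : Mat k l) (N : Mat l m) → N ᵀ *ᴹ M ᵀ ≈ᴹ (M *ᴹ N) ᵀ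
  *ᴹ-ᵀ M N i j = sum-cong-≋ λ h → *-comm (N h i) (M j h)

  -- Kᵈ = im N ⊕ coker N: the columns of B are a basis of im N, B = N V, and Λ is the cokernel map.
  record Splitting {d} (N : Mat d d) (a s : ℕ) : Set (c ⊔ ℓ) where
    field
      B        : Mat d a
      B⁺       : Mat a d
      V        : Mat d a
      Λ        : Mat s d
      κ        : Mat d s
      B⁺*B≈1   : B⁺ *ᴹ B ≈ᴹ 1ᴹ
      N*V≈B    : N *ᴹ V ≈ᴹ B
      Λ*N≈0    : Λ *ᴹ N ≈ᴹ 0ᴹ
      Λ*κ≈1    : Λ *ᴹ κ ≈ᴹ 1ᴹ
      split    : B *ᴹ B⁺ +ᴹ κ *ᴹ Λ ≈ᴹ 1ᴹ

    Λ*B≈0 : Λ *ᴹ B ≈ᴹ 0ᴹ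
    Λ*B≈0 = ≈ᴹ.trans (*ᴹ-congˡ Λ (≈ᴹ.sym N*V≈B)) (≈ᴹ.trans (≈ᴹ.sym (*ᴹ-assoc Λ N V))
      (≈ᴹ.trans (*ᴹ-congʳ V Λ*N≈0) (*ᴹ-zeroˡ V)))

    B*B⁺*N≈N : B *ᴹ (B⁺ *ᴹ N) ≈ᴹ N
    B*B⁺*N≈N i j = begin
      (B *ᴹ (B⁺ *ᴹ N)) i j                       ≈⟨ *ᴹ-assoc B B⁺ N i j ⟨
      (B *ᴹ B⁺ *ᴹ N) i j                         ≈⟨ +-identityʳ _ ⟨
      (B *ᴹ B⁺ *ᴹ N) i j + 0#                    ≈⟨ +-congˡ (*ᴹ-zeroʳ κ i j) ⟨
      (B *ᴹ B⁺ *ᴹ N) i j + (κ *ᴹ 0ᴹ) i j         ≈⟨ +-congˡ (*ᴹ-congˡ κ Λ*N≈0 i j) ⟨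
      (B *ᴹ B⁺ *ᴹ N) i j + (κ *ᴹ (Λ *ᴹ N)) i j   ≈⟨ +-congˡ (*ᴹ-assoc κ Λ N i j) ⟨
      (B *ᴹ B⁺ *ᴹ N) i j + (κ *ᴹ Λ *ᴹ N) i j     ≈⟨ *ᴹ-distribʳ N (B *ᴹ B⁺) (κ *ᴹ Λ) i j ⟨
      ((B *ᴹ B⁺ +ᴹ κ *ᴹ Λ) *ᴹ N) i j             ≈⟨ *ᴹ-congʳ N split i j ⟩
      (1ᴹ *ᴹ N) i j                              ≈⟨ *ᴹ-identityˡ N i j ⟩
      N i j                                      ∎

  module _ {d} {A A⁻¹ P P⁻¹ N R : Mat d d} (AA⁻¹ : IsInverse A A⁻¹) (PP⁻¹ : IsInverse P P⁻¹)
           (reduced : P *ᴹ (A⁻¹ *ᴹ N) ≈ᴹ R) (independent : RowIndependent R) where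
    private
      module +M = Enumeration +-commutativeMonoid
      Q = proj₁ (completion R independent)
      rows = proj₂ (completion R independent)
      Q⁻¹ = mat⁻¹ Q
      zeros    = filter (zeroRow? R) (allFin d)
      nonzeros = filter (¬? ∘ zeroRow? R) (allFin d)
      zero# : Fin (length zeros) → Fin d
      zero# = List.lookup zeros
      nonzero# : Fin (length nonzeros) → Fin d
      nonzero# = List.lookup nonzeros

      PA⁻¹ = P *ᴹ A⁻¹

      -- `N` and `R` differ by an invertible factor on the left, hence have the same row space.
      N≈ : A *ᴹ (P⁻¹ *ᴹ R) ≈ᴹ N
      N≈ = ≈ᴹ.trans (≈ᴹ.sym (*ᴹ-assoc A P⁻¹ R)) (≈ᴹ.trans
        (*ᴹ-congˡ (A *ᴹ P⁻¹) (≈ᴹ.trans (≈ᴹ.sym reduced) (≈ᴹ.sym (*ᴹ-assoc P A⁻¹ N))))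
        (≈ᴹ.trans (≈ᴹ.sym (*ᴹ-assoc (A *ᴹ P⁻¹) (P *ᴹ A⁻¹) N))
          (≈ᴹ.trans (*ᴹ-congʳ N (proj₁ (inverse-* AA⁻¹ (proj₂ PP⁻¹ , proj₁ PP⁻¹)))) (*ᴹ-identityˡ N))))

      -- Each row of R is zero or equal to the row of Q with the same index. So row i of R Q⁻¹ is
      -- zero or the i-th unit row, and the latter occurs only for indices of nonzero rows.
      R*Q⁻¹ : ∀ i z → (R *ᴹ Q⁻¹) i (zero# z) ≈ 0#
      R*Q⁻¹ i z with zeroRow? R i
      ... | yes r = ᵛ*-zero (R i) Q⁻¹ r (zero# z)
      ... | no ¬r = trans (*ᴹ-congʳ Q⁻¹ (λ (_ : Fin 1) j → sym (rows i ¬r j)) zero (zero# z))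
        (trans (proj₁ (isInverse Q) i (zero# z))
          (1ᴹ-off λ i≡z → ¬r (≡.subst (ZeroRow R) (≡.sym i≡z) (lookup-filter (zeroRow? R) z))))

      N*Q⁻¹ : ∀ i z → (N *ᴹ Q⁻¹) i (zero# z) ≈ 0#
      N*Q⁻¹ i z = begin
        (N *ᴹ Q⁻¹) i (zero# z)                       ≈⟨ *ᴹ-congʳ Q⁻¹ N≈ i (zero# z) ⟨
        (A *ᴹ (P⁻¹ *ᴹ R) *ᴹ Q⁻¹) i (zero# z)         ≈⟨ *ᴹ-assoc A (P⁻¹ *ᴹ R) Q⁻¹ i (zero# z) ⟩
        (A *ᴹ (P⁻¹ *ᴹ R *ᴹ Q⁻¹)) i (zero# z)         ≈⟨ *ᴹ-congˡ A (*ᴹ-assoc P⁻¹ R Q⁻¹) i (zero# z) ⟩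
        (A *ᴹ (P⁻¹ *ᴹ (R *ᴹ Q⁻¹))) i (zero# z)       ≈⟨ *ᴹ-assoc A P⁻¹ (R *ᴹ Q⁻¹) i (zero# z) ⟨
        (A *ᴹ P⁻¹ *ᴹ (R *ᴹ Q⁻¹)) i (zero# z)         ≈⟨ sum-0 (λ h → (A *ᴹ P⁻¹) i h * (R *ᴹ Q⁻¹) h (zero# z))
            (λ h → trans (*-congˡ (R*Q⁻¹ h z)) (zeroʳ _)) ⟩
        0#                                           ∎

    -- The rows of Q at nonzero indices of R are a basis of the row space of N, which is the image
    -- of Nᵀ; the other rows of Q span a complement. The columns of Q⁻¹ are the dual coordinates,
    -- and `V` is read off from P A⁻¹ N = R.
    splitting : Splitting (N ᵀ) (length nonzeros) (length zeros)
    splitting = record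
      { B  = λ h α → mat Q (nonzero# α) h
      ; B⁺ = λ α h → Q⁻¹ h (nonzero# α)
      ; V  = λ h α → PA⁻¹ (nonzero# α) h
      ; Λ  = λ z h → Q⁻¹ h (zero# z)
      ; κ  = λ h z → mat Q (zero# z) h
      ; B⁺*B≈1 = λ α β → trans (*ᴹ-ᵀ (mat Q) Q⁻¹ (nonzero# α) (nonzero# β))
          (trans (proj₁ (isInverse Q) _ _) (trans (1ᴹ-comm (nonzero# β) (nonzero# α)) (sym (1ᴹ-injective nonzero# (lookup-filter-injective (¬? ∘ zeroRow? R) _ _) α β))))
      ; N*V≈B = λ h α → trans (*ᴹ-ᵀ PA⁻¹ N h (nonzero# α)) (trans (*ᴹ-assoc P A⁻¹ N (nonzero# α) h)
          (trans (reduced (nonzero# α) h) (sym (rows (nonzero# α) (lookup-filter (¬? ∘ zeroRow? R) α) h))))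
      ; Λ*N≈0 = λ z h → trans (*ᴹ-ᵀ N Q⁻¹ (zero# z) h) (N*Q⁻¹ h z)
      ; Λ*κ≈1 = λ z z' → trans (*ᴹ-ᵀ (mat Q) Q⁻¹ (zero# z) (zero# z'))
          (trans (proj₁ (isInverse Q) _ _) (trans (1ᴹ-comm (zero# z') (zero# z)) (sym (1ᴹ-injective zero# (lookup-filter-injective (zeroRow? R) _ _) z z'))))
      ; split = λ h k → trans (+M.sum-filter (zeroRow? R) (λ i → mat Q i h * Q⁻¹ k i))
          (trans (*ᴹ-ᵀ Q⁻¹ (mat Q) h k) (trans (proj₂ (isInverse Q) k h) (1ᴹ-comm k h)))
      }

-- Twisted polynomials: products with τ and with constants.

module SkewLemmas (R : Ring c ℓ) (σ : RingHomomorphism (Ring.rawRing R) (Ring.rawRing R)) where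
  open Ring R hiding (zero)
  open SkewPolynomials R σ
  open RingHomomorphism σ using () renaming
    (⟦_⟧ to s; ⟦⟧-cong to s-cong; *-homo to s-*; 0#-homo to s-0; 1#-homo to s-1)
  private
    module P = Ring ring

  iterate : ℕ → Carrier → Carrier
  iterate zero    x = x
  iterate (suc n) x = iterate n (s x)

  ∷-cong : ∀ {a b f g} → a ≈ b → f ≈ₚ g → a ∷ f ≈ₚ b ∷ g
  ∷-cong p q = mk λ { zero → p ; (suc n) → at q n }

  0∷[]≈[] : 0# ∷ [] ≈ₚ []
  0∷[]≈[] = mk λ { zero → refl ; (suc n) → refl }

  ∷≈const+0∷ : ∀ a f → a ∷ f ≈ₚ const a +ₚ (0# ∷ f)
  ∷≈const+0∷ a f = ∷-cong (sym (+-identityʳ a)) P.refl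

  coeff-const-* : ∀ a f n → coeff (const a *ₚ f) n ≈ a * coeff f n
  coeff-const-* a f n = trans (coeff-+ (a ·ₚ f) (0# ∷ []) n)
    (trans (+-cong (coeff-· a f n) (at 0∷[]≈[] n)) (+-identityʳ _))

  *-const : ∀ f a n → coeff (f *ₚ const a) n ≈ coeff f n * iterate n a
  *-const []      a n       = sym (zeroˡ _)
  *-const (b ∷ f) a zero    = +-identityʳ _
  *-const (b ∷ f) a (suc n) = *-const f (s a) n

  *-τ : ∀ f → f *ₚ τ ≈ₚ 0# ∷ f
  *-τ []      = P.sym 0∷[]≈[]
  *-τ (a ∷ f) = ∷-cong (trans (+-identityʳ _) (zeroʳ a)) (P.trans
    (P.+-cong (∷-cong (*-identityʳ a) P.refl)
      (P.trans (P.*-congˡ {x = f} (∷-cong s-0 (∷-cong s-1 P.refl))) (*-τ f)))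
    (P.sym (∷≈const+0∷ a f)))

  τ-* : ∀ f → τ *ₚ f ≈ₚ 0# ∷ map s f
  τ-* f = mk λ n → trans (coeff-+ (0# ·ₚ f) (0# ∷ ((1# ·ₚ map s f) +ₚ (0# ∷ []))) n)
    (trans (+-congʳ (trans (coeff-· 0# f n) (zeroˡ _))) (trans (+-identityˡ _) (lemma n)))
    where
    lemma : ∀ n → coeff (0# ∷ (const 1# *ₚ map s f)) n ≈ coeff (0# ∷ map s f) n
    lemma zero    = refl
    lemma (suc n) = trans (coeff-const-* 1# (map s f) n) (*-identityˡ _)

  0∷-* : ∀ f g → (0# ∷ f) *ₚ g ≈ₚ 0# ∷ (f *ₚ map s g)
  0∷-* f g = mk λ n → trans (coeff-+ (0# ·ₚ g) (0# ∷ (f *ₚ map s g)) n)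
    (trans (+-congʳ (trans (coeff-· 0# g n) (zeroˡ _))) (+-identityˡ _))

  *-0∷ : ∀ f g → f *ₚ (0# ∷ g) ≈ₚ 0# ∷ (f *ₚ g)
  *-0∷ f g = P.trans (P.*-congˡ {x = f} (P.sym (*-τ g)))
    (P.trans (P.sym (P.*-assoc f g τ)) (*-τ (f *ₚ g)))

  *-∷ : ∀ f a g → f *ₚ (a ∷ g) ≈ₚ f *ₚ const a +ₚ (0# ∷ (f *ₚ g))
  *-∷ f a g = P.trans (P.*-congˡ {x = f} (∷≈const+0∷ a g))
    (P.trans (P.distribˡ f (const a) (0# ∷ g)) (P.+-congˡ {x = f *ₚ const a} (*-0∷ f g)))

-- The universal property of F[t] for maps into a noncommutative ring.

module Horner (F : CommutativeRing c₁ ℓ₁) (S : Ring c₂ ℓ₂)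
              (h : RingHomomorphism (CommutativeRing.rawRing F) (Ring.rawRing S)) (x : Ring.Carrier S) where
  private
    module F = CommutativeRing F
    module F[t] = Polynomials F
    module A = CommutativeRing F[t].commutativeRing
    module h = RingHomomorphism h
  open Ring S hiding (zero)
  open SetoidReasoning setoid
  open CommutativeSemigroupProperties +-commutativeSemigroup using (interchange)

  horner : A.Carrier → Carrier
  horner []      = 0#
  horner (a ∷ f) = h.⟦ a ⟧ + x * horner f

  horner-t : horner F[t].t ≈ x
  horner-t = trans (+-cong h.0#-homo (*-congˡ (trans (+-cong h.1#-homo (zeroʳ x)) (+-identityʳ 1#))))
    (trans (+-identityˡ _) (*-identityʳ x))

  horner-const : ∀ a → horner (F[t].const a) ≈ h.⟦ a ⟧
  horner-const a = trans (+-congˡ (zeroʳ x)) (+-identityʳ _)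

  module _ (commute : ∀ a → h.⟦ a ⟧ * x ≈ x * h.⟦ a ⟧) where
    private
      horner-0 : ∀ f → f A.≈ [] → horner f ≈ 0#
      horner-0 []      p = refl
      horner-0 (a ∷ f) p = trans
        (+-cong (trans (h.⟦⟧-cong (F[t].at p zero)) h.0#-homo)
          (trans (*-congˡ (horner-0 f (F[t].mk λ n → F[t].at p (suc n)))) (zeroʳ x)))
        (+-identityˡ 0#)

      horner-cong : ∀ f g → f A.≈ g → horner f ≈ horner g
      horner-cong []      g       p = sym (horner-0 g (A.sym p))
      horner-cong (a ∷ f) []      p = horner-0 (a ∷ f) p
      horner-cong (a ∷ f) (b ∷ g) p = +-cong (h.⟦⟧-cong (F[t].at p zero))
        (*-congˡ (horner-cong f g (F[t].mk λ n → F[t].at p (suc n))))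

      horner-+ : ∀ f g → horner (f A.+ g) ≈ horner f + horner g
      horner-+ []      g       = sym (+-identityˡ _)
      horner-+ (a ∷ f) []      = sym (+-identityʳ _)
      horner-+ (a ∷ f) (b ∷ g) = trans
        (+-cong (h.+-homo a b) (trans (*-congˡ (horner-+ f g)) (distribˡ _ _ _)))
        (interchange _ _ _ _)

      horner-· : ∀ a f → horner (a F[t].·ₚ f) ≈ h.⟦ a ⟧ * horner f
      horner-· a []      = sym (zeroʳ _)
      horner-· a (b ∷ f) = begin
        h.⟦ a F.* b ⟧ + x * horner (a F[t].·ₚ f)       ≈⟨ +-cong (h.*-homo a b) (*-congˡ (horner-· a f)) ⟩
        h.⟦ a ⟧ * h.⟦ b ⟧ + x * (h.⟦ a ⟧ * horner f)   ≈⟨ +-congˡ (*-assoc _ _ _) ⟨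
        h.⟦ a ⟧ * h.⟦ b ⟧ + x * h.⟦ a ⟧ * horner f     ≈⟨ +-congˡ (*-congʳ (commute a)) ⟨
        h.⟦ a ⟧ * h.⟦ b ⟧ + h.⟦ a ⟧ * x * horner f     ≈⟨ +-congˡ (*-assoc _ _ _) ⟩
        h.⟦ a ⟧ * h.⟦ b ⟧ + h.⟦ a ⟧ * (x * horner f)   ≈⟨ distribˡ _ _ _ ⟨
        h.⟦ a ⟧ * (h.⟦ b ⟧ + x * horner f)             ∎

      horner-0∷ : ∀ f → horner (F.0# ∷ f) ≈ x * horner f
      horner-0∷ f = trans (+-congʳ h.0#-homo) (+-identityˡ _)

      horner-* : ∀ f g → horner (f A.* g) ≈ horner f * horner g
      horner-* []      g = sym (zeroˡ _)
      horner-* (a ∷ f) g = begin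
        horner ((a F[t].·ₚ g) A.+ (F.0# ∷ (f A.* map (λ b → b) g)))
          ≈⟨ horner-+ (a F[t].·ₚ g) (F.0# ∷ (f A.* map (λ b → b) g)) ⟩
        horner (a F[t].·ₚ g) + horner (F.0# ∷ (f A.* map (λ b → b) g))
          ≈⟨ +-cong (horner-· a g) (horner-0∷ (f A.* map (λ b → b) g)) ⟩
        h.⟦ a ⟧ * horner g + x * horner (f A.* map (λ b → b) g)
          ≡⟨ ≡.cong (λ g' → h.⟦ a ⟧ * horner g + x * horner (f A.* g')) (List.map-id g) ⟩
        h.⟦ a ⟧ * horner g + x * horner (f A.* g)
          ≈⟨ +-congˡ (trans (*-congˡ (horner-* f g)) (sym (*-assoc _ _ _))) ⟩
        h.⟦ a ⟧ * horner g + x * horner f * horner g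
          ≈⟨ distribʳ _ _ _ ⟨
        (h.⟦ a ⟧ + x * horner f) * horner g ∎

    hornerHom : RingHomomorphism A.rawRing rawRing
    hornerHom = record
      { ⟦_⟧ = horner
      ; isRingHomomorphism = record
        { isSemiringHomomorphism = record
          { isNearSemiringHomomorphism = record
            { +-isMonoidHomomorphism = record
              { isMagmaHomomorphism = record
                { isRelHomomorphism = record { cong = horner-cong _ _ }
                ; homo = horner-+ }
              ; ε-homo = refl }
            ; *-homo = horner-* }
          ; 1#-homo = trans (horner-const F.1#) h.1#-homo }
        ; -‿homo = λ f → RingProperties.+-inverseʳ-unique S (horner f) (horner (A.- f))
            (trans (sym (horner-+ f (A.- f))) (horner-cong _ _ (A.-‿inverseʳ f))) } }

-- Twisted polynomials as additive maps on K-algebras.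

module Evaluation (S : Setting c₁ ℓ₁ c₂ ℓ₂) (R : TModules.KAlgebra S) where
  open TModules S
  open KAlgebra R hiding (zero)
  open Points R
  open Exp commutativeSemiring using (_^_; ^-congˡ; ^-distrib-*)
  open Sum semiring using (sum; sum-cong-≋; ∑-distrib-+; ∑-comm; *-distribˡ-sum)
  open CommutativeSemigroupProperties +-commutativeSemigroup using (interchange)
  open CommutativeSemigroupProperties *-commutativeSemigroup using (x∙yz≈y∙xz)
  private
    module φ = RingHomomorphism structure
    module T = Ring K⟨τ⟩.ring
    module +S = Sums +-commutativeMonoid
    module ΣT = Sum T.semiring
    open SetoidReasoning setoid
    open Mult semiring using () renaming (_×_ to _⊗_)
    open Mult K.semiring using () renaming (_×_ to _⊗ᴷ_)

    ⊗-homo : ∀ n x → φ.⟦ n ⊗ᴷ x ⟧ ≈ n ⊗ φ.⟦ x ⟧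
    ⊗-homo zero    x = φ.0#-homo
    ⊗-homo (suc n) x = trans (φ.+-homo x (n ⊗ᴷ x)) (+-congˡ (⊗-homo n x))

    char : p ⊗ 1# ≈ 0#
    char = trans (Mult.×-congʳ semiring p (sym φ.1#-homo))
      (trans (sym (⊗-homo p K.1#)) (trans (φ.⟦⟧-cong K-char) φ.0#-homo))

  module Frob = RingHomomorphism (Frobenius.frobenius commutativeRing p-prime char r)

  eval-cong : ∀ f {x y} → x ≈ y → eval f x ≈ eval f y
  eval-cong []      p = refl
  eval-cong (a ∷ f) p = +-cong (*-congˡ p) (eval-cong f (^-congˡ q p))

  private
    eval-[] : ∀ f x → f T.≈ [] → eval f x ≈ 0#
    eval-[] []      x p = refl
    eval-[] (a ∷ f) x p = trans (+-cong
        (trans (*-congʳ (trans (φ.⟦⟧-cong (K⟨τ⟩.at p zero)) φ.0#-homo)) (zeroˡ x))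
        (eval-[] f (x ^ q) (K⟨τ⟩.mk λ n → K⟨τ⟩.at p (suc n))))
      (+-identityˡ 0#)

  eval-congˡ : ∀ f g x → f T.≈ g → eval f x ≈ eval g x
  eval-congˡ []      g       x p = sym (eval-[] g x (T.sym p))
  eval-congˡ (a ∷ f) []      x p = eval-[] (a ∷ f) x p
  eval-congˡ (a ∷ f) (b ∷ g) x p = +-cong (*-congʳ (φ.⟦⟧-cong (K⟨τ⟩.at p zero)))
    (eval-congˡ f g (x ^ q) (K⟨τ⟩.mk λ n → K⟨τ⟩.at p (suc n)))

  eval-+ : ∀ f x y → eval f (x + y) ≈ eval f x + eval f y
  eval-+ []      x y = sym (+-identityˡ 0#)
  eval-+ (a ∷ f) x y = trans
    (+-cong (distribˡ _ _ _) (trans (eval-cong f (Frob.+-homo x y)) (eval-+ f (x ^ q) (y ^ q))))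
    (interchange _ _ _ _)

  eval-0 : ∀ f → eval f 0# ≈ 0#
  eval-0 []      = refl
  eval-0 (a ∷ f) = trans (+-cong (zeroʳ _) (trans (eval-cong f Frob.0#-homo) (eval-0 f))) (+-identityˡ 0#)

  eval-sum : ∀ f {n} (x : Vector Carrier n) → eval f (sum x) ≈ sum (λ i → eval f (x i))
  eval-sum f {zero}  x = eval-0 f
  eval-sum f {suc n} x = trans (eval-+ f (x zero) (sum (x ∘ suc))) (+-congˡ (eval-sum f (x ∘ suc)))

  eval-+ˡ : ∀ f g x → eval (f T.+ g) x ≈ eval f x + eval g x
  eval-+ˡ []      g       x = sym (+-identityˡ _)
  eval-+ˡ (a ∷ f) []      x = sym (+-identityʳ _)
  eval-+ˡ (a ∷ f) (b ∷ g) x = trans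
    (+-cong (trans (*-congʳ (φ.+-homo a b)) (distribʳ _ _ _)) (eval-+ˡ f g (x ^ q)))
    (interchange _ _ _ _)

  eval-neg : ∀ f x → eval f (- x) ≈ - eval f x
  eval-neg f x = RingProperties.+-inverseʳ-unique ring (eval f x) (eval f (- x))
    (trans (sym (eval-+ f x (- x))) (trans (eval-cong f (-‿inverseʳ x)) (eval-0 f)))

  eval-sumˡ : ∀ {n} (f : Vector T.Carrier n) x → eval (ΣT.sum f) x ≈ sum (λ i → eval (f i) x)
  eval-sumˡ {zero}  f x = refl
  eval-sumˡ {suc n} f x = trans (eval-+ˡ (f zero) (ΣT.sum (f ∘ suc)) x) (+-congˡ (eval-sumˡ (f ∘ suc) x))

  private
    φ-^ : ∀ a n → φ.⟦ Exp._^_ K.commutativeSemiring a n ⟧ ≈ φ.⟦ a ⟧ ^ n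
    φ-^ a zero    = φ.1#-homo
    φ-^ a (suc n) = trans (φ.*-homo _ _) (*-congˡ (φ-^ a n))

    eval-· : ∀ a f x → eval (a K⟨τ⟩.·ₚ f) x ≈ φ.⟦ a ⟧ * eval f x
    eval-· a []      x = sym (zeroʳ _)
    eval-· a (b ∷ f) x = trans
      (+-cong (trans (*-congʳ (φ.*-homo a b)) (*-assoc _ _ _)) (eval-· a f (x ^ q)))
      (sym (distribˡ _ _ _))

    -- The rule τ x = x^q τ read on points; it is what turns products of twisted polynomials into
    -- compositions in `eval-*`.
    eval-σ : ∀ f x → eval (map (λ a → Exp._^_ K.commutativeSemiring a q) f) (x ^ q) ≈ eval f x ^ q
    eval-σ []      x = sym Frob.0#-homo
    eval-σ (a ∷ f) x = sym (trans (Frob.+-homo (φ.⟦ a ⟧ * x) (eval f (x ^ q))) (+-cong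
      (trans (^-distrib-* _ _ q) (*-congʳ (sym (φ-^ a q)))) (sym (eval-σ f (x ^ q)))))

  eval-0∷ : ∀ f x → eval (K.0# ∷ f) x ≈ eval f (x ^ q)
  eval-0∷ f x = trans (+-congʳ (trans (*-congʳ φ.0#-homo) (zeroˡ x))) (+-identityˡ _)

  eval-* : ∀ f g x → eval (f T.* g) x ≈ eval f (eval g x)
  eval-* []      g x = refl
  eval-* (a ∷ f) g x = begin
    eval ((a K⟨τ⟩.·ₚ g) T.+ (K.0# ∷ (f T.* σg))) x
      ≈⟨ eval-+ˡ (a K⟨τ⟩.·ₚ g) (K.0# ∷ (f T.* σg)) x ⟩
    eval (a K⟨τ⟩.·ₚ g) x + eval (K.0# ∷ (f T.* σg)) x
      ≈⟨ +-cong (eval-· a g x) (trans (eval-0∷ (f T.* σg) x) (eval-* f σg (x ^ q))) ⟩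
    φ.⟦ a ⟧ * eval g x + eval f (eval σg (x ^ q))
      ≈⟨ +-congˡ (eval-cong f (eval-σ g x)) ⟩
    φ.⟦ a ⟧ * eval g x + eval f (eval g x ^ q) ∎
    where σg = map (λ a → Exp._^_ K.commutativeSemiring a q) g

  eval-const : ∀ a x → eval (K⟨τ⟩.const a) x ≈ φ.⟦ a ⟧ * x
  eval-const a x = +-identityʳ _

  eval-1 : ∀ x → eval T.1# x ≈ x
  eval-1 x = trans (eval-const K.1# x) (trans (*-congʳ φ.1#-homo) (*-identityˡ x))

  -- An element fixed by the q-th power passes through every term. Applied to the image of F, this
  -- makes evaluation F-linear.
  eval-linear : ∀ {a} → a ^ q ≈ a → ∀ f x → eval f (a * x) ≈ a * eval f x
  eval-linear p []      x = sym (zeroʳ _)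
  eval-linear p (b ∷ f) x = trans
    (+-cong (x∙yz≈y∙xz _ _ _)
      (trans (eval-cong f (trans (^-distrib-* _ x q) (*-congʳ p))) (eval-linear p f (x ^ q))))
    (sym (distribˡ _ _ _))

  module _ {k l} (M : MatT.Mat k l) where
    evalᴹ-cong : ∀ {x y} → x ≈ᵛ y → evalᴹ M x ≈ᵛ evalᴹ M y
    evalᴹ-cong p i = sum-cong-≋ λ j → eval-cong (M i j) (p j)

    evalᴹ-+ : ∀ x y → evalᴹ M (λ i → x i + y i) ≈ᵛ (λ i → evalᴹ M x i + evalᴹ M y i)
    evalᴹ-+ x y i = trans (sum-cong-≋ λ j → eval-+ (M i j) (x j) (y j))
      (∑-distrib-+ (λ j → eval (M i j) (x j)) (λ j → eval (M i j) (y j)))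

    evalᴹ-0 : evalᴹ M (λ _ → 0#) ≈ᵛ (λ _ → 0#)
    evalᴹ-0 i = +S.sum-0 (λ j → eval (M i j) 0#) λ j → eval-0 (M i j)

    evalᴹ-congˡ : ∀ {N} → M MatT.≈ᴹ N → ∀ x → evalᴹ M x ≈ᵛ evalᴹ N x
    evalᴹ-congˡ {N} p x i = sum-cong-≋ λ j → eval-congˡ (M i j) (N i j) (x j) (p i j)

    evalᴹ-+ˡ : ∀ N x → evalᴹ (M MatT.+ᴹ N) x ≈ᵛ (λ i → evalᴹ M x i + evalᴹ N x i)
    evalᴹ-+ˡ N x i = trans (sum-cong-≋ λ j → eval-+ˡ (M i j) (N i j) (x j))
      (∑-distrib-+ (λ j → eval (M i j) (x j)) (λ j → eval (N i j) (x j)))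

    evalᴹ-negˡ : ∀ x → evalᴹ (MatT.-ᴹ M) x ≈ᵛ (λ i → - evalᴹ M x i)
    evalᴹ-negˡ x i = RingProperties.+-inverseʳ-unique ring (evalᴹ M x i) (evalᴹ (MatT.-ᴹ M) x i) (trans
      (sym (evalᴹ-+ˡ (MatT.-ᴹ M) x i))
      (+S.sum-0 _ λ j → trans (eval-congˡ (M i j T.+ T.- M i j) [] (x j) (T.-‿inverseʳ (M i j))) refl))

  evalᴹ-* : ∀ {k l m} (M : MatT.Mat k l) (N : MatT.Mat l m) x → evalᴹ (M MatT.*ᴹ N) x ≈ᵛ evalᴹ M (evalᴹ N x)
  evalᴹ-* M N x i = begin
    sum (λ j → eval (ΣT.sum (λ h → M i h T.* N h j)) (x j))
      ≈⟨ sum-cong-≋ (λ j → trans (eval-sumˡ (λ h → M i h T.* N h j) (x j))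
           (sum-cong-≋ λ h → eval-* (M i h) (N h j) (x j))) ⟩
    sum (λ j → sum (λ h → eval (M i h) (eval (N h j) (x j))))
      ≈⟨ ∑-comm (λ j h → eval (M i h) (eval (N h j) (x j))) ⟩
    sum (λ h → sum (λ j → eval (M i h) (eval (N h j) (x j))))
      ≈⟨ sum-cong-≋ (λ h → eval-sum (M i h) (λ j → eval (N h j) (x j))) ⟨
    sum (λ h → eval (M i h) (sum (λ j → eval (N h j) (x j)))) ∎

  evalᴹ-scalar : ∀ {k} f x → evalᴹ (MatT.scalar {k} f) x ≈ᵛ (λ i → eval f (x i))
  evalᴹ-scalar f x i = trans
    (+S.sum-single (λ j → eval (MatT.scalar f i j) (x j)) i λ j j≢i →
      eval-congˡ (MatT.scalar f i j) [] (x j) (MT.scalar-off f (j≢i ∘ ≡.sym)))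
    (eval-congˡ (MatT.scalar f i i) f (x i) (MT.scalar-diagonal f i))
    where module MT = MatrixRing K⟨τ⟩.ring

module Differences (G : AbelianGroup c ℓ) where
  open AbelianGroup G renaming (_∙_ to _+_; ε to 0#; _⁻¹ to infix 8 -_; ∙-cong to +-cong; ∙-congˡ to +-congˡ; ∙-congʳ to +-congʳ)
  open SetoidReasoning setoid
  open CommutativeSemigroupProperties commutativeSemigroup using (interchange)

  -- In the recursion for inner derivations w comes from the constant term of the polynomial and z
  -- is the mixed product Ψ_t U Φ_f, inserted to separate the two Leibniz terms.
  [w+x]-[w+y]≈[z-y]+[x-z] : ∀ w x y z → (w + x) + - (w + y) ≈ (z + - y) + (x + - z)
  [w+x]-[w+y]≈[z-y]+[x-z] w x y z = begin
    (w + x) + - (w + y)        ≈⟨ +-congˡ (AbelianGroupProperties.⁻¹-∙-comm G w y) ⟨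
    (w + x) + (- w + - y)      ≈⟨ interchange w x (- w) (- y) ⟩
    (w + - w) + (x + - y)      ≈⟨ +-cong (trans (inverseʳ w) (sym (inverseʳ z))) (comm x (- y)) ⟩
    (z + - z) + (- y + x)      ≈⟨ interchange z (- z) (- y) x ⟩
    (z + - y) + (- z + x)      ≈⟨ +-congˡ (comm (- z) x) ⟩
    (z + - y) + (x + - z)      ∎

-- The constants from F, and t-modules given by one matrix.

module Constants (S : Setting c₁ ℓ₁ c₂ ℓ₂) where
  open TModules S
  module η = RingHomomorphism η
  module T = Ring K⟨τ⟩.ring
  module Fx = Exp F.commutativeSemiring
  module Kx = Exp K.commutativeSemiring
  module Skew = SkewLemmas K.ring (Frobenius.frobenius K.commutativeRing p-prime K-char r)
  module Fskew = SkewLemmas F.ring (Identity.ringHomomorphism F.ring)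
  open MatT
  open MatrixRing K⟨τ⟩.ring public

  η-fixed : ∀ x → η.⟦ x ⟧ Kx.^ q K.≈ η.⟦ x ⟧
  η-fixed x = K.trans (K.sym (η-^ q)) (η.⟦⟧-cong (FiniteField.x^q≈x F F-finite x))
    where
    η-^ : ∀ n → η.⟦ x Fx.^ n ⟧ K.≈ η.⟦ x ⟧ Kx.^ n
    η-^ zero    = η.1#-homo
    η-^ (suc n) = K.trans (η.*-homo _ _) (K.*-congˡ (η-^ n))

  iterate-fixed : ∀ {a} → a Kx.^ q K.≈ a → ∀ n → Skew.iterate n a K.≈ a
  iterate-fixed p zero    = K.refl
  iterate-fixed {a} p (suc n) = K.trans (iterate-fixed (Kx.^-congˡ q p) n) p

  ηᵀ : F.Carrier → T.Carrier
  ηᵀ x = K⟨τ⟩.const η.⟦ x ⟧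

  -- Moving a constant past τⁿ twists it n times, and by Fermat's theorem the elements of F are
  -- fixed by the twist.
  η-central : ∀ x f → ηᵀ x T.* f T.≈ f T.* ηᵀ x
  η-central x f = K⟨τ⟩.mk λ n → K.trans (Skew.coeff-const-* η.⟦ x ⟧ f n) (K.trans (K.*-comm _ _)
    (K.trans (K.*-congˡ (K.sym (iterate-fixed (η-fixed x) n))) (K.sym (Skew.*-const f η.⟦ x ⟧ n))))

  ·-*ᴹ : ∀ {k l m} x (M : Mat k l) (N : Mat l m) → (x ·ᴹ M) *ᴹ N ≈ᴹ x ·ᴹ (M *ᴹ N)
  ·-*ᴹ x M N = ≈ᴹ.trans (*ᴹ-congʳ N (≈ᴹ.sym (scalar-*ᴹ x M)))
    (≈ᴹ.trans (*ᴹ-assoc (scalar x) M N) (scalar-*ᴹ x (M *ᴹ N)))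

  *ᴹ-η· : ∀ {k l m} x (M : Mat k l) (N : Mat l m) → M *ᴹ (ηᵀ x ·ᴹ N) ≈ᴹ ηᵀ x ·ᴹ (M *ᴹ N)
  *ᴹ-η· x M N i j = T.trans
    (sum-cong-≋ λ h → T.trans (T.sym (T.*-assoc (M i h) (ηᵀ x) (N h j)))
      (T.trans (T.*-congʳ (T.sym (η-central x (M i h)))) (T.*-assoc (ηᵀ x) (M i h) (N h j))))
    (T.sym (*-distribˡ-sum (ηᵀ x) (λ h → M i h T.* N h j)))
    where open Sum T.semiring using (sum-cong-≋; *-distribˡ-sum)

  scalarη : ∀ k → RingHomomorphism F.rawRing (matRawRing k)
  scalarη k = record
    { isRingHomomorphism = Composition.isRingHomomorphism ≈ᴹ.trans
        (RingHomomorphism.isRingHomomorphism η)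
        (Composition.isRingHomomorphism ≈ᴹ.trans
          (RingHomomorphism.isRingHomomorphism K⟨τ⟩.constHom)
          (RingHomomorphism.isRingHomomorphism (scalarHom k))) }

  scalarη-comm : ∀ {k l} x (M : Mat k l) → M *ᴹ scalar (ηᵀ x) ≈ᴹ scalar (ηᵀ x) *ᴹ M
  scalarη-comm x M = ≈ᴹ.trans (*ᴹ-congˡ M (≈ᴹ.trans (≈ᴹ.sym (*ᴹ-identityʳ (scalar (ηᵀ x)))) (scalar-*ᴹ (ηᵀ x) 1ᴹ)))
    (≈ᴹ.trans (*ᴹ-η· x M 1ᴹ) (≈ᴹ.trans (λ i j → T.*-congˡ {ηᵀ x} (*ᴹ-identityʳ M i j)) (≈ᴹ.sym (scalar-*ᴹ (ηᵀ x) M))))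

  module _ {k} (X : Mat k k) where
    private module H = Horner F.commutativeRing (matRing k) (scalarη k) X

    -- Scalars from F commute with every matrix over K{τ}, so t may be sent to any X. With constant
    -- term θ the nilpotent part is zero, whence the exponent 1.
    tModuleOf : coeffᴹ X 0 MatK.≈ᴹ MatK.scalar θ → TModule k
    tModuleOf X₀ = record
      { hom = H.hornerHom (λ a → ≈ᴹ.sym (scalarη-comm a X))
      ; linear = H.horner-const
      ; nilpotent = 1 , MatKR.≈ᴹ.trans (MatK.*ᴹ-cong {M' = MatK.0ᴹ} {N = MatK.1ᴹ} N≈0 MatKR.≈ᴹ.refl) (MatK.*ᴹ-zeroˡ MatK.1ᴹ) }
      where
      module MatKR = MatrixRing K.ring
      N≈0 : (coeffᴹ (H.horner F[t].t) 0 MatK.-ᴹ MatK.scalar θ) MatK.≈ᴹ MatK.0ᴹ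
      N≈0 i j = K.trans (K.+-congʳ (K.trans (K⟨τ⟩.at (H.horner-t i j) 0) (X₀ i j))) (K.-‿inverseʳ _)

    tModuleOf-t : ∀ X₀ → TModule.at-t (tModuleOf X₀) ≈ᴹ X
    tModuleOf-t X₀ = H.horner-t

  ∷≈const+t* : ∀ a f → a ∷ f A.≈ F[t].const a A.+ F[t].t A.* f
  ∷≈const+t* a f = A.trans (Fskew.∷≈const+0∷ a f) (A.+-congˡ {F[t].const a}
    (A.trans (A.reflexive (≡.cong (F.0# ∷_) (≡.sym (List.map-id f)))) (A.sym (Fskew.τ-* f))))

  module _ {k} (Φ : TModule k) where
    private
      module Φ = TModule Φ
      module hom = RingHomomorphism Φ.hom

    at-∷ : ∀ a f → Φ.at (a ∷ f) ≈ᴹ scalar (ηᵀ a) +ᴹ Φ.at-t *ᴹ Φ.at f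
    at-∷ a f = ≈ᴹ.trans (hom.⟦⟧-cong (∷≈const+t* a f)) (≈ᴹ.trans (hom.+-homo _ _)
      (+ᴹ-cong (Φ.linear a) (hom.*-homo _ _)))

    at-· : ∀ a f → Φ.at (a F[t].·ₚ f) ≈ᴹ ηᵀ a ·ᴹ Φ.at f
    at-· a f = ≈ᴹ.trans (hom.⟦⟧-cong (F[t].mk λ n → F.trans (F[t].coeff-· a f n) (F.sym (Fskew.coeff-const-* a f n))))
      (≈ᴹ.trans (hom.*-homo _ _) (≈ᴹ.trans (*ᴹ-congʳ (Φ.at f) (Φ.linear a)) (scalar-*ᴹ (ηᵀ a) (Φ.at f))))

-- Derivations and their values at t.

module Derivations (S : Setting c₁ ℓ₁ c₂ ℓ₂) {d e} (Φ : TModules.TModule S d) (Ψ : TModules.TModule S e) where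
  open TModules S
  open Constants S
  open MatT
  open Der
  private
    module Φ = TModule Φ
    module Ψ = TModule Ψ
    module Φh = RingHomomorphism Φ.hom
    module Ψh = RingHomomorphism Ψ.hom
    open CommutativeSemigroupProperties T.+-commutativeSemigroup using (interchange; x∙yz≈xy∙z)
    open Differences T.+-abelianGroup
    open SetoidReasoning (matSetoid e d)

  inner : Mat e d → A.Carrier → Mat e d
  inner U a = U *ᴹ Φ.at a -ᴹ Ψ.at a *ᴹ U

  module _ (W : Mat e d) where
    private
      -- The Leibniz rule applied to a + t f, with derivations vanishing on constants, leaves this
      -- recursion as the only choice with value W at t.
      δ' : A.Carrier → Mat e d
      δ' []      = 0ᴹ
      δ' (a ∷ f) = Ψ.at-t *ᴹ δ' f +ᴹ W *ᴹ Φ.at f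

      +0 : ∀ {M N : Mat e d} → M ≈ᴹ 0ᴹ → N ≈ᴹ 0ᴹ → M +ᴹ N ≈ᴹ 0ᴹ
      +0 p q i j = T.trans (T.+-cong (p i j) (q i j)) (T.+-identityˡ [])

      δ-0 : ∀ f → f A.≈ [] → δ' f ≈ᴹ 0ᴹ
      δ-0 []      p = ≈ᴹ.refl
      δ-0 (a ∷ f) p = +0 (≈ᴹ.trans (*ᴹ-congˡ Ψ.at-t (δ-0 f f≈0)) (*ᴹ-zeroʳ Ψ.at-t))
        (≈ᴹ.trans (*ᴹ-congˡ W (≈ᴹ.trans (Φh.⟦⟧-cong f≈0) Φh.0#-homo)) (*ᴹ-zeroʳ W))
        where
        f≈0 : f A.≈ []
        f≈0 = F[t].mk λ n → F[t].at p (suc n)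

      δ-cong : ∀ f g → f A.≈ g → δ' f ≈ᴹ δ' g
      δ-cong []      g       p = ≈ᴹ.sym (δ-0 g (A.sym p))
      δ-cong (a ∷ f) []      p = δ-0 (a ∷ f) p
      δ-cong (a ∷ f) (b ∷ g) p = +ᴹ-cong (*ᴹ-congˡ Ψ.at-t (δ-cong f g f≈g)) (*ᴹ-congˡ W (Φh.⟦⟧-cong f≈g))
        where
        f≈g : f A.≈ g
        f≈g = F[t].mk λ n → F[t].at p (suc n)

      δ-+ : ∀ f g → δ' (f A.+ g) ≈ᴹ δ' f +ᴹ δ' g
      δ-+ []      g       i j = T.sym (T.+-identityˡ (δ' g i j))
      δ-+ (a ∷ f) []      i j = T.sym (T.+-identityʳ (δ' (a ∷ f) i j))
      δ-+ (a ∷ f) (b ∷ g) = begin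
        Ψ.at-t *ᴹ δ' (f A.+ g) +ᴹ W *ᴹ Φ.at (f A.+ g)
          ≈⟨ +ᴹ-cong (≈ᴹ.trans (*ᴹ-congˡ Ψ.at-t (δ-+ f g)) (*ᴹ-distribˡ Ψ.at-t (δ' f) (δ' g)))
               (≈ᴹ.trans (*ᴹ-congˡ W (Φh.+-homo f g)) (*ᴹ-distribˡ W (Φ.at f) (Φ.at g))) ⟩
        (Ψ.at-t *ᴹ δ' f +ᴹ Ψ.at-t *ᴹ δ' g) +ᴹ (W *ᴹ Φ.at f +ᴹ W *ᴹ Φ.at g)
          ≈⟨ (λ i j → interchange ((Ψ.at-t *ᴹ δ' f) i j) ((Ψ.at-t *ᴹ δ' g) i j) ((W *ᴹ Φ.at f) i j) ((W *ᴹ Φ.at g) i j)) ⟩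
        δ' (a ∷ f) +ᴹ δ' (b ∷ g) ∎

      δ-· : ∀ x f → δ' (x F[t].·ₚ f) ≈ᴹ ηᵀ x ·ᴹ δ' f
      δ-· x []      i j = T.sym (T.zeroʳ (ηᵀ x))
      δ-· x (a ∷ f) = begin
        Ψ.at-t *ᴹ δ' (x F[t].·ₚ f) +ᴹ W *ᴹ Φ.at (x F[t].·ₚ f)
          ≈⟨ +ᴹ-cong (*ᴹ-congˡ Ψ.at-t (δ-· x f)) (*ᴹ-congˡ W (at-· Φ x f)) ⟩
        Ψ.at-t *ᴹ (ηᵀ x ·ᴹ δ' f) +ᴹ W *ᴹ (ηᵀ x ·ᴹ Φ.at f)
          ≈⟨ +ᴹ-cong (*ᴹ-η· x Ψ.at-t (δ' f)) (*ᴹ-η· x W (Φ.at f)) ⟩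
        ηᵀ x ·ᴹ (Ψ.at-t *ᴹ δ' f) +ᴹ ηᵀ x ·ᴹ (W *ᴹ Φ.at f)
          ≈⟨ (λ i j → T.sym (T.distribˡ (ηᵀ x) ((Ψ.at-t *ᴹ δ' f) i j) ((W *ᴹ Φ.at f) i j))) ⟩
        ηᵀ x ·ᴹ δ' (a ∷ f) ∎

      δ-* : ∀ f g → δ' (f A.* g) ≈ᴹ Ψ.at f *ᴹ δ' g +ᴹ δ' f *ᴹ Φ.at g
      δ-* []      g = ≈ᴹ.sym (+0 (≈ᴹ.trans (*ᴹ-congʳ (δ' g) Ψh.0#-homo) (*ᴹ-zeroˡ (δ' g))) (*ᴹ-zeroˡ (Φ.at g)))
      δ-* (a ∷ f) g = begin
        δ' ((a F[t].·ₚ g) A.+ (F.0# ∷ (f A.* map (λ b → b) g)))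
          ≡⟨ ≡.cong (λ g' → δ' ((a F[t].·ₚ g) A.+ (F.0# ∷ (f A.* g')))) (List.map-id g) ⟩
        δ' ((a F[t].·ₚ g) A.+ (F.0# ∷ (f A.* g)))
          ≈⟨ δ-+ (a F[t].·ₚ g) (F.0# ∷ (f A.* g)) ⟩
        δ' (a F[t].·ₚ g) +ᴹ (Ψ.at-t *ᴹ δ' (f A.* g) +ᴹ W *ᴹ Φ.at (f A.* g))
          ≈⟨ +ᴹ-cong (≈ᴹ.trans (δ-· a g) (≈ᴹ.sym (scalar-*ᴹ (ηᵀ a) (δ' g)))) (+ᴹ-cong
               (≈ᴹ.trans (*ᴹ-congˡ Ψ.at-t (δ-* f g)) (*ᴹ-distribˡ Ψ.at-t (Ψ.at f *ᴹ δ' g) (δ' f *ᴹ Φ.at g)))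
               (≈ᴹ.trans (*ᴹ-congˡ W (Φh.*-homo f g)) (≈ᴹ.sym (*ᴹ-assoc W (Φ.at f) (Φ.at g))))) ⟩
        scalar (ηᵀ a) *ᴹ δ' g +ᴹ (Ψ.at-t *ᴹ (Ψ.at f *ᴹ δ' g) +ᴹ Ψ.at-t *ᴹ (δ' f *ᴹ Φ.at g) +ᴹ W *ᴹ Φ.at f *ᴹ Φ.at g)
          ≈⟨ (λ i j → T.trans (T.+-congˡ {(scalar (ηᵀ a) *ᴹ δ' g) i j} (T.+-assoc ((Ψ.at-t *ᴹ (Ψ.at f *ᴹ δ' g)) i j) ((Ψ.at-t *ᴹ (δ' f *ᴹ Φ.at g)) i j) ((W *ᴹ Φ.at f *ᴹ Φ.at g) i j)))
               (x∙yz≈xy∙z ((scalar (ηᵀ a) *ᴹ δ' g) i j) ((Ψ.at-t *ᴹ (Ψ.at f *ᴹ δ' g)) i j) ((Ψ.at-t *ᴹ (δ' f *ᴹ Φ.at g) +ᴹ W *ᴹ Φ.at f *ᴹ Φ.at g) i j))) ⟩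
        (scalar (ηᵀ a) *ᴹ δ' g +ᴹ Ψ.at-t *ᴹ (Ψ.at f *ᴹ δ' g)) +ᴹ (Ψ.at-t *ᴹ (δ' f *ᴹ Φ.at g) +ᴹ W *ᴹ Φ.at f *ᴹ Φ.at g)
          ≈⟨ +ᴹ-cong (+ᴹ-cong (≈ᴹ.refl {x = scalar (ηᵀ a) *ᴹ δ' g}) (*ᴹ-assoc Ψ.at-t (Ψ.at f) (δ' g)))
               (+ᴹ-cong (*ᴹ-assoc Ψ.at-t (δ' f) (Φ.at g)) (≈ᴹ.refl {x = W *ᴹ Φ.at f *ᴹ Φ.at g})) ⟨
        (scalar (ηᵀ a) *ᴹ δ' g +ᴹ Ψ.at-t *ᴹ Ψ.at f *ᴹ δ' g) +ᴹ (Ψ.at-t *ᴹ δ' f *ᴹ Φ.at g +ᴹ W *ᴹ Φ.at f *ᴹ Φ.at g)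
          ≈⟨ +ᴹ-cong (*ᴹ-distribʳ (δ' g) (scalar (ηᵀ a)) (Ψ.at-t *ᴹ Ψ.at f)) (*ᴹ-distribʳ (Φ.at g) (Ψ.at-t *ᴹ δ' f) (W *ᴹ Φ.at f)) ⟨
        (scalar (ηᵀ a) +ᴹ Ψ.at-t *ᴹ Ψ.at f) *ᴹ δ' g +ᴹ δ' (a ∷ f) *ᴹ Φ.at g
          ≈⟨ +ᴹ-cong (*ᴹ-congʳ (δ' g) (at-∷ Ψ a f)) (≈ᴹ.refl {x = δ' (a ∷ f) *ᴹ Φ.at g}) ⟨
        Ψ.at (a ∷ f) *ᴹ δ' g +ᴹ δ' (a ∷ f) *ᴹ Φ.at g ∎

    derivation : Der Φ Ψ
    derivation = record
      { δ       = δ'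
      ; cong    = δ-cong _ _
      ; +-homo  = δ-+
      ; linear  = λ x a → ≈ᴹ.trans (δ-cong (F[t].const x A.* a) (x F[t].·ₚ a) (F[t].mk λ n →
          F.trans (Fskew.coeff-const-* x a n) (F.sym (F[t].coeff-· x a n)))) (δ-· x a)
      ; leibniz = δ-* }

    derivation-t : δ derivation F[t].t ≈ᴹ W
    derivation-t = ≈ᴹ.trans (+ᴹ-cong
        (≈ᴹ.trans (*ᴹ-congˡ Ψ.at-t {δ' (F.1# ∷ [])} {0ᴹ} (+0 (*ᴹ-zeroʳ Ψ.at-t) (≈ᴹ.trans (*ᴹ-congˡ W Φh.0#-homo) (*ᴹ-zeroʳ W)))) (*ᴹ-zeroʳ Ψ.at-t))
        (≈ᴹ.trans (*ᴹ-congˡ W Φh.1#-homo) (*ᴹ-identityʳ W)))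
      λ i j → T.+-identityˡ (W i j)

  -- The Leibniz rule for 1 · 1 gives δ(1) = 0, so F-linearity removes the constant term.
  δ-∷ : ∀ (D : Der Φ Ψ) a f → δ D (a ∷ f) ≈ᴹ Ψ.at-t *ᴹ δ D f +ᴹ δ D F[t].t *ᴹ Φ.at f
  δ-∷ D a f = begin
    δ D (a ∷ f)
      ≈⟨ cong D (A.trans (∷≈const+t* a f) (A.+-congʳ {F[t].t A.* f} (A.sym (A.*-identityʳ (F[t].const a))))) ⟩
    δ D (F[t].const a A.* A.1# A.+ F[t].t A.* f)
      ≈⟨ +-homo D _ _ ⟩
    δ D (F[t].const a A.* A.1#) +ᴹ δ D (F[t].t A.* f)
      ≈⟨ +ᴹ-cong (≈ᴹ.trans (linear D a A.1#) (λ i j → T.trans (T.*-congˡ {ηᵀ a} (δ-1 i j)) (T.zeroʳ (ηᵀ a)))) (leibniz D F[t].t f) ⟩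
    0ᴹ +ᴹ (Ψ.at-t *ᴹ δ D f +ᴹ δ D F[t].t *ᴹ Φ.at f)
      ≈⟨ (λ i j → T.+-identityˡ _) ⟩
    Ψ.at-t *ᴹ δ D f +ᴹ δ D F[t].t *ᴹ Φ.at f ∎
    where
    δ-1 : δ D A.1# ≈ᴹ 0ᴹ
    δ-1 i j = RingProperties.x+x≈x⇒x≈0 K⟨τ⟩.ring (δ D A.1# i j) (T.sym (≈ᴹ.trans (cong D (A.sym (A.*-identityˡ A.1#)))
      (≈ᴹ.trans (leibniz D A.1# A.1#) (+ᴹ-cong
        (≈ᴹ.trans (*ᴹ-congʳ (δ D A.1#) Ψh.1#-homo) (*ᴹ-identityˡ (δ D A.1#)))
        (≈ᴹ.trans (*ᴹ-congˡ (δ D A.1#) Φh.1#-homo) (*ᴹ-identityʳ (δ D A.1#))))) i j))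

  δ-[] : ∀ (D : Der Φ Ψ) → δ D [] ≈ᴹ 0ᴹ
  δ-[] D i j = RingProperties.x+x≈x⇒x≈0 K⟨τ⟩.ring (δ D [] i j) (T.sym (+-homo D [] [] i j))

  δ-determined : ∀ (D D' : Der Φ Ψ) → δ D F[t].t ≈ᴹ δ D' F[t].t → ∀ a → δ D a ≈ᴹ δ D' a
  δ-determined D D' p []      = ≈ᴹ.trans (δ-[] D) (≈ᴹ.sym (δ-[] D'))
  δ-determined D D' p (a ∷ f) = ≈ᴹ.trans (δ-∷ D a f) (≈ᴹ.trans
    (+ᴹ-cong (*ᴹ-congˡ Ψ.at-t (δ-determined D D' p f)) (*ᴹ-congʳ (Φ.at f) p)) (≈ᴹ.sym (δ-∷ D' a f)))

  private
    -- The terms Ψ_t U Φ_f cancel.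
    inner-∷ : ∀ U a f → inner U (a ∷ f) ≈ᴹ Ψ.at-t *ᴹ inner U f +ᴹ inner U F[t].t *ᴹ Φ.at f
    inner-∷ U a f = begin
      U *ᴹ Φ.at (a ∷ f) -ᴹ Ψ.at (a ∷ f) *ᴹ U
        ≈⟨ +ᴹ-cong (≈ᴹ.trans (*ᴹ-congˡ U (at-∷ Φ a f)) (*ᴹ-distribˡ U (scalar (ηᵀ a)) (Φ.at-t *ᴹ Φ.at f)))
             (neg (≈ᴹ.trans (*ᴹ-congʳ U (at-∷ Ψ a f)) (*ᴹ-distribʳ U (scalar (ηᵀ a)) (Ψ.at-t *ᴹ Ψ.at f)))) ⟩
      (U *ᴹ scalar (ηᵀ a) +ᴹ U *ᴹ (Φ.at-t *ᴹ Φ.at f)) -ᴹ (scalar (ηᵀ a) *ᴹ U +ᴹ Ψ.at-t *ᴹ Ψ.at f *ᴹ U)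
        ≈⟨ +ᴹ-cong (+ᴹ-cong (scalarη-comm a U) (≈ᴹ.sym (*ᴹ-assoc U Φ.at-t (Φ.at f))))
             (neg (+ᴹ-cong (≈ᴹ.refl {x = scalar (ηᵀ a) *ᴹ U}) (*ᴹ-assoc Ψ.at-t (Ψ.at f) U))) ⟩
      (scalar (ηᵀ a) *ᴹ U +ᴹ U *ᴹ Φ.at-t *ᴹ Φ.at f) -ᴹ (scalar (ηᵀ a) *ᴹ U +ᴹ Ψ.at-t *ᴹ (Ψ.at f *ᴹ U))
        ≈⟨ (λ i j → [w+x]-[w+y]≈[z-y]+[x-z] ((scalar (ηᵀ a) *ᴹ U) i j) ((U *ᴹ Φ.at-t *ᴹ Φ.at f) i j) ((Ψ.at-t *ᴹ (Ψ.at f *ᴹ U)) i j) ((Ψ.at-t *ᴹ (U *ᴹ Φ.at f)) i j)) ⟩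
      (Ψ.at-t *ᴹ (U *ᴹ Φ.at f) -ᴹ Ψ.at-t *ᴹ (Ψ.at f *ᴹ U)) +ᴹ (U *ᴹ Φ.at-t *ᴹ Φ.at f -ᴹ Ψ.at-t *ᴹ (U *ᴹ Φ.at f))
        ≈⟨ +ᴹ-cong
             (≈ᴹ.trans (*ᴹ-distribˡ Ψ.at-t (U *ᴹ Φ.at f) (-ᴹ (Ψ.at f *ᴹ U)))
               (+ᴹ-cong (≈ᴹ.refl {x = Ψ.at-t *ᴹ (U *ᴹ Φ.at f)}) (*ᴹ-negʳ Ψ.at-t (Ψ.at f *ᴹ U))))
             (≈ᴹ.trans (*ᴹ-distribʳ (Φ.at f) (U *ᴹ Φ.at-t) (-ᴹ (Ψ.at-t *ᴹ U)))
               (+ᴹ-cong (≈ᴹ.refl {x = U *ᴹ Φ.at-t *ᴹ Φ.at f})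
                 (≈ᴹ.trans (*ᴹ-negˡ (Ψ.at-t *ᴹ U) (Φ.at f)) (neg (*ᴹ-assoc Ψ.at-t U (Φ.at f)))))) ⟨
      Ψ.at-t *ᴹ inner U f +ᴹ inner U F[t].t *ᴹ Φ.at f ∎
      where
      neg : ∀ {M N : Mat e d} → M ≈ᴹ N → -ᴹ M ≈ᴹ -ᴹ N
      neg p i j = T.-‿cong (p i j)

  -- A derivation and an inner one obey the same recursion in the polynomial, so agreement at t
  -- propagates.
  inner⇒IsInner : ∀ (D : Der Φ Ψ) U → δ D F[t].t ≈ᴹ inner U F[t].t → IsInner Φ Ψ (δ D)
  inner⇒IsInner D U p = U , go
    where
    go : ∀ a → δ D a ≈ᴹ inner U a
    go []      = ≈ᴹ.trans (δ-[] D) (≈ᴹ.sym λ i j → T.trans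
      (T.+-cong (≈ᴹ.trans (*ᴹ-congˡ U Φh.0#-homo) (*ᴹ-zeroʳ U) i j)
        (T.-‿cong (≈ᴹ.trans (*ᴹ-congʳ U Ψh.0#-homo) (*ᴹ-zeroˡ U) i j)))
      (T.+-identityˡ []))
    go (a ∷ f) = ≈ᴹ.trans (δ-∷ D a f) (≈ᴹ.trans
      (+ᴹ-cong (*ᴹ-congˡ Ψ.at-t (go f)) (*ᴹ-congʳ (Φ.at f) p)) (≈ᴹ.sym (inner-∷ U a f)))

-- Frobenius twists, constant matrices, and sequences of twisted polynomials applied to
-- coefficients.

module Twists (S : Setting c₁ ℓ₁ c₂ ℓ₂) where
  open TModules S
  open Constants S
  private
    module σ = RingHomomorphism (Frobenius.frobenius K.commutativeRing p-prime K-char r)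
    module ΣK = Sums K.+-commutativeMonoid
    module ΣT = Sums T.+-commutativeMonoid
    module constH = RingHomomorphism K⟨τ⟩.constHom
    module MK = MatrixRing K.ring
  open Skew using (iterate) public
  open LinearAlgebra K using (_ᵀ; *ᴹ-ᵀ)

  iterate-cong : ∀ k {x y} → x K.≈ y → iterate k x K.≈ iterate k y
  iterate-cong zero    p = p
  iterate-cong (suc k) p = iterate-cong k (σ.⟦⟧-cong p)

  iterate-0 : ∀ k → iterate k K.0# K.≈ K.0#
  iterate-0 zero    = K.refl
  iterate-0 (suc k) = K.trans (iterate-cong k σ.0#-homo) (iterate-0 k)

  iterate-1 : ∀ k → iterate k K.1# K.≈ K.1#
  iterate-1 zero    = K.refl
  iterate-1 (suc k) = K.trans (iterate-cong k σ.1#-homo) (iterate-1 k)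

  iterate-+ : ∀ k x y → iterate k (x K.+ y) K.≈ iterate k x K.+ iterate k y
  iterate-+ zero    x y = K.refl
  iterate-+ (suc k) x y = K.trans (iterate-cong k (σ.+-homo x y)) (iterate-+ k _ _)

  iterate-* : ∀ k x y → iterate k (x K.* y) K.≈ iterate k x K.* iterate k y
  iterate-* zero    x y = K.refl
  iterate-* (suc k) x y = K.trans (iterate-cong k (σ.*-homo x y)) (iterate-* k _ _)

  iterate-σ : ∀ k x → iterate k σ.⟦ x ⟧ ≡ σ.⟦ iterate k x ⟧
  iterate-σ zero    x = ≡.refl
  iterate-σ (suc k) x = iterate-σ k σ.⟦ x ⟧

  iterate-sum : ∀ k {m} (f : Vector K.Carrier m) → iterate k (ΣK.sum f) K.≈ ΣK.sum (λ i → iterate k (f i))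
  iterate-sum k {zero}  f = iterate-0 k
  iterate-sum k {suc m} f = K.trans (iterate-+ k (f zero) (ΣK.sum (f ∘ suc))) (K.+-congˡ (iterate-sum k (f ∘ suc)))

  twist : ∀ {m l} → ℕ → MatK.Mat m l → MatK.Mat m l
  twist k M i j = iterate k (M i j)

  twist-inverse : ∀ {m} k {M N : MatK.Mat m m} → M MatK.*ᴹ N MatK.≈ᴹ MatK.1ᴹ → twist k M MatK.*ᴹ twist k N MatK.≈ᴹ MatK.1ᴹ
  twist-inverse k {M} {N} p i j = K.trans
    (K.sym (K.trans (iterate-sum k (λ h → M i h K.* N h j)) (ΣK.sum-cong-≋ λ h → iterate-* k (M i h) (N h j))))
    (K.trans (iterate-cong k (p i j)) (if-iterate (does (i Fin.≟ j))))
    where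
    if-iterate : ∀ b → iterate k (if b then K.1# else K.0#) K.≈ (if b then K.1# else K.0#)
    if-iterate true  = iterate-1 k
    if-iterate false = iterate-0 k

  mono : ℕ → K.Carrier → T.Carrier
  mono zero    a = K⟨τ⟩.const a
  mono (suc k) a = K.0# ∷ mono k a

  coeff-mono-* : ∀ k a f i → K⟨τ⟩.coeff (mono k a T.* f) (k ℕ.+ i) K.≈ a K.* iterate k (K⟨τ⟩.coeff f i)
  coeff-mono-* zero    a f i = Skew.coeff-const-* a f i
  coeff-mono-* (suc k) a f i = K.trans (K⟨τ⟩.at (Skew.0∷-* (mono k a) f) (suc (k ℕ.+ i)))
    (K.trans (coeff-mono-* k a (map σ.⟦_⟧ f) i) (K.*-congˡ (iterate-cong k (K⟨τ⟩.coeff-σ f i))))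

  coeff-*-mono : ∀ k a f i → K⟨τ⟩.coeff (f T.* mono k a) (k ℕ.+ i) K.≈ K⟨τ⟩.coeff f i K.* iterate i a
  coeff-*-mono zero    a f i = Skew.*-const f a i
  coeff-*-mono (suc k) a f i = K.trans (K⟨τ⟩.at (Skew.*-0∷ f (mono k a)) (suc (k ℕ.+ i))) (coeff-*-mono k a f i)

  const-sum : ∀ {m} (f : Vector K.Carrier m) → K⟨τ⟩.const (ΣK.sum f) T.≈ ΣT.sum (λ i → K⟨τ⟩.const (f i))
  const-sum {zero}  f = constH.0#-homo
  const-sum {suc m} f = T.+-congˡ {K⟨τ⟩.const (f zero)} (const-sum (f ∘ suc))

  constᴹ : ∀ {m l} → MatK.Mat m l → MatT.Mat m l
  constᴹ M i j = K⟨τ⟩.const (M i j)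

  constᴹ-cong : ∀ {m l} {M N : MatK.Mat m l} → M MatK.≈ᴹ N → constᴹ M MatT.≈ᴹ constᴹ N
  constᴹ-cong p i j = constH.⟦⟧-cong (p i j)

  constᴹ-* : ∀ {m l o} (M : MatK.Mat m l) (N : MatK.Mat l o) → constᴹ (M MatK.*ᴹ N) MatT.≈ᴹ constᴹ M MatT.*ᴹ constᴹ N
  constᴹ-* M N i j = T.trans (const-sum (λ h → M i h K.* N h j))
    (ΣT.sum-cong-≋ λ h → constH.*-homo (M i h) (N h j))

  constᴹ-scalar : ∀ {m} a → constᴹ (MatK.scalar {m} a) MatT.≈ᴹ MatT.scalar (K⟨τ⟩.const a)
  constᴹ-scalar a i j = if-const (does (i Fin.≟ j))
    where
    if-const : ∀ b → K⟨τ⟩.const (if b then a else K.0#) T.≈ (if b then K⟨τ⟩.const a else [])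
    if-const true  = T.refl
    if-const false = constH.0#-homo

  coeff-sum : ∀ k {m} (f : Vector T.Carrier m) → K⟨τ⟩.coeff (ΣT.sum f) k K.≈ ΣK.sum (λ i → K⟨τ⟩.coeff (f i) k)
  coeff-sum k {zero}  f = K.refl
  coeff-sum k {suc m} f = K.trans (K⟨τ⟩.coeff-+ (f zero) (ΣT.sum (f ∘ suc)) k) (K.+-congˡ (coeff-sum k (f ∘ suc)))

  coeff₀-*ᴹ : ∀ {m l o} (M : MatT.Mat m l) (N : MatT.Mat l o) → coeffᴹ (M MatT.*ᴹ N) 0 MatK.≈ᴹ coeffᴹ M 0 MatK.*ᴹ coeffᴹ N 0
  coeff₀-*ᴹ M N i j = K.trans (coeff-sum 0 (λ h → M i h T.* N h j)) (ΣK.sum-cong-≋ λ h → K⟨τ⟩.coeff₀-* (M i h) (N h j))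

  coeff-tabulate : ∀ {m} (f : Vector K.Carrier m) i → K⟨τ⟩.coeff (tabulate f) (toℕ i) ≡ f i
  coeff-tabulate f zero    = ≡.refl
  coeff-tabulate f (suc i) = coeff-tabulate (f ∘ suc) i

  coeff-tabulate-high : ∀ {m} (f : Vector K.Carrier m) i → m ≤ i → K⟨τ⟩.coeff (tabulate f) i ≡ K.0#
  coeff-tabulate-high {zero}  f i       _           = ≡.refl
  coeff-tabulate-high {suc m} f (suc i) (ℕ.s≤s m≤i) = coeff-tabulate-high (f ∘ suc) i m≤i

  bounded : ∀ {m} (f : Vector T.Carrier m) → ∃ λ B → ∀ j i → B ≤ i → K⟨τ⟩.coeff (f j) i K.≈ K.0#
  bounded {zero}  f = 0 , λ ()
  bounded {suc m} f with bounded (f ∘ suc)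
  ... | B , high = length (f zero) ℕ.⊔ B , λ
    { zero    i B≤i → beyond (f zero) i (ℕ.≤-trans (ℕ.m≤m⊔n _ B) B≤i)
    ; (suc j) i B≤i → high j i (ℕ.≤-trans (ℕ.m≤n⊔m (length (f zero)) B) B≤i) }
    where
    beyond : ∀ f i → length f ≤ i → K⟨τ⟩.coeff f i K.≈ K.0#
    beyond []      i       _         = K.refl
    beyond (a ∷ f) (suc i) (ℕ.s≤s p) = beyond f i p

  module SelfEvaluation = Evaluation S selfAlgebra
  open Points selfAlgebra using (eval; evalᴹ)

  eval-mono : ∀ k a x → eval (mono k a) x K.≈ a K.* iterate k x
  eval-mono zero    a x = SelfEvaluation.eval-const a x
  eval-mono (suc k) a x = K.trans (SelfEvaluation.eval-0∷ (mono k a) x) (eval-mono k a (x Kx.^ q))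

  -- This sends Σ aᵢ τⁱ to the sum of the values of p (k + i) at aᵢ. With p an entry of `Ρ` it is a
  -- coordinate of the remainder of Σ aᵢ τ^(k+i); the offset k lets the list be peeled from the
  -- left.
  pair : (ℕ → T.Carrier) → ℕ → T.Carrier → K.Carrier
  pair p k []      = K.0#
  pair p k (a ∷ f) = eval (p k) a K.+ pair p (suc k) f

  private
    open CommutativeSemigroupProperties K.+-commutativeSemigroup using (interchange)

    pair-0 : ∀ p k f → f T.≈ [] → pair p k f K.≈ K.0#
    pair-0 p k []      e = K.refl
    pair-0 p k (a ∷ f) e = K.trans (K.+-cong
      (K.trans (SelfEvaluation.eval-cong (p k) (K⟨τ⟩.at e zero)) (SelfEvaluation.eval-0 (p k)))
      (pair-0 p (suc k) f (K⟨τ⟩.mk λ n → K⟨τ⟩.at e (suc n)))) (K.+-identityˡ _)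

  module _ (p : ℕ → T.Carrier) where
    pair-cong : ∀ k f g → f T.≈ g → pair p k f K.≈ pair p k g
    pair-cong k []      g       e = K.sym (pair-0 p k g (T.sym e))
    pair-cong k (a ∷ f) []      e = pair-0 p k (a ∷ f) e
    pair-cong k (a ∷ f) (b ∷ g) e = K.+-cong (SelfEvaluation.eval-cong (p k) (K⟨τ⟩.at e zero))
      (pair-cong (suc k) f g (K⟨τ⟩.mk λ n → K⟨τ⟩.at e (suc n)))

    pair-+ : ∀ k f g → pair p k (f T.+ g) K.≈ pair p k f K.+ pair p k g
    pair-+ k []      g       = K.sym (K.+-identityˡ _)
    pair-+ k (a ∷ f) []      = K.sym (K.+-identityʳ _)
    pair-+ k (a ∷ f) (b ∷ g) = K.trans (K.+-cong (SelfEvaluation.eval-+ (p k) a b) (pair-+ (suc k) f g))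
      (interchange _ _ _ _)

    pair-0∷ : ∀ k f → pair p k (K.0# ∷ f) K.≈ pair p (suc k) f
    pair-0∷ k f = K.trans (K.+-congʳ (SelfEvaluation.eval-0 (p k))) (K.+-identityˡ _)

    pair-Σ : ∀ k {m} (f : Vector T.Carrier m) → pair p k (ΣT.sum f) K.≈ ΣK.sum (λ i → pair p k (f i))
    pair-Σ k {zero}  f = K.refl
    pair-Σ k {suc m} f = K.trans (pair-+ k (f zero) (ΣT.sum (f ∘ suc))) (K.+-congˡ (pair-Σ k (f ∘ suc)))

    pair-η· : ∀ x k f → pair p k (ηᵀ x T.* f) K.≈ η.⟦ x ⟧ K.* pair p k f
    pair-η· x k f = K.trans (pair-cong k (ηᵀ x T.* f) (η.⟦ x ⟧ K⟨τ⟩.·ₚ f) (K⟨τ⟩.mk λ n →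
        K.trans (Skew.coeff-const-* η.⟦ x ⟧ f n) (K.sym (K⟨τ⟩.coeff-· η.⟦ x ⟧ f n))))
      (scale k f)
      where
      scale : ∀ k f → pair p k (η.⟦ x ⟧ K⟨τ⟩.·ₚ f) K.≈ η.⟦ x ⟧ K.* pair p k f
      scale k []      = K.sym (K.zeroʳ _)
      scale k (a ∷ f) = K.trans (K.+-cong (SelfEvaluation.eval-linear (η-fixed x) (p k) a) (scale (suc k) f))
        (K.sym (K.distribˡ _ _ _))

    -- The list may be longer or shorter than m: surplus entries are zero, and missing ones
    -- contribute values at 0.
    pair-bounded : ∀ m k f → (∀ i → m ≤ i → K⟨τ⟩.coeff f i K.≈ K.0#) →
      pair p k f K.≈ ΣK.sum {m} (λ i → eval (p (k ℕ.+ toℕ i)) (K⟨τ⟩.coeff f (toℕ i)))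
    pair-bounded zero    k f       b = pair-0 p k f (K⟨τ⟩.mk λ n → b n ℕ.z≤n)
    pair-bounded (suc m) k []      b = K.sym (ΣK.sum-0 {suc m} (λ i → eval (p (k ℕ.+ toℕ i)) K.0#)
      λ i → SelfEvaluation.eval-0 (p (k ℕ.+ toℕ i)))
    pair-bounded (suc m) k (a ∷ f) b = K.+-cong
      (K.reflexive (≡.cong (λ l → eval (p l) a) (≡.sym (ℕ.+-identityʳ k))))
      (K.trans (pair-bounded m (suc k) f λ i m≤i → b (suc i) (ℕ.s≤s m≤i))
        (ΣK.sum-cong-≋ {m} λ i → K.reflexive (≡.cong (λ l → eval (p l) (K⟨τ⟩.coeff f (toℕ i))) (≡.sym (ℕ.+-suc k (toℕ i))))))

  pair-vanishing : ∀ p → (∀ k → p k T.≈ []) → ∀ k f → pair p k f K.≈ K.0#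
  pair-vanishing p z k []      = K.refl
  pair-vanishing p z k (a ∷ f) = K.trans (K.+-cong (SelfEvaluation.eval-congˡ (p k) [] a (z k)) (pair-vanishing p z (suc k) f))
    (K.+-identityˡ _)

  pair-suc : ∀ p k f → pair p (suc k) f K.≈ pair (p ∘ suc) k f
  pair-suc p k []      = K.refl
  pair-suc p k (a ∷ f) = K.+-congˡ (pair-suc p (suc k) f)

  -- Evaluation is additive, so a row g can be moved inside the pairing. It serves to apply Λ to a
  -- remainder.
  sum-eval-pair : ∀ {m} (g : Vector T.Carrier m) (p : Fin m → ℕ → T.Carrier) k f →
    ΣK.sum (λ r → eval (g r) (pair (p r) k f)) K.≈ pair (λ i → ΣT.sum (λ r → g r T.* p r i)) k f
  sum-eval-pair g p k []      = ΣK.sum-0 (λ r → eval (g r) K.0#) λ r → SelfEvaluation.eval-0 (g r)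
  sum-eval-pair g p k (a ∷ f) = K.trans
    (ΣK.sum-cong-≋ λ r → K.trans (SelfEvaluation.eval-+ (g r) (eval (p r k) a) (pair (p r) (suc k) f))
      (K.+-congʳ (K.sym (SelfEvaluation.eval-* (g r) (p r k) a))))
    (K.trans (ΣK.∑-distrib-+ (λ r → eval (g r T.* p r k) a) (λ r → eval (g r) (pair (p r) (suc k) f)))
      (K.+-cong (K.sym (SelfEvaluation.eval-sumˡ (λ r → g r T.* p r k) a)) (sum-eval-pair g p (suc k) f)))

  module _ {a} {M : Set a} where
    -- One step of a recurrence: the oldest entry is dropped and the new value `m` is put at the
    -- end.
    advance : ∀ {n} → (Fin (suc n) → M) → M → Fin (suc n) → M
    advance {zero}  w m i       = m
    advance {suc n} w m zero    = w (suc zero)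
    advance {suc n} w m (suc i) = advance (w ∘ suc) m i

    advance-inject₁ : ∀ {n} (w : Fin (suc n) → M) m i → advance w m (inject₁ i) ≡ w (suc i)
    advance-inject₁ {suc n} w m zero    = ≡.refl
    advance-inject₁ {suc n} w m (suc i) = advance-inject₁ (w ∘ suc) m i

    advance-fromℕ : ∀ {n} (w : Fin (suc n) → M) m → advance w m (fromℕ n) ≡ m
    advance-fromℕ {zero}  w m = ≡.refl
    advance-fromℕ {suc n} w m = advance-fromℕ (w ∘ suc) m

    advance-all : ∀ {ℓ} {n} (P : M → Set ℓ) (w : Fin (suc n) → M) m → (∀ i → P (w (suc i))) → P m → ∀ i → P (advance w m i)
    advance-all {n = zero}  P w m ws pm i       = pm
    advance-all {n = suc n} P w m ws pm zero    = ws zero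
    advance-all {n = suc n} P w m ws pm (suc i) = advance-all P (w ∘ suc) m (ws ∘ suc) pm i

-- Division by Φ_t: the remainder map and the action of t on remainders.

module Reduction (S : Setting c₁ ℓ₁ c₂ ℓ₂) where
  open TModules S
  open Constants S
  open Twists S
  open Points selfAlgebra
  open LinearAlgebra K using (_ᵀ; *ᴹ-ᵀ)
  private
    module E = SelfEvaluation
    module ΣK = Sums K.+-commutativeMonoid
    module ΣT = Sums T.+-commutativeMonoid
    module MK = MatrixRing K.ring

  module Recurrence {d} (Φ : TModule d) (ψ : TModule 1) (n' : ℕ) (A⁻¹ : MatK.Mat d d)
    (A-high : ∀ j → suc n' < j → coeffᴹ (TModule.at-t Φ) j MatK.≈ᴹ MatK.0ᴹ)
    (A-inverse : MatK.IsInverse (coeffᴹ (TModule.at-t Φ) (suc n')) A⁻¹)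
    (b-high : ∀ i → suc n' ≤ i → K⟨τ⟩.coeff (TModule.at-t ψ zero zero) i K.≈ K.0#) where

    private
      module Φ = TModule Φ
      module ψ = TModule ψ
      n = suc n'
      ψ₀ = ψ.at-t zero zero

    A_ : ℕ → MatK.Mat d d
    A_ = coeffᴹ Φ.at-t

    b : ℕ → K.Carrier
    b = K⟨τ⟩.coeff ψ₀

    -- The product a τᵏ A_i τⁱ has coefficient a σᵏ(A_i), with σ the Frobenius. Evaluation acts on
    -- columns, so the row a becomes a column and the twisted matrix is transposed.
    Aᵗ : ℕ → ℕ → MatT.Mat d d
    Aᵗ k i = constᴹ (twist k (A_ i) ᵀ)

    A⁻ᵗ : ℕ → MatT.Mat d d
    A⁻ᵗ k = constᴹ (twist k A⁻¹ ᵀ)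

    -- Modulo inner values u τᵏ Φ_t equals ψ_t u τᵏ. Hence the term u σᵏ(Aₙ) τ^(k+n) is replaced by
    -- terms of degree k + i, i < n, with coefficients bᵢ u^(qⁱ) - u σᵏ(A_i).
    X : ℕ → ℕ → MatT.Mat d d
    X k i = MatT.scalar (mono i (b i)) MatT.-ᴹ Aᵗ k i

    Σᴹ : ∀ {m k l} → (Fin m → MatT.Mat k l) → MatT.Mat k l
    Σᴹ M r j = ΣT.sum (λ i → M i r j)

    -- `A⁻ᵗ k` recovers u from the coefficient u σᵏ(Aₙ) that is being removed.
    next : ∀ {k} → ℕ → (Fin n → MatT.Mat k d) → MatT.Mat k d
    next k w = Σᴹ (λ i → w i MatT.*ᴹ X k (toℕ i)) MatT.*ᴹ A⁻ᵗ k

    -- Ρ k is the matrix of w ↦ (w τᵏ reduced to degree < n).  Reducing the term of degree k + n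
    -- by the inner derivation of w τᵏ gives a recurrence of order n; window k holds Ρ k, …, Ρ (k + n'),
    -- and the coefficient of eⱼ τⁱ in a reduced row is stored at index combine i j.
    window : ℕ → Fin n → MatT.Mat (n ℕ.* d) d
    window zero    i r j = MatT.1ᴹ r (combine i j)
    window (suc k)       = advance (window k) (next k (window k))

    Ρ : ℕ → MatT.Mat (n ℕ.* d) d
    Ρ k = window k zero

    window≡Ρ : ∀ m i → toℕ i ≡ m → ∀ k → window k i ≡ Ρ (k ℕ.+ m)
    window≡Ρ zero    zero    e k = ≡.cong Ρ (≡.sym (ℕ.+-identityʳ k))
    window≡Ρ (suc m) (suc i) e k = ≡.trans (≡.sym (advance-inject₁ (window k) (next k (window k)) i))
      (≡.trans (window≡Ρ m (inject₁ i) (≡.trans (Fin.toℕ-inject₁ i) (ℕ.suc-injective e)) (suc k))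
        (≡.cong Ρ (≡.sym (ℕ.+-suc k m))))

    Ρ-next : ∀ k → Ρ (k ℕ.+ n) ≡ next k (window k)
    Ρ-next k = ≡.trans (≡.cong Ρ (ℕ.+-suc k n')) (≡.trans
      (≡.sym (window≡Ρ n' (fromℕ n') (Fin.toℕ-fromℕ n') (suc k)))
      (advance-fromℕ (window k) (next k (window k))))

    evalᴹ-Σᴹ : ∀ {m k l} (M : Fin m → MatT.Mat k l) x r → evalᴹ (Σᴹ M) x r K.≈ ΣK.sum (λ i → evalᴹ (M i) x r)
    evalᴹ-Σᴹ M x r = K.trans (ΣK.sum-cong-≋ λ j → E.eval-sumˡ (λ i → M i r j) (x j))
      (ΣK.∑-comm (λ j i → eval (M i r j) (x j)))

    A⁻ᵗ*Aᵗ : ∀ k u → evalᴹ (A⁻ᵗ k) (evalᴹ (Aᵗ k n) u) ≈ᵛ u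
    A⁻ᵗ*Aᵗ k u i = K.trans (K.sym (E.evalᴹ-* (A⁻ᵗ k) (Aᵗ k n) u i)) (K.trans
      (E.evalᴹ-congˡ (A⁻ᵗ k MatT.*ᴹ Aᵗ k n) {MatT.scalar T.1#} inverse u i)
      (K.trans (E.evalᴹ-scalar T.1# u i) (E.eval-1 (u i))))
      where
      inverse : A⁻ᵗ k MatT.*ᴹ Aᵗ k n MatT.≈ᴹ MatT.scalar T.1#
      inverse = ≈ᴹ.trans (≈ᴹ.sym (constᴹ-* (twist k A⁻¹ ᵀ) (twist k (A_ n) ᵀ))) (≈ᴹ.trans
        (constᴹ-cong {M = twist k A⁻¹ ᵀ MatK.*ᴹ twist k (A_ n) ᵀ} {N = MatK.1ᴹ} λ i j →
          K.trans (*ᴹ-ᵀ (twist k (A_ n)) (twist k A⁻¹) i j)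
          (K.trans (twist-inverse k (proj₁ A-inverse) j i) (MK.1ᴹ-comm j i)))
        (constᴹ-scalar K.1#))

    -- Prescribing u instead of the top coefficient clears the inverse matrix from the definition of
    -- `next`.
    recurrence : ∀ k u r → evalᴹ (Ρ (k ℕ.+ n)) (evalᴹ (Aᵗ k n) u) r K.≈
      ΣK.sum {n} (λ i → evalᴹ (Ρ (k ℕ.+ toℕ i)) (evalᴹ (X k (toℕ i)) u) r)
    recurrence k u r = begin
      evalᴹ (Ρ (k ℕ.+ n)) v r
        ≡⟨ ≡.cong (λ M → evalᴹ M v r) (Ρ-next k) ⟩
      evalᴹ (next k (window k)) v r
        ≈⟨ E.evalᴹ-* (Σᴹ (λ i → window k i MatT.*ᴹ X k (toℕ i))) (A⁻ᵗ k) v r ⟩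
      evalᴹ (Σᴹ (λ i → window k i MatT.*ᴹ X k (toℕ i))) (evalᴹ (A⁻ᵗ k) v) r
        ≈⟨ E.evalᴹ-cong (Σᴹ (λ i → window k i MatT.*ᴹ X k (toℕ i))) (A⁻ᵗ*Aᵗ k u) r ⟩
      evalᴹ (Σᴹ (λ i → window k i MatT.*ᴹ X k (toℕ i))) u r
        ≈⟨ evalᴹ-Σᴹ (λ i → window k i MatT.*ᴹ X k (toℕ i)) u r ⟩
      ΣK.sum {n} (λ i → evalᴹ (window k i MatT.*ᴹ X k (toℕ i)) u r)
        ≈⟨ ΣK.sum-cong-≋ {n} (λ i → K.trans (E.evalᴹ-* (window k i) (X k (toℕ i)) u r)
             (K.reflexive (≡.cong (λ M → evalᴹ M (evalᴹ (X k (toℕ i)) u) r) (window≡Ρ (toℕ i) i ≡.refl k)))) ⟩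
      ΣK.sum {n} (λ i → evalᴹ (Ρ (k ℕ.+ toℕ i)) (evalᴹ (X k (toℕ i)) u) r) ∎
      where
      open SetoidReasoning K.setoid
      v = evalᴹ (Aᵗ k n) u

    module _ (k : ℕ) (h : Fin d) (a : K.Carrier) (r : Fin (n ℕ.* d)) where
      private
        open SetoidReasoning K.setoid
        P : ℕ → MatT.Mat (n ℕ.* d) d
        P i = Ρ (k ℕ.+ i)
        u : Vector K.Carrier d
        u j = MatK.1ᴹ h j K.* a
        v w : ℕ → Vector K.Carrier d
        v i j = a K.* iterate k (A_ i h j)
        w i j = b i K.* iterate i (u j)
        u-h : u h K.≈ a
        u-h = K.trans (K.*-congʳ (MK.1ᴹ-diagonal h)) (K.*-identityˡ a)
        u-off : ∀ j → j ≢ h → u j K.≈ K.0#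
        u-off j j≢h = K.trans (K.*-congʳ (MK.1ᴹ-off (j≢h ∘ ≡.sym))) (K.zeroˡ a)

        Aᵗ-u : ∀ i → evalᴹ (Aᵗ k i) u ≈ᵛ v i
        Aᵗ-u i j = K.trans (ΣK.sum-single (λ l → eval (Aᵗ k i j l) (u l)) h λ l l≢h →
            K.trans (E.eval-cong (Aᵗ k i j l) (u-off l l≢h)) (E.eval-0 (Aᵗ k i j l)))
          (K.trans (E.eval-const _ (u h)) (K.trans (K.*-congˡ u-h) (K.*-comm _ _)))

        X-u : ∀ i → evalᴹ (X k i) u ≈ᵛ (λ j → w i j K.- v i j)
        X-u i j = K.trans (E.evalᴹ-+ˡ (MatT.scalar (mono i (b i))) (MatT.-ᴹ Aᵗ k i) u j)
          (K.+-cong (K.trans (E.evalᴹ-scalar (mono i (b i)) u j) (eval-mono i (b i) (u j)))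
            (K.trans (E.evalᴹ-negˡ (Aᵗ k i) u j) (K.-‿cong (Aᵗ-u i j))))

        P-w : ∀ i → evalᴹ (P i) (w i) r K.≈ eval (P i r h) (b i K.* iterate i a)
        P-w i = K.trans (ΣK.sum-single (λ j → eval (P i r j) (w i j)) h λ j j≢h →
            K.trans (E.eval-cong (P i r j) (K.trans (K.*-congˡ (K.trans (iterate-cong i (u-off j j≢h)) (iterate-0 i))) (K.zeroʳ _)))
              (E.eval-0 (P i r j)))
          (E.eval-cong (P i r h) (K.*-congˡ (iterate-cong i u-h)))

        C : ℕ → K.Carrier
        C i = evalᴹ (P i) (v i) r

        P-X-u : ∀ i → evalᴹ (P i) (evalᴹ (X k i) u) r K.≈ evalᴹ (P i) (w i) r K.- C i
        P-X-u i = K.trans (E.evalᴹ-cong (P i) (X-u i) r) (K.trans (E.evalᴹ-+ (P i) (w i) (λ j → K.- v i j) r)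
          (K.+-congˡ (K.trans (ΣK.sum-cong-≋ λ j → E.eval-neg (P i r j) (v i j))
            (sum-neg (λ j → eval (P i r j) (v i j))))))
          where
          sum-neg : ∀ {m} (f : Vector K.Carrier m) → ΣK.sum (λ j → K.- f j) K.≈ K.- ΣK.sum f
          sum-neg f = RingProperties.+-inverseʳ-unique K.ring (ΣK.sum f) (ΣK.sum (λ j → K.- f j))
            (K.trans (K.sym (ΣK.∑-distrib-+ f (λ j → K.- f j))) (ΣK.sum-0 (λ j → f j K.+ K.- f j) λ j → K.-‿inverseʳ (f j)))

        cancel : ∀ x y → x K.+ (y K.- x) K.≈ y
        cancel x y = K.trans (K.+-congˡ (K.+-comm y (K.- x))) (K.trans (K.sym (K.+-assoc x (K.- x) y))
          (K.trans (K.+-congʳ (K.-‿inverseʳ x)) (K.+-identityˡ y)))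

      -- Coordinate r of the remainder of a τᵏ times row h of Φ_t, against that of ψ_t a τᵏ in place
      -- h. The recurrence rewrites the top term of the left side as the right side minus the lower
      -- terms of the left.
      balance : ΣK.sum (λ j → ΣK.sum {suc n} (λ i → eval (Ρ (k ℕ.+ toℕ i) r j) (a K.* iterate k (A_ (toℕ i) h j)))) K.≈
                ΣK.sum {n} (λ i → eval (Ρ (k ℕ.+ toℕ i) r h) (b (toℕ i) K.* iterate (toℕ i) a))
      balance = begin
        ΣK.sum (λ j → ΣK.sum {suc n} (λ i → eval (P (toℕ i) r j) (v (toℕ i) j)))
          ≈⟨ ΣK.∑-comm (λ j (i : Fin (suc n)) → eval (P (toℕ i) r j) (v (toℕ i) j)) ⟩
        ΣK.sum {suc n} (λ i → C (toℕ i))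
          ≈⟨ ΣK.sum-init-last {n} (λ i → C (toℕ i)) ⟩
        ΣK.sum {n} (λ i → C (toℕ (inject₁ i))) K.+ C (toℕ (fromℕ n))
          ≈⟨ K.+-cong (ΣK.sum-cong-≋ {n} λ i → K.reflexive (≡.cong C (Fin.toℕ-inject₁ i))) (K.reflexive (≡.cong C (Fin.toℕ-fromℕ n))) ⟩
        ΣK.sum {n} (λ i → C (toℕ i)) K.+ C n
          ≈⟨ K.+-congˡ (K.trans (K.sym (E.evalᴹ-cong (P n) (Aᵗ-u n) r)) (recurrence k u r)) ⟩
        ΣK.sum {n} (λ i → C (toℕ i)) K.+ ΣK.sum {n} (λ i → evalᴹ (P (toℕ i)) (evalᴹ (X k (toℕ i)) u) r)
          ≈⟨ ΣK.∑-distrib-+ {n} (λ i → C (toℕ i)) (λ i → evalᴹ (P (toℕ i)) (evalᴹ (X k (toℕ i)) u) r) ⟨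
        ΣK.sum {n} (λ i → C (toℕ i) K.+ evalᴹ (P (toℕ i)) (evalᴹ (X k (toℕ i)) u) r)
          ≈⟨ ΣK.sum-cong-≋ {n} (λ i → K.trans (K.+-congˡ (P-X-u (toℕ i))) (K.trans (cancel _ _) (P-w (toℕ i)))) ⟩
        ΣK.sum {n} (λ i → eval (P (toℕ i) r h) (b (toℕ i) K.* iterate (toℕ i) a)) ∎

    private
      Ρ[_,_] : Fin (n ℕ.* d) → Fin d → ℕ → T.Carrier
      Ρ[ r , j ] k = Ρ k r j

      pair-ψ-const : ∀ p k a → pair p k (ψ₀ T.* K⟨τ⟩.const a) K.≈
        ΣK.sum {n} (λ i → eval (p (k ℕ.+ toℕ i)) (b (toℕ i) K.* iterate (toℕ i) a))
      pair-ψ-const p k a = K.trans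
        (pair-bounded p n k (ψ₀ T.* K⟨τ⟩.const a) λ i n≤i → K.trans (Skew.*-const ψ₀ a i)
          (K.trans (K.*-congʳ (b-high i n≤i)) (K.zeroˡ _)))
        (ΣK.sum-cong-≋ {n} λ i → E.eval-cong (p (k ℕ.+ toℕ i)) (Skew.*-const ψ₀ a (toℕ i)))

      pair-ψ-∷ : ∀ p k a f → pair p k (ψ₀ T.* (a ∷ f)) K.≈ pair p k (ψ₀ T.* K⟨τ⟩.const a) K.+ pair p (suc k) (ψ₀ T.* f)
      pair-ψ-∷ p k a f = K.trans (pair-cong p k (ψ₀ T.* (a ∷ f)) (ψ₀ T.* K⟨τ⟩.const a T.+ (K.0# ∷ (ψ₀ T.* f))) (Skew.*-∷ ψ₀ a f))
        (K.trans (pair-+ p k (ψ₀ T.* K⟨τ⟩.const a) (K.0# ∷ (ψ₀ T.* f))) (K.+-congˡ (pair-0∷ p k (ψ₀ T.* f))))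

    -- `balance` summed over the terms of f. Each power of τ that is peeled off twists row h of Φ_t
    -- once more, which is why g is only known to be the k-fold twist of that row; k = 0 gives equal
    -- remainders for f Φ_t and ψ_t f.
    absorb : ∀ r h f k (g : Fin d → T.Carrier) → (∀ j i → K⟨τ⟩.coeff (g j) i K.≈ iterate k (A_ i h j)) →
      ΣK.sum (λ j → pair Ρ[ r , j ] k (f T.* g j)) K.≈ pair Ρ[ r , h ] k (ψ₀ T.* f)
    absorb r h []      k g G = K.trans (ΣK.sum-0 {d} (λ _ → K.0#) λ _ → K.refl)
      (pair-cong Ρ[ r , h ] k [] (ψ₀ T.* []) (T.sym (T.zeroʳ ψ₀)))
    absorb r h (a ∷ f) k g G = begin
      ΣK.sum (λ j → pair Ρ[ r , j ] k ((a ∷ f) T.* g j))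
        ≈⟨ ΣK.sum-cong-≋ (λ j → K.trans
             (pair-cong Ρ[ r , j ] k ((a ∷ f) T.* g j) (K⟨τ⟩.const a T.* g j T.+ (K.0# ∷ (f T.* σg j))) (∷-* j))
             (K.trans (pair-+ Ρ[ r , j ] k (K⟨τ⟩.const a T.* g j) (K.0# ∷ (f T.* σg j)))
               (K.+-cong (head j) (pair-0∷ Ρ[ r , j ] k (f T.* σg j))))) ⟩
      ΣK.sum (λ j → term j K.+ pair Ρ[ r , j ] (suc k) (f T.* σg j))
        ≈⟨ ΣK.∑-distrib-+ term (λ j → pair Ρ[ r , j ] (suc k) (f T.* σg j)) ⟩
      ΣK.sum term K.+ ΣK.sum (λ j → pair Ρ[ r , j ] (suc k) (f T.* σg j))
        ≈⟨ K.+-cong (K.trans (balance k h a r) (K.sym (pair-ψ-const Ρ[ r , h ] k a))) (absorb r h f (suc k) σg G') ⟩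
      pair Ρ[ r , h ] k (ψ₀ T.* K⟨τ⟩.const a) K.+ pair Ρ[ r , h ] (suc k) (ψ₀ T.* f)
        ≈⟨ pair-ψ-∷ Ρ[ r , h ] k a f ⟨
      pair Ρ[ r , h ] k (ψ₀ T.* (a ∷ f)) ∎
      where
      open SetoidReasoning K.setoid
      module σ = RingHomomorphism (Frobenius.frobenius K.commutativeRing p-prime K-char (Setting.r S))
      σg : Fin d → T.Carrier
      σg j = map σ.⟦_⟧ (g j)
      term : Fin d → K.Carrier
      term j = ΣK.sum {suc n} (λ i → eval (Ρ (k ℕ.+ toℕ i) r j) (a K.* iterate k (A_ (toℕ i) h j)))
      G' : ∀ j i → K⟨τ⟩.coeff (σg j) i K.≈ iterate (suc k) (A_ i h j)
      G' j i = K.trans (K⟨τ⟩.coeff-σ (g j) i) (K.trans (σ.⟦⟧-cong (G j i)) (K.reflexive (≡.sym (iterate-σ k (A_ i h j)))))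
      ∷-* : ∀ j → (a ∷ f) T.* g j T.≈ K⟨τ⟩.const a T.* g j T.+ (K.0# ∷ (f T.* σg j))
      ∷-* j = T.trans (T.*-congʳ {g j} (Skew.∷≈const+0∷ a f)) (T.trans (T.distribʳ (g j) (K⟨τ⟩.const a) (K.0# ∷ f))
        (T.+-congˡ {K⟨τ⟩.const a T.* g j} (Skew.0∷-* f (g j))))
      coeff-a : ∀ j i → K⟨τ⟩.coeff (K⟨τ⟩.const a T.* g j) i K.≈ a K.* iterate k (A_ i h j)
      coeff-a j i = K.trans (Skew.coeff-const-* a (g j) i) (K.*-congˡ (G j i))
      head : ∀ j → pair Ρ[ r , j ] k (K⟨τ⟩.const a T.* g j) K.≈ term j
      head j = K.trans
        (pair-bounded Ρ[ r , j ] (suc n) k (K⟨τ⟩.const a T.* g j) λ i n<i → K.trans (coeff-a j i)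
          (K.trans (K.*-congˡ (K.trans (iterate-cong k (A-high i n<i h j)) (iterate-0 k))) (K.zeroʳ a)))
        (ΣK.sum-cong-≋ {suc n} λ i → E.eval-cong (Ρ (k ℕ.+ toℕ i) r j) (coeff-a j (toℕ i)))

    ρ : MatT.Mat 1 d → Vector K.Carrier (n ℕ.* d)
    ρ W r = ΣK.sum (λ j → pair Ρ[ r , j ] 0 (W zero j))

    I : MatT.Mat 1 d → MatT.Mat 1 d
    I U = U MatT.*ᴹ Φ.at-t MatT.-ᴹ ψ.at-t MatT.*ᴹ U

    ρ-cong : ∀ {W W'} → W MatT.≈ᴹ W' → ρ W ≈ᵛ ρ W'
    ρ-cong {W} {W'} p r = ΣK.sum-cong-≋ λ j → pair-cong Ρ[ r , j ] 0 (W zero j) (W' zero j) (p zero j)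

    ρ-+ : ∀ W W' → ρ (W MatT.+ᴹ W') ≈ᵛ (λ r → ρ W r K.+ ρ W' r)
    ρ-+ W W' r = K.trans (ΣK.sum-cong-≋ λ j → pair-+ Ρ[ r , j ] 0 (W zero j) (W' zero j))
      (ΣK.∑-distrib-+ (λ j → pair Ρ[ r , j ] 0 (W zero j)) (λ j → pair Ρ[ r , j ] 0 (W' zero j)))

    ρ-0 : ρ MatT.0ᴹ ≈ᵛ (λ _ → K.0#)
    ρ-0 r = ΣK.sum-0 {d} (λ _ → K.0#) λ _ → K.refl

    ρ-neg : ∀ W → ρ (MatT.-ᴹ W) ≈ᵛ (λ r → K.- ρ W r)
    ρ-neg W r = RingProperties.+-inverseʳ-unique K.ring (ρ W r) (ρ (MatT.-ᴹ W) r)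
      (K.trans (K.sym (ρ-+ W (MatT.-ᴹ W) r)) (K.trans
        (ρ-cong {W MatT.-ᴹ W} {MatT.0ᴹ} (λ i j → T.-‿inverseʳ (W i j)) r) (ρ-0 r)))

    ρ-η· : ∀ x W → ρ (ηᵀ x MatT.·ᴹ W) ≈ᵛ (λ r → η.⟦ x ⟧ K.* ρ W r)
    ρ-η· x W r = K.trans (ΣK.sum-cong-≋ λ j → pair-η· Ρ[ r , j ] x 0 (W zero j))
      (K.sym (Sum.*-distribˡ-sum K.semiring η.⟦ x ⟧ (λ j → pair Ρ[ r , j ] 0 (W zero j))))

    ψ-* : ∀ (W : MatT.Mat 1 d) j → (ψ.at-t MatT.*ᴹ W) zero j T.≈ ψ₀ T.* W zero j
    ψ-* W j = T.+-identityʳ (ψ₀ T.* W zero j)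

    ρ-I : ∀ U → ρ (I U) ≈ᵛ (λ _ → K.0#)
    ρ-I U r = K.trans (ρ-+ (U MatT.*ᴹ Φ.at-t) (MatT.-ᴹ (ψ.at-t MatT.*ᴹ U)) r)
      (K.trans (K.+-cong UΦ≈ψU (ρ-neg (ψ.at-t MatT.*ᴹ U) r)) (K.-‿inverseʳ _))
      where
      open SetoidReasoning K.setoid
      UΦ≈ψU : ρ (U MatT.*ᴹ Φ.at-t) r K.≈ ρ (ψ.at-t MatT.*ᴹ U) r
      UΦ≈ψU = begin
        ΣK.sum (λ j → pair Ρ[ r , j ] 0 ((U MatT.*ᴹ Φ.at-t) zero j))
          ≈⟨ ΣK.sum-cong-≋ (λ j → pair-Σ Ρ[ r , j ] 0 (λ h → U zero h T.* Φ.at-t h j)) ⟩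
        ΣK.sum (λ j → ΣK.sum (λ h → pair Ρ[ r , j ] 0 (U zero h T.* Φ.at-t h j)))
          ≈⟨ ΣK.∑-comm (λ j h → pair Ρ[ r , j ] 0 (U zero h T.* Φ.at-t h j)) ⟩
        ΣK.sum (λ h → ΣK.sum (λ j → pair Ρ[ r , j ] 0 (U zero h T.* Φ.at-t h j)))
          ≈⟨ ΣK.sum-cong-≋ (λ h → K.trans (absorb r h (U zero h) 0 (Φ.at-t h) λ j i → K.refl)
               (pair-cong Ρ[ r , h ] 0 (ψ₀ T.* U zero h) ((ψ.at-t MatT.*ᴹ U) zero h) (T.sym (ψ-* U h)))) ⟩
        ρ (ψ.at-t MatT.*ᴹ U) r ∎

    lift : Vector K.Carrier (n ℕ.* d) → MatT.Mat 1 d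
    lift c _ j = tabulate {n = n} (λ i → c (combine i j))

    Low : MatT.Mat 1 d → Set ℓ₂
    Low W = ∀ j i → n ≤ i → K⟨τ⟩.coeff (W zero j) i K.≈ K.0#

    lift-low : ∀ c → Low (lift c)
    lift-low c j i n≤i = K.reflexive (coeff-tabulate-high {n} (λ i → c (combine i j)) i n≤i)

    lift-coeff : ∀ c j i → K⟨τ⟩.coeff (lift c zero j) (toℕ i) K.≈ c (combine i j)
    lift-coeff c j i = K.reflexive (coeff-tabulate {n} (λ i → c (combine i j)) i)

    -- For i < n the matrices `Ρ i` form the initial window, which stores a coefficient at its index
    -- without reducing anything.
    ρ-low : ∀ W c → Low W → (∀ j (i : Fin n) → K⟨τ⟩.coeff (W zero j) (toℕ i) K.≈ c (combine i j)) → ρ W ≈ᵛ c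
    ρ-low W c low W≈c r = begin
      ΣK.sum (λ j → pair Ρ[ r , j ] 0 (W zero j))
        ≈⟨ ΣK.sum-cong-≋ (λ j → K.trans (pair-bounded Ρ[ r , j ] n 0 (W zero j) (low j))
             (ΣK.sum-cong-≋ {n} λ i → K.trans (E.eval-cong (Ρ (toℕ i) r j) (W≈c j i))
               (K.reflexive (≡.cong (λ M → eval (M r j) (c (combine i j))) (≡.sym (window≡Ρ (toℕ i) i ≡.refl 0)))))) ⟩
      ΣK.sum (λ j → ΣK.sum {n} (λ i → eval (MatT.1ᴹ r (combine i j)) (c (combine i j))))
        ≈⟨ ΣK.∑-comm (λ j (i : Fin n) → eval (MatT.1ᴹ r (combine i j)) (c (combine i j))) ⟩
      ΣK.sum {n} (λ i → ΣK.sum (λ j → eval (MatT.1ᴹ r (combine i j)) (c (combine i j))))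
        ≈⟨ ΣK.sum-combine n {d} (λ r' → eval (MatT.1ᴹ r r') (c r')) ⟨
      evalᴹ MatT.1ᴹ c r
        ≈⟨ K.trans (E.evalᴹ-scalar T.1# c r) (E.eval-1 (c r)) ⟩
      c r ∎
      where open SetoidReasoning K.setoid

    ρ-lift : ∀ c → ρ (lift c) ≈ᵛ c
    ρ-lift c = ρ-low (lift c) c (lift-low c) (lift-coeff c)

    I-+ : ∀ U V → I (U MatT.+ᴹ V) MatT.≈ᴹ I U MatT.+ᴹ I V
    I-+ U V i j = T.trans (T.+-cong (MatT.*ᴹ-distribʳ Φ.at-t U V i j)
        (T.trans (T.-‿cong (MatT.*ᴹ-distribˡ ψ.at-t U V i j)) (T.sym (RingProperties.-‿+-comm K⟨τ⟩.ring ((ψ.at-t MatT.*ᴹ U) i j) ((ψ.at-t MatT.*ᴹ V) i j)))))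
      (interchange ((U MatT.*ᴹ Φ.at-t) i j) ((V MatT.*ᴹ Φ.at-t) i j) (T.- (ψ.at-t MatT.*ᴹ U) i j) (T.- (ψ.at-t MatT.*ᴹ V) i j))
      where open CommutativeSemigroupProperties T.+-commutativeSemigroup using (interchange)

    I-0 : I MatT.0ᴹ MatT.≈ᴹ MatT.0ᴹ
    I-0 i j = T.trans (T.+-cong (MatT.*ᴹ-zeroˡ {1} Φ.at-t i j) (T.-‿cong (MatT.*ᴹ-zeroʳ ψ.at-t i j))) T.refl

    ψ-I : ∀ U → ψ.at-t MatT.*ᴹ I U MatT.≈ᴹ I (ψ.at-t MatT.*ᴹ U)
    ψ-I U = ≈ᴹ.trans (MatT.*ᴹ-distribˡ ψ.at-t (U MatT.*ᴹ Φ.at-t) (MatT.-ᴹ (ψ.at-t MatT.*ᴹ U)))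
      (+ᴹ-cong (≈ᴹ.sym (MatT.*ᴹ-assoc ψ.at-t U Φ.at-t)) (MatT.*ᴹ-negʳ ψ.at-t (ψ.at-t MatT.*ᴹ U)))

    -- Induction on the excess B of the degree. Subtracting I (u τᴮ) with u σᴮ(Aₙ) = w removes the
    -- coefficient w of degree B + n; the product ψ_t u τᴮ stays below that degree and does not
    -- interfere.
    divide : ∀ B W → (∀ j i → n ≤ i → K⟨τ⟩.coeff (W zero j) (B ℕ.+ i) K.≈ K.0#) →
      ∃ λ U → ∃ λ W' → Low W' × W MatT.≈ᴹ W' MatT.+ᴹ I U
    divide zero    W high = MatT.0ᴹ , W , high , λ i j → T.sym (T.trans (T.+-congˡ {W i j} (I-0 i j)) (T.+-identityʳ (W i j)))
    divide (suc B) W high with divide B (W MatT.-ᴹ I U₀) lower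
      where
      w : MatK.Mat 1 d
      w _ j = K⟨τ⟩.coeff (W zero j) (B ℕ.+ n)
      u : MatK.Mat 1 d
      u = w MatK.*ᴹ twist B A⁻¹
      U₀ : MatT.Mat 1 d
      U₀ i h = mono B (u i h)
      UΦ : ∀ j i → K⟨τ⟩.coeff ((U₀ MatT.*ᴹ Φ.at-t) zero j) (B ℕ.+ i) K.≈ (u MatK.*ᴹ twist B (A_ i)) zero j
      UΦ j i = K.trans (coeff-sum (B ℕ.+ i) (λ h → U₀ zero h T.* Φ.at-t h j))
        (ΣK.sum-cong-≋ λ h → coeff-mono-* B (u zero h) (Φ.at-t h j) i)
      u-top : u MatK.*ᴹ twist B (A_ n) MatK.≈ᴹ w
      u-top = MK.≈ᴹ.trans (MatK.*ᴹ-assoc w (twist B A⁻¹) (twist B (A_ n)))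
        (MK.≈ᴹ.trans (MK.*ᴹ-congˡ w (twist-inverse B (proj₂ A-inverse))) (MK.*ᴹ-identityʳ w))
      u-high : ∀ i → n < i → u MatK.*ᴹ twist B (A_ i) MatK.≈ᴹ MatK.0ᴹ
      u-high i n<i = MK.≈ᴹ.trans (MK.*ᴹ-congˡ u λ h j → K.trans (iterate-cong B (A-high i n<i h j)) (iterate-0 B)) (MatK.*ᴹ-zeroʳ u)
      ψU : ∀ j i → n ≤ i → K⟨τ⟩.coeff ((ψ.at-t MatT.*ᴹ U₀) zero j) (B ℕ.+ i) K.≈ K.0#
      ψU j i n≤i = K.trans (K⟨τ⟩.at (ψ-* U₀ j) (B ℕ.+ i)) (K.trans (coeff-*-mono B (u zero j) ψ₀ i)
        (K.trans (K.*-congʳ (b-high i n≤i)) (K.zeroˡ _)))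
      W≈UΦ : ∀ j i → n ≤ i → K⟨τ⟩.coeff (W zero j) (B ℕ.+ i) K.≈ (u MatK.*ᴹ twist B (A_ i)) zero j
      W≈UΦ j i n≤i with ℕ.m≤n⇒m<n∨m≡n n≤i
      W≈UΦ j i n≤i | inj₂ ≡.refl = K.sym (u-top zero j)
      W≈UΦ j (suc i) n≤i | inj₁ n<i = K.trans (K.reflexive (≡.cong (K⟨τ⟩.coeff (W zero j)) (ℕ.+-suc B i)))
        (K.trans (high j i (ℕ.s≤s⁻¹ n<i)) (K.sym (u-high (suc i) n<i zero j)))
      lower : ∀ j i → n ≤ i → K⟨τ⟩.coeff ((W MatT.-ᴹ I U₀) zero j) (B ℕ.+ i) K.≈ K.0#
      lower j i n≤i = begin
        K⟨τ⟩.coeff ((W MatT.-ᴹ I U₀) zero j) (B ℕ.+ i)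
          ≈⟨ K⟨τ⟩.coeff-+ (W zero j) (T.- I U₀ zero j) (B ℕ.+ i) ⟩
        K⟨τ⟩.coeff (W zero j) (B ℕ.+ i) K.+ K⟨τ⟩.coeff (T.- I U₀ zero j) (B ℕ.+ i)
          ≈⟨ K.+-cong (K.trans (W≈UΦ j i n≤i) (K.sym (UΦ j i))) (K.trans (K⟨τ⟩.coeff-neg (I U₀ zero j) (B ℕ.+ i)) (K.-‿cong IU₀)) ⟩
        x K.- x
          ≈⟨ K.-‿inverseʳ x ⟩
        K.0# ∎
        where
        open SetoidReasoning K.setoid
        x = K⟨τ⟩.coeff ((U₀ MatT.*ᴹ Φ.at-t) zero j) (B ℕ.+ i)
        IU₀ : K⟨τ⟩.coeff (I U₀ zero j) (B ℕ.+ i) K.≈ x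
        IU₀ = K.trans (K⟨τ⟩.coeff-+ ((U₀ MatT.*ᴹ Φ.at-t) zero j) (T.- (ψ.at-t MatT.*ᴹ U₀) zero j) (B ℕ.+ i))
          (K.trans (K.+-congˡ (K.trans (K⟨τ⟩.coeff-neg ((ψ.at-t MatT.*ᴹ U₀) zero j) (B ℕ.+ i))
            (K.trans (K.-‿cong (ψU j i n≤i)) (RingProperties.-0#≈0# K.ring)))) (K.+-identityʳ x))
    ... | U₁ , W' , low , eq = U₁ MatT.+ᴹ U₀ , W' , low , λ i j → begin
      W i j                                         ≈⟨ restore (W i j) (I U₀ i j) ⟨
      (W i j T.+ T.- I U₀ i j) T.+ I U₀ i j         ≈⟨ T.+-congʳ (eq i j) ⟩
      W' i j T.+ I U₁ i j T.+ I U₀ i j              ≈⟨ T.+-assoc (W' i j) (I U₁ i j) (I U₀ i j) ⟩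
      W' i j T.+ (I U₁ i j T.+ I U₀ i j)            ≈⟨ T.+-congˡ {W' i j} (I-+ U₁ U₀ i j) ⟨
      W' i j T.+ I (U₁ MatT.+ᴹ U₀) i j              ∎
      where
      open SetoidReasoning T.setoid
      U₀ : MatT.Mat 1 d
      U₀ i h = mono B (((λ _ j → K⟨τ⟩.coeff (W zero j) (B ℕ.+ n)) MatK.*ᴹ twist B A⁻¹) i h)
      restore : ∀ x y → (x T.+ T.- y) T.+ y T.≈ x
      restore x y = T.trans (T.+-assoc x (T.- y) y) (T.trans (T.+-congˡ {x} (T.-‿inverseˡ y)) (T.+-identityʳ x))

    -- Division yields some low row W' with W - W' inner. Since ρ kills the inner part and reads off
    -- W', that row can only be `lift (ρ W)`.
    decompose : ∀ W → ∃ λ U → W MatT.≈ᴹ lift (ρ W) MatT.+ᴹ I U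
    decompose W with bounded (W zero)
    ... | B , high with divide B W (λ j i _ → high j (B ℕ.+ i) (ℕ.m≤m+n B i))
    ...   | U , W' , low , eq = U , ≈ᴹ.trans eq (+ᴹ-cong W'≈lift (≈ᴹ.refl {x = I U}))
      where
      rem : Vector K.Carrier (n ℕ.* d)
      rem r = K⟨τ⟩.coeff (W' zero (proj₂ (remQuot {n} d r))) (toℕ (proj₁ (remQuot {n} d r)))
      W'≈c : ∀ j (i : Fin n) → K⟨τ⟩.coeff (W' zero j) (toℕ i) K.≈ rem (combine i j)
      W'≈c j i = K.reflexive (≡.sym (≡.cong (λ ij → K⟨τ⟩.coeff (W' zero (proj₂ ij)) (toℕ (proj₁ ij))) (Fin.remQuot-combine i j)))
      ρW≈c : ρ W ≈ᵛ rem
      ρW≈c r = K.trans (ρ-cong {W} {W' MatT.+ᴹ I U} eq r) (K.trans (ρ-+ W' (I U) r)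
        (K.trans (K.+-cong (ρ-low W' rem low W'≈c r) (ρ-I U r)) (K.+-identityʳ _)))
      W'≈lift : W' MatT.≈ᴹ lift (ρ W)
      W'≈lift zero j = K⟨τ⟩.mk compare
        where
        compare : ∀ i → K⟨τ⟩.coeff (W' zero j) i K.≈ K⟨τ⟩.coeff (lift (ρ W) zero j) i
        compare i with i ℕ.<? n
        ... | yes i<n = ≡.subst (λ i → K⟨τ⟩.coeff (W' zero j) i K.≈ K⟨τ⟩.coeff (lift (ρ W) zero j) i) (Fin.toℕ-fromℕ< i<n)
          (K.trans (W'≈c j (Fin.fromℕ< i<n)) (K.sym (K.trans (lift-coeff (ρ W) j (Fin.fromℕ< i<n)) (ρW≈c (combine (Fin.fromℕ< i<n) j)))))
        ... | no i≮n = K.trans (low j i (ℕ.≮⇒≥ i≮n)) (K.sym (lift-low (ρ W) j i (ℕ.≮⇒≥ i≮n)))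

    pair-ψ-tabulate : ∀ p k {m} (f : Vector K.Carrier m) →
      pair p k (ψ₀ T.* tabulate f) K.≈ ΣK.sum (λ i → pair p (k ℕ.+ toℕ i) (ψ₀ T.* K⟨τ⟩.const (f i)))
    pair-ψ-tabulate p k {zero}  f = pair-cong p k (ψ₀ T.* []) [] (T.zeroʳ ψ₀)
    pair-ψ-tabulate p k {suc m} f = K.trans (pair-ψ-∷ p k (f zero) (tabulate (f ∘ suc))) (K.+-cong
      (K.reflexive (≡.cong (λ l → pair p l (ψ₀ T.* K⟨τ⟩.const (f zero))) (≡.sym (ℕ.+-identityʳ k))))
      (K.trans (pair-ψ-tabulate p (suc k) (f ∘ suc)) (ΣK.sum-cong-≋ {m} λ i →
        K.reflexive (≡.cong (λ l → pair p l (ψ₀ T.* K⟨τ⟩.const (f (suc i)))) (≡.sym (ℕ.+-suc k (toℕ i)))))))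

    -- ψ_t sends c τⁱ in place j to the terms b_l c^(q^l) τ^(i+l), and `Ρ (i + l)` reduces each of
    -- them.
    Π-entry : Fin (n ℕ.* d) → Fin n × Fin d → T.Carrier
    Π-entry r (i , j) = ΣT.sum {n} (λ l → Ρ (toℕ i ℕ.+ toℕ l) r j T.* mono (toℕ l) (b (toℕ l)))

    Π : MatT.Mat (n ℕ.* d) (n ℕ.* d)
    Π r r' = Π-entry r (remQuot {n} d r')

    Π-combine : ∀ r i j → Π r (combine i j) ≡ Π-entry r (i , j)
    Π-combine r i j = ≡.cong (Π-entry r) (Fin.remQuot-combine i j)

    ρ-ψ-lift : ∀ c → ρ (ψ.at-t MatT.*ᴹ lift c) ≈ᵛ evalᴹ Π c
    ρ-ψ-lift c r = begin
      ΣK.sum (λ j → pair Ρ[ r , j ] 0 ((ψ.at-t MatT.*ᴹ lift c) zero j))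
        ≈⟨ ΣK.sum-cong-≋ (λ j → K.trans
             (pair-cong Ρ[ r , j ] 0 ((ψ.at-t MatT.*ᴹ lift c) zero j) (ψ₀ T.* lift c zero j) (ψ-* (lift c) j))
             (K.trans (pair-ψ-tabulate Ρ[ r , j ] 0 {n} (λ i → c (combine i j)))
               (ΣK.sum-cong-≋ {n} λ i → entry i j))) ⟩
      ΣK.sum (λ j → ΣK.sum {n} (λ i → eval (Π r (combine i j)) (c (combine i j))))
        ≈⟨ ΣK.∑-comm (λ j (i : Fin n) → eval (Π r (combine i j)) (c (combine i j))) ⟩
      ΣK.sum {n} (λ i → ΣK.sum (λ j → eval (Π r (combine i j)) (c (combine i j))))
        ≈⟨ ΣK.sum-combine n {d} (λ r' → eval (Π r r') (c r')) ⟨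
      evalᴹ Π c r ∎
      where
      open SetoidReasoning K.setoid
      entry : ∀ i j → pair Ρ[ r , j ] (toℕ i) (ψ₀ T.* K⟨τ⟩.const (c (combine i j))) K.≈ eval (Π r (combine i j)) (c (combine i j))
      entry i j = K.trans (pair-ψ-const Ρ[ r , j ] (toℕ i) (c (combine i j))) (K.trans
        (ΣK.sum-cong-≋ {n} λ l → K.sym (K.trans
          (E.eval-* (Ρ (toℕ i ℕ.+ toℕ l) r j) (mono (toℕ l) (b (toℕ l))) (c (combine i j)))
          (E.eval-cong (Ρ (toℕ i ℕ.+ toℕ l) r j) (eval-mono (toℕ l) (b (toℕ l)) (c (combine i j))))))
        (K.trans (K.sym (E.eval-sumˡ {n} (λ l → Ρ (toℕ i ℕ.+ toℕ l) r j T.* mono (toℕ l) (b (toℕ l))) (c (combine i j))))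
          (K.reflexive (≡.cong (λ f → eval f (c (combine i j))) (≡.sym (Π-combine r i j))))))

    -- Multiplication by ψ_t preserves inner values, so W may be replaced by its remainder before
    -- multiplying.
    ρ-ψ : ∀ W → ρ (ψ.at-t MatT.*ᴹ W) ≈ᵛ evalᴹ Π (ρ W)
    ρ-ψ W r with decompose W
    ... | U , eq = begin
      ρ (ψ.at-t MatT.*ᴹ W) r
        ≈⟨ ρ-cong {ψ.at-t MatT.*ᴹ W} {ψ.at-t MatT.*ᴹ lift (ρ W) MatT.+ᴹ I (ψ.at-t MatT.*ᴹ U)}
             (≈ᴹ.trans (*ᴹ-congˡ ψ.at-t eq) (≈ᴹ.trans (MatT.*ᴹ-distribˡ ψ.at-t (lift (ρ W)) (I U))
               (+ᴹ-cong (≈ᴹ.refl {x = ψ.at-t MatT.*ᴹ lift (ρ W)}) (ψ-I U)))) r ⟩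
      ρ (ψ.at-t MatT.*ᴹ lift (ρ W) MatT.+ᴹ I (ψ.at-t MatT.*ᴹ U)) r
        ≈⟨ ρ-+ (ψ.at-t MatT.*ᴹ lift (ρ W)) (I (ψ.at-t MatT.*ᴹ U)) r ⟩
      ρ (ψ.at-t MatT.*ᴹ lift (ρ W)) r K.+ ρ (I (ψ.at-t MatT.*ᴹ U)) r
        ≈⟨ K.+-cong (ρ-ψ-lift (ρ W) r) (ρ-I (ψ.at-t MatT.*ᴹ U) r) ⟩
      evalᴹ Π (ρ W) r K.+ K.0#
        ≈⟨ K.+-identityʳ _ ⟩
      evalᴹ Π (ρ W) r ∎
      where open SetoidReasoning K.setoid

    private
      *-zero : ∀ x y → x K.* y K.≈ K.0# → x K.≉ K.0# → y K.≈ K.0#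
      *-zero x y xy≈0 x≉0 = let x⁻¹ , e = K.inverse x x≉0 in K.trans (K.sym (K.*-identityˡ y))
        (K.trans (K.*-congʳ (K.trans (K.sym e) (K.*-comm x x⁻¹))) (K.trans (K.*-assoc x⁻¹ x y) (K.trans (K.*-congˡ xy≈0) (K.zeroʳ x⁻¹))))

      ^ᴹ-zero : ∀ (M : MatK.Mat 1 1) k → M MatK.^ᴹ k MatK.≈ᴹ MatK.0ᴹ → M zero zero K.≈ K.0#
      ^ᴹ-zero M zero    p = contradiction (K.sym (p zero zero)) K.0≉1
      ^ᴹ-zero M (suc k) p with M zero zero K.≟ K.0#
      ... | yes z = z
      ... | no ¬z = ^ᴹ-zero M k λ { zero zero →
        *-zero (M zero zero) ((M MatK.^ᴹ k) zero zero) (K.trans (K.sym (K.+-identityʳ _)) (p zero zero)) ¬z }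

    -- In dimension one the nilpotent part is a nilpotent element of a field, hence zero.
    b₀≈θ : b 0 K.≈ θ
    b₀≈θ = K.trans (K.sym (K.+-identityʳ _)) (K.trans (K.+-congˡ (K.sym (K.-‿inverseˡ θ)))
      (K.trans (K.sym (K.+-assoc (b 0) (K.- θ) θ))
        (K.trans (K.+-congʳ (^ᴹ-zero ψ.N (proj₁ ψ.nilpotent) (proj₂ ψ.nilpotent))) (K.+-identityˡ θ))))

    -- Only l = 0 contributes a constant coefficient, and `Ρ i` with i < n lies in the initial
    -- window, whose entries are those of the identity matrix.
    Π-constant : coeffᴹ Π 0 MatK.≈ᴹ MatK.scalar θ
    Π-constant r r' = ≡.subst (λ r' → K⟨τ⟩.coeff (Π r r') 0 K.≈ MatK.scalar θ r r') (Fin.combine-remQuot {n} d r')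
      (at-combine (proj₁ (remQuot {n} d r')) (proj₂ (remQuot {n} d r')))
      where
      open SetoidReasoning K.setoid
      coeff-if : ∀ c → K⟨τ⟩.coeff (if c then T.1# else []) 0 K.* θ K.≈ (if c then θ else K.0#)
      coeff-if true  = K.*-identityˡ θ
      coeff-if false = K.zeroˡ θ
      at-combine : ∀ i j → K⟨τ⟩.coeff (Π r (combine i j)) 0 K.≈ MatK.scalar θ r (combine i j)
      at-combine i j = begin
        K⟨τ⟩.coeff (Π r (combine i j)) 0
          ≡⟨ ≡.cong (λ f → K⟨τ⟩.coeff f 0) (Π-combine r i j) ⟩
        K⟨τ⟩.coeff (Π-entry r (i , j)) 0
          ≈⟨ K.trans (coeff-sum 0 {n} (λ l → P l T.* mono (toℕ l) (b (toℕ l)))) (ΣK.sum-cong-≋ {n} λ l → K⟨τ⟩.coeff₀-* (P l) (mono (toℕ l) (b (toℕ l)))) ⟩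
        ΣK.sum {n} (λ l → K⟨τ⟩.coeff (P l) 0 K.* K⟨τ⟩.coeff (mono (toℕ l) (b (toℕ l))) 0)
          ≈⟨ K.+-congˡ (ΣK.sum-0 {n'} (λ l → K⟨τ⟩.coeff (P (suc l)) 0 K.* K.0#) λ l → K.zeroʳ _) ⟩
        K⟨τ⟩.coeff (P zero) 0 K.* b 0 K.+ K.0#
          ≈⟨ K.trans (K.+-identityʳ _) (K.*-congˡ b₀≈θ) ⟩
        K⟨τ⟩.coeff (P zero) 0 K.* θ
          ≡⟨ ≡.cong (λ M → K⟨τ⟩.coeff (M r j) 0 K.* θ) (≡.trans (≡.cong Ρ (ℕ.+-identityʳ (toℕ i))) (≡.sym (window≡Ρ (toℕ i) i ≡.refl 0))) ⟩
        K⟨τ⟩.coeff (MatT.1ᴹ r (combine i j)) 0 K.* θ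
          ≈⟨ coeff-if (does (r Fin.≟ combine i j)) ⟩
        MatK.scalar θ r (combine i j) ∎
        where
        P : Fin n → T.Carrier
        P l = Ρ (toℕ i ℕ.+ toℕ l) r j

    -- A functional Λ killing the rows of N kills every correction made by the reduction to the
    -- constant term, so (Λ | 0) intertwines Π with θ.
    module _ {s} (Λ : MatK.Mat s d) (Λ*N≈0 : Λ MatK.*ᴹ (Φ.N ᵀ) MatK.≈ᴹ MatK.0ᴹ) where
      Λ∣0 : MatT.Mat s (n ℕ.* d)
      Λ∣0 = constᴹ (MK.padRight (n' ℕ.* d) Λ)

      private
        const0 : K⟨τ⟩.const K.0# T.≈ []
        const0 = Skew.0∷[]≈[]

        Λ-entry₀ : ∀ z j → Λ∣0 z (combine {n} zero j) T.≈ K⟨τ⟩.const (Λ z j)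
        Λ-entry₀ z j = T.reflexive (≡.cong K⟨τ⟩.const (MK.padRightˡ (n' ℕ.* d) Λ z j))

        Λ-entry₊ : ∀ z i j → Λ∣0 z (combine {n} (suc i) j) T.≈ []
        Λ-entry₊ z i j = T.trans (T.reflexive (≡.cong K⟨τ⟩.const (MK.padRightʳ (n' ℕ.* d) Λ z (combine i j)))) const0

        Λ-window₀ : Λ∣0 MatT.*ᴹ window 0 zero MatT.≈ᴹ constᴹ Λ
        Λ-window₀ z j = T.trans (*ᴹ-identityʳ Λ∣0 z (combine {n} zero j)) (Λ-entry₀ z j)

        Λ-window₀₊ : ∀ i → Λ∣0 MatT.*ᴹ window 0 (suc i) MatT.≈ᴹ MatT.0ᴹ
        Λ-window₀₊ i z j = T.trans (*ᴹ-identityʳ Λ∣0 z (combine {n} (suc i) j)) (Λ-entry₊ z i j)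

        *ᴹ-Σᴹ : ∀ {m k l o} (M : MatT.Mat k l) (N : Fin m → MatT.Mat l o) → M MatT.*ᴹ Σᴹ N MatT.≈ᴹ Σᴹ (λ i → M MatT.*ᴹ N i)
        *ᴹ-Σᴹ M N z j = T.trans
          (ΣT.sum-cong-≋ λ h → Sum.*-distribˡ-sum T.semiring (M z h) (λ i → N i h j))
          (ΣT.∑-comm (λ h i → M z h T.* N i h j))

        Λ-next : ∀ k w → (∀ i → Λ∣0 MatT.*ᴹ w i MatT.*ᴹ X k (toℕ i) MatT.≈ᴹ MatT.0ᴹ) → Λ∣0 MatT.*ᴹ next k w MatT.≈ᴹ MatT.0ᴹ
        Λ-next k w p = ≈ᴹ.trans (≈ᴹ.sym (MatT.*ᴹ-assoc Λ∣0 (Σᴹ (λ i → w i MatT.*ᴹ X k (toℕ i))) (A⁻ᵗ k)))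
          (≈ᴹ.trans (*ᴹ-congʳ (A⁻ᵗ k) {M' = MatT.0ᴹ} (≈ᴹ.trans (*ᴹ-Σᴹ Λ∣0 (λ i → w i MatT.*ᴹ X k (toℕ i)))
            λ z j → ΣT.sum-0 {n} (λ i → (Λ∣0 MatT.*ᴹ (w i MatT.*ᴹ X k (toℕ i))) z j) λ i →
              ≈ᴹ.trans (≈ᴹ.sym (MatT.*ᴹ-assoc Λ∣0 (w i) (X k (toℕ i)))) (p i) z j))
            (MatT.*ᴹ-zeroˡ (A⁻ᵗ k)))

        Λ*A₀ᵀ : Λ MatK.*ᴹ (A_ 0 ᵀ) MatK.≈ᴹ Λ MatK.*ᴹ MatK.scalar (b 0)
        Λ*A₀ᵀ = MK.≈ᴹ.trans (MK.*ᴹ-congˡ Λ A₀ᵀ≈) (MK.≈ᴹ.trans (MatK.*ᴹ-distribˡ Λ (Φ.N ᵀ) (MatK.scalar (b 0)))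
          (λ z j → K.trans (K.+-congʳ (Λ*N≈0 z j)) (K.+-identityˡ _)))
          where
          scalar-b₀ : ∀ i j → MatK.scalar (b 0) i j K.≈ MatK.scalar θ i j
          scalar-b₀ = RingHomomorphism.⟦⟧-cong (MatK.scalarHom d) b₀≈θ
          A₀ᵀ≈ : A_ 0 ᵀ MatK.≈ᴹ Φ.N ᵀ MatK.+ᴹ MatK.scalar (b 0)
          A₀ᵀ≈ i j = K.sym (K.trans (K.+-congˡ (K.trans (MK.scalar-comm (b 0) i j) (scalar-b₀ j i))) (K.trans (K.+-assoc (A_ 0 j i) (K.- MatK.scalar θ j i) (MatK.scalar θ j i))
            (K.trans (K.+-congˡ (K.-‿inverseˡ _)) (K.+-identityʳ _))))

        -- The one correction reaching the constant coefficient comes from u of degree 0: it is θ u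
        -- - u A₀ = -u N, which Λ kills.
        Λ*X₀ : constᴹ Λ MatT.*ᴹ X 0 0 MatT.≈ᴹ MatT.0ᴹ
        Λ*X₀ = ≈ᴹ.trans (MatT.*ᴹ-distribˡ (constᴹ Λ) (MatT.scalar (mono 0 (b 0))) (MatT.-ᴹ Aᵗ 0 0)) λ z j →
          T.trans (T.+-cong
              (≈ᴹ.trans (*ᴹ-congˡ (constᴹ Λ) (≈ᴹ.sym (constᴹ-scalar (b 0)))) (≈ᴹ.sym (constᴹ-* Λ (MatK.scalar (b 0)))) z j)
              (T.trans (MatT.*ᴹ-negʳ (constᴹ Λ) (Aᵗ 0 0) z j) (T.-‿cong
                (≈ᴹ.trans (≈ᴹ.sym (constᴹ-* Λ (A_ 0 ᵀ))) (constᴹ-cong Λ*A₀ᵀ) z j))))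
            (T.-‿inverseʳ (constᴹ (Λ MatK.*ᴹ MatK.scalar (b 0)) z j))

        zero-X : ∀ {M : MatT.Mat s d} k i → M MatT.≈ᴹ MatT.0ᴹ → M MatT.*ᴹ X k i MatT.≈ᴹ MatT.0ᴹ
        zero-X k i p = ≈ᴹ.trans (*ᴹ-congʳ (X k i) {M' = MatT.0ᴹ} p) (MatT.*ᴹ-zeroˡ (X k i))

        -- Λ is nonzero on `Ρ 0` alone among the initial entries, and `Ρ 0` enters only the first
        -- step, multiplied by `X 0 0`. From then on every window consists of entries killed by Λ.
        Λ-window₊ : ∀ k i → Λ∣0 MatT.*ᴹ window (suc k) i MatT.≈ᴹ MatT.0ᴹ
        Λ-window₊ zero    = advance-all (λ M → Λ∣0 MatT.*ᴹ M MatT.≈ᴹ MatT.0ᴹ) (window 0) (next 0 (window 0)) Λ-window₀₊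
          (Λ-next 0 (window 0) λ
            { zero    → ≈ᴹ.trans (*ᴹ-congʳ (X 0 0) Λ-window₀) Λ*X₀
            ; (suc i) → zero-X 0 (suc (toℕ i)) (Λ-window₀₊ i) })
        Λ-window₊ (suc k) = advance-all (λ M → Λ∣0 MatT.*ᴹ M MatT.≈ᴹ MatT.0ᴹ) (window (suc k)) (next (suc k) (window (suc k)))
          (λ i → Λ-window₊ k (suc i)) (Λ-next (suc k) (window (suc k)) λ i → zero-X (suc k) (toℕ i) (Λ-window₊ k i))

      Λ-Π : Λ∣0 MatT.*ᴹ Π MatT.≈ᴹ K⟨τ⟩.const θ MatT.·ᴹ Λ∣0
      Λ-Π z r' = ≡.subst (λ r' → (Λ∣0 MatT.*ᴹ Π) z r' T.≈ K⟨τ⟩.const θ T.* Λ∣0 z r') (Fin.combine-remQuot {n} d r')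
        (at-combine (proj₁ (remQuot {n} d r')) (proj₂ (remQuot {n} d r')))
        where
        open SetoidReasoning T.setoid
        P : Fin n → Fin n → MatT.Mat s d
        P i l = Λ∣0 MatT.*ᴹ Ρ (toℕ i ℕ.+ toℕ l)
        m : Fin n → T.Carrier
        m l = mono (toℕ l) (b (toℕ l))
        expand : ∀ i j → (Λ∣0 MatT.*ᴹ Π) z (combine i j) T.≈ ΣT.sum {n} (λ l → P i l z j T.* m l)
        expand i j = begin
          ΣT.sum (λ r → Λ∣0 z r T.* Π r (combine i j))
            ≈⟨ ΣT.sum-cong-≋ (λ r → T.trans
                 (T.*-congˡ {Λ∣0 z r} (T.reflexive (Π-combine r i j)))
                 (T.trans (Sum.*-distribˡ-sum T.semiring {n} (Λ∣0 z r) (λ l → Ρ (toℕ i ℕ.+ toℕ l) r j T.* m l))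
                   (ΣT.sum-cong-≋ {n} λ l → T.sym (T.*-assoc (Λ∣0 z r) (Ρ (toℕ i ℕ.+ toℕ l) r j) (m l))))) ⟩
          ΣT.sum (λ r → ΣT.sum {n} (λ l → Λ∣0 z r T.* Ρ (toℕ i ℕ.+ toℕ l) r j T.* m l))
            ≈⟨ ΣT.∑-comm (λ r (l : Fin n) → Λ∣0 z r T.* Ρ (toℕ i ℕ.+ toℕ l) r j T.* m l) ⟩
          ΣT.sum {n} (λ l → ΣT.sum (λ r → Λ∣0 z r T.* Ρ (toℕ i ℕ.+ toℕ l) r j T.* m l))
            ≈⟨ ΣT.sum-cong-≋ {n} (λ l → Sum.*-distribʳ-sum T.semiring (m l) (λ r → Λ∣0 z r T.* Ρ (toℕ i ℕ.+ toℕ l) r j)) ⟨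
          ΣT.sum {n} (λ l → P i l z j T.* m l) ∎
        vanish : ∀ {x} y → x T.≈ [] → x T.* y T.≈ []
        vanish y p = T.trans (T.*-congʳ {y} p) T.refl
        at-combine : ∀ i j → (Λ∣0 MatT.*ᴹ Π) z (combine i j) T.≈ K⟨τ⟩.const θ T.* Λ∣0 z (combine i j)
        at-combine zero j = begin
          (Λ∣0 MatT.*ᴹ Π) z (combine {n} zero j)
            ≈⟨ expand zero j ⟩
          ΣT.sum {n} (λ l → P zero l z j T.* m l)
            ≈⟨ T.+-congˡ {P zero zero z j T.* m zero} (ΣT.sum-0 {n'} (λ l → P zero (suc l) z j T.* m (suc l)) λ l →
                 vanish (m (suc l)) (Λ-window₊ (toℕ l) zero z j)) ⟩
          P zero zero z j T.* m zero T.+ []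
            ≈⟨ T.+-identityʳ (P zero zero z j T.* m zero) ⟩
          P zero zero z j T.* m zero
            ≈⟨ T.*-cong {P zero zero z j} {K⟨τ⟩.const (Λ z j)} {m zero} {K⟨τ⟩.const θ} (Λ-window₀ z j) (Skew.∷-cong b₀≈θ T.refl) ⟩
          K⟨τ⟩.const (Λ z j) T.* K⟨τ⟩.const θ
            ≈⟨ Skew.∷-cong (K.+-congʳ (K.*-comm (Λ z j) θ)) T.refl ⟩
          K⟨τ⟩.const θ T.* K⟨τ⟩.const (Λ z j)
            ≈⟨ T.*-congˡ {K⟨τ⟩.const θ} (Λ-entry₀ z j) ⟨
          K⟨τ⟩.const θ T.* Λ∣0 z (combine {n} zero j) ∎
        at-combine (suc i) j = T.trans (expand (suc i) j) (T.trans
          (ΣT.sum-0 {n} (λ l → P (suc i) l z j T.* m l) λ l → vanish (m l) (Λ-window₊ (toℕ i ℕ.+ toℕ l) zero z j))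
          (T.sym (T.trans (T.*-congˡ {K⟨τ⟩.const θ} (Λ-entry₊ z i j)) (T.zeroʳ (K⟨τ⟩.const θ)))))

      -- All `Ρ k` with k > 0 are killed, so the quotient map sees nothing of a row but its constant
      -- coefficient, even before reduction.
      Λ-ρ : ∀ W z → evalᴹ Λ∣0 (ρ W) z K.≈ ΣK.sum (λ j → Λ z j K.* K⟨τ⟩.coeff (W zero j) 0)
      Λ-ρ W z = begin
        ΣK.sum (λ r → eval (Λ∣0 z r) (ΣK.sum (λ j → pair Ρ[ r , j ] 0 (W zero j))))
          ≈⟨ ΣK.sum-cong-≋ (λ r → E.eval-sum (Λ∣0 z r) (λ j → pair Ρ[ r , j ] 0 (W zero j))) ⟩
        ΣK.sum (λ r → ΣK.sum (λ j → eval (Λ∣0 z r) (pair Ρ[ r , j ] 0 (W zero j))))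
          ≈⟨ ΣK.∑-comm (λ r j → eval (Λ∣0 z r) (pair Ρ[ r , j ] 0 (W zero j))) ⟩
        ΣK.sum (λ j → ΣK.sum (λ r → eval (Λ∣0 z r) (pair Ρ[ r , j ] 0 (W zero j))))
          ≈⟨ ΣK.sum-cong-≋ (λ j → K.trans (sum-eval-pair (Λ∣0 z) (λ r → Ρ[ r , j ]) 0 (W zero j)) (constant j (W zero j))) ⟩
        ΣK.sum (λ j → Λ z j K.* K⟨τ⟩.coeff (W zero j) 0) ∎
        where
        open SetoidReasoning K.setoid
        P : Fin d → ℕ → T.Carrier
        P j k = (Λ∣0 MatT.*ᴹ Ρ k) z j
        constant : ∀ j f → pair (P j) 0 f K.≈ Λ z j K.* K⟨τ⟩.coeff f 0
        constant j []      = K.sym (K.zeroʳ _)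
        constant j (a ∷ f) = K.trans (K.+-cong
            (K.trans (E.eval-congˡ (P j 0) (K⟨τ⟩.const (Λ z j)) a (Λ-window₀ z j)) (E.eval-const (Λ z j) a))
            (K.trans (pair-suc (P j) 0 f) (pair-vanishing (P j ∘ suc) (λ k → Λ-window₊ k zero z j) 0 f)))
          (K.+-identityʳ _)

-- Degrees in τ against vanishing of coefficients.

module Degrees (S : Setting c₁ ℓ₁ c₂ ℓ₂) where
  open TModules S

  private
    all-zero : ∀ f → (∀ i → K⟨τ⟩.coeff f i K.≈ K.0#) → All (K._≈ K.0#) f
    all-zero []      p = All.[]
    all-zero (a ∷ f) p = p 0 All.∷ all-zero f (p ∘ suc)

    zero-coeff : ∀ {f} → All (K._≈ K.0#) f → ∀ i → K⟨τ⟩.coeff f i K.≈ K.0#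
    zero-coeff All.[]       i       = K.refl
    zero-coeff (p All.∷ ps) zero    = p
    zero-coeff (p All.∷ ps) (suc i) = zero-coeff ps i

  deg-≤ : ∀ f n → (∀ i → n < i → K⟨τ⟩.coeff f i K.≈ K.0#) → deg f ≤ n
  deg-≤ []      n high = ℕ.z≤n
  deg-≤ (a ∷ f) n high with all? (K._≟ K.0#) f
  ... | yes _ = ℕ.z≤n
  deg-≤ (a ∷ f) zero    high | no ¬z = contradiction (all-zero f λ i → high (suc i) (ℕ.s≤s ℕ.z≤n)) ¬z
  deg-≤ (a ∷ f) (suc n) high | no ¬z = ℕ.s≤s (deg-≤ f n λ i n<i → high (suc i) (ℕ.s≤s n<i))

  deg-< : ∀ f i → deg f < i → K⟨τ⟩.coeff f i K.≈ K.0#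
  deg-< []      i       p = K.refl
  deg-< (a ∷ f) (suc i) p with all? (K._≟ K.0#) f
  ... | yes z = zero-coeff z i
  ... | no _  = deg-< f i (ℕ.s≤s⁻¹ p)

  private
    ⊔-upper : ∀ {n} (f : Vector ℕ n) i → f i ≤ Vector.foldr ℕ._⊔_ 0 f
    ⊔-upper f zero    = ℕ.m≤m⊔n _ _
    ⊔-upper f (suc i) = ℕ.≤-trans (⊔-upper (f ∘ suc) i) (ℕ.m≤n⊔m (f zero) _)

    ⊔-least : ∀ {n} (f : Vector ℕ n) {m} → (∀ i → f i ≤ m) → Vector.foldr ℕ._⊔_ 0 f ≤ m
    ⊔-least {zero}  f p = ℕ.z≤n
    ⊔-least {suc n} f p = ℕ.⊔-lub (p zero) (⊔-least (f ∘ suc) (p ∘ suc))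

  degᴹ-≤ : ∀ {k l} (M : MatT.Mat k l) n → (∀ i → n < i → coeffᴹ M i MatK.≈ᴹ MatK.0ᴹ) → degᴹ M ≤ n
  degᴹ-≤ M n high = ⊔-least _ λ i → ⊔-least (λ j → deg (M i j)) λ j → deg-≤ (M i j) n λ l n<l → high l n<l i j

  degᴹ-< : ∀ {k l} (M : MatT.Mat k l) n → degᴹ M < n → coeffᴹ M n MatK.≈ᴹ MatK.0ᴹ
  degᴹ-< M n d<n i j = deg-< (M i j) n (ℕ.≤-<-trans
    (ℕ.≤-trans (⊔-upper (λ j → deg (M i j)) j) (⊔-upper (λ i → Vector.foldr ℕ._⊔_ 0 (λ j → deg (M i j))) i)) d<n)

-- Constant matrices acting on points.

module ConstantMatrices (S : Setting c₁ ℓ₁ c₂ ℓ₂) (R : TModules.KAlgebra S) where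
  open TModules S
  open Constants S
  open Twists S
  open Points R
  open TModules.KAlgebra R hiding (zero)
  private
    module E = Evaluation S R

  module _ {k l m} (X : MatK.Mat k l) (Y : MatK.Mat l m) (x : Vector Carrier m) where
    evalᴹ-const-* : evalᴹ (constᴹ X) (evalᴹ (constᴹ Y) x) ≈ᵛ evalᴹ (constᴹ (X MatK.*ᴹ Y)) x
    evalᴹ-const-* i = sym (trans (E.evalᴹ-congˡ (constᴹ (X MatK.*ᴹ Y)) (constᴹ-* X Y) x i) (E.evalᴹ-* (constᴹ X) (constᴹ Y) x i))

    evalᴹ-const-cancel : X MatK.*ᴹ Y MatK.≈ᴹ MatK.0ᴹ → evalᴹ (constᴹ X) (evalᴹ (constᴹ Y) x) ≈ᵛ (λ _ → 0#)
    evalᴹ-const-cancel p i = trans (evalᴹ-const-* i) (trans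
      (E.evalᴹ-congˡ (constᴹ (X MatK.*ᴹ Y)) {MatT.0ᴹ} (≈ᴹ.trans (constᴹ-cong {N = MatK.0ᴹ} p) λ i j → Skew.0∷[]≈[]) x i)
      (Sums.sum-0 +-commutativeMonoid {m} (λ _ → 0#) λ _ → refl))

  evalᴹ-const-1 : ∀ {k} (X : MatK.Mat k k) → X MatK.≈ᴹ MatK.1ᴹ → ∀ x → evalᴹ (constᴹ X) x ≈ᵛ x
  evalᴹ-const-1 X p x i = trans (E.evalᴹ-congˡ (constᴹ X) (≈ᴹ.trans (constᴹ-cong p) (constᴹ-scalar K.1#)) x i)
    (trans (E.evalᴹ-scalar T.1# x i) (E.eval-1 (x i)))

  evalᴹ-const-inverse : ∀ {k l} (X : MatK.Mat k l) (Y : MatK.Mat l k) → X MatK.*ᴹ Y MatK.≈ᴹ MatK.1ᴹ →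
    ∀ x → evalᴹ (constᴹ X) (evalᴹ (constᴹ Y) x) ≈ᵛ x
  evalᴹ-const-inverse X Y p x i = trans (evalᴹ-const-* X Y x i) (evalᴹ-const-1 (X MatK.*ᴹ Y) p x i)

-- From compatibility with t to compatibility with all of F[t].

module MorphismPowers (S : Setting c₁ ℓ₁ c₂ ℓ₂) where
  open TModules S
  open Constants S
  open MatT

  morphism-at : ∀ {d e} (Ψ : TModule e) (Φ : TModule d) f → IsMorphism Ψ Φ f →
    ∀ a → f *ᴹ TModule.at Ψ a ≈ᴹ TModule.at Φ a *ᴹ f
  morphism-at Ψ Φ f p []      = ≈ᴹ.trans (≈ᴹ.trans (*ᴹ-congˡ f (RingHomomorphism.0#-homo (TModule.hom Ψ))) (*ᴹ-zeroʳ f))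
    (≈ᴹ.sym (≈ᴹ.trans (*ᴹ-congʳ f (RingHomomorphism.0#-homo (TModule.hom Φ))) (*ᴹ-zeroˡ f)))
  morphism-at Ψ Φ f p (a ∷ b) = begin
    f *ᴹ Ψ.at (a ∷ b)
      ≈⟨ ≈ᴹ.trans (*ᴹ-congˡ f (at-∷ Ψ a b)) (*ᴹ-distribˡ f (scalar (ηᵀ a)) (Ψ.at-t *ᴹ Ψ.at b)) ⟩
    f *ᴹ scalar (ηᵀ a) +ᴹ f *ᴹ (Ψ.at-t *ᴹ Ψ.at b)
      ≈⟨ +ᴹ-cong (scalarη-comm a f) (≈ᴹ.trans (≈ᴹ.sym (*ᴹ-assoc f Ψ.at-t (Ψ.at b))) (≈ᴹ.trans (*ᴹ-congʳ (Ψ.at b) p)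
           (≈ᴹ.trans (*ᴹ-assoc Φ.at-t f (Ψ.at b)) (≈ᴹ.trans (*ᴹ-congˡ Φ.at-t (morphism-at Ψ Φ f p b)) (≈ᴹ.sym (*ᴹ-assoc Φ.at-t (Φ.at b) f)))))) ⟩
    scalar (ηᵀ a) *ᴹ f +ᴹ Φ.at-t *ᴹ Φ.at b *ᴹ f
      ≈⟨ ≈ᴹ.trans (*ᴹ-congʳ f (at-∷ Φ a b)) (*ᴹ-distribʳ f (scalar (ηᵀ a)) (Φ.at-t *ᴹ Φ.at b)) ⟨
    Φ.at (a ∷ b) *ᴹ f ∎
    where
    open SetoidReasoning (matSetoid _ _)
    module Ψ = TModule Ψ
    module Φ = TModule Φ

-- The t-modules on Ext¹ and Ext₀ and the exact sequence.

module ExtModules (S : Setting c₁ ℓ₁ c₂ ℓ₂) where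
  open TModules S
  open Constants S
  open Twists S
  open Points selfAlgebra
  open LinearAlgebra K
  open MorphismPowers S
  private
    module E = SelfEvaluation
    module C = ConstantMatrices S selfAlgebra
    module ΣK = Sums K.+-commutativeMonoid
    module MK = MatrixRing K.ring

  module Structures {d} (Φ : TModule d) (ψ : TModule 1) (n' : ℕ) (A⁻¹ : MatK.Mat d d)
    (A-high : ∀ j → suc n' < j → coeffᴹ (TModule.at-t Φ) j MatK.≈ᴹ MatK.0ᴹ)
    (A-inverse : MatK.IsInverse (coeffᴹ (TModule.at-t Φ) (suc n')) A⁻¹)
    (b-high : ∀ i → suc n' ≤ i → K⟨τ⟩.coeff (TModule.at-t ψ zero zero) i K.≈ K.0#) where

    private
      module Φ = TModule Φ
      module ψ = TModule ψ
      n = suc n'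
      m = n' ℕ.* d
      open Reduction.Recurrence S Φ ψ n' A⁻¹ A-high A-inverse b-high
      open Derivations S Φ ψ
      open Der

      value : Der Φ ψ → MatT.Mat 1 d
      value D = δ D F[t].t

    extTModule : TModule (n ℕ.* d)
    extTModule = tModuleOf Π Π-constant

    private
      module Ext-T = TModule extTModule

      ρ-action : ∀ a W → ρ (ψ.at a MatT.*ᴹ W) ≈ᵛ evalᴹ (Ext-T.at a) (ρ W)
      ρ-action []      W r = K.trans
        (ρ-cong {ψ.at [] MatT.*ᴹ W} {MatT.0ᴹ} (≈ᴹ.trans (*ᴹ-congʳ W (RingHomomorphism.0#-homo ψ.hom)) (MatT.*ᴹ-zeroˡ W)) r)
        (K.trans (ρ-0 r) (K.sym (ΣK.sum-0 {n ℕ.* d} (λ _ → K.0#) λ _ → K.refl)))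
      ρ-action (a ∷ f) W r = begin
        ρ (ψ.at (a ∷ f) MatT.*ᴹ W) r
          ≈⟨ ρ-cong {ψ.at (a ∷ f) MatT.*ᴹ W} {ηᵀ a MatT.·ᴹ W MatT.+ᴹ ψ.at-t MatT.*ᴹ (ψ.at f MatT.*ᴹ W)}
               (≈ᴹ.trans (*ᴹ-congʳ W (at-∷ ψ a f)) (≈ᴹ.trans (MatT.*ᴹ-distribʳ W (MatT.scalar (ηᵀ a)) (ψ.at-t MatT.*ᴹ ψ.at f))
                 (+ᴹ-cong (MatT.scalar-*ᴹ (ηᵀ a) W) (MatT.*ᴹ-assoc ψ.at-t (ψ.at f) W)))) r ⟩
        ρ (ηᵀ a MatT.·ᴹ W MatT.+ᴹ ψ.at-t MatT.*ᴹ (ψ.at f MatT.*ᴹ W)) r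
          ≈⟨ ρ-+ (ηᵀ a MatT.·ᴹ W) (ψ.at-t MatT.*ᴹ (ψ.at f MatT.*ᴹ W)) r ⟩
        ρ (ηᵀ a MatT.·ᴹ W) r K.+ ρ (ψ.at-t MatT.*ᴹ (ψ.at f MatT.*ᴹ W)) r
          ≈⟨ K.+-cong (ρ-η· a W r) (K.trans (ρ-ψ (ψ.at f MatT.*ᴹ W) r) (E.evalᴹ-cong Π (ρ-action f W) r)) ⟩
        η.⟦ a ⟧ K.* ρ W r K.+ evalᴹ Π (evalᴹ (Ext-T.at f) (ρ W)) r
          ≈⟨ K.+-cong (K.trans (E.evalᴹ-scalar (ηᵀ a) (ρ W) r) (E.eval-const η.⟦ a ⟧ (ρ W r))) (E.evalᴹ-* Π (Ext-T.at f) (ρ W) r) ⟨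
        evalᴹ (MatT.scalar (ηᵀ a)) (ρ W) r K.+ evalᴹ (Π MatT.*ᴹ Ext-T.at f) (ρ W) r
          ≈⟨ E.evalᴹ-+ˡ (MatT.scalar (ηᵀ a)) (Π MatT.*ᴹ Ext-T.at f) (ρ W) r ⟨
        evalᴹ (Ext-T.at (a ∷ f)) (ρ W) r ∎
        where open SetoidReasoning K.setoid

      x-y≈0⇒x≈y : ∀ x y → x K.- y K.≈ K.0# → x K.≈ y
      x-y≈0⇒x≈y x y p = K.trans (K.sym (K.+-identityʳ x)) (K.trans (K.+-congˡ (K.sym (K.-‿inverseˡ y)))
        (K.trans (K.sym (K.+-assoc x (K.- y) y)) (K.trans (K.+-congʳ p) (K.+-identityˡ y))))

      ρ-respects : ∀ D D' → IsInner Φ ψ (λ a → δ D a MatT.-ᴹ δ D' a) → ρ (value D) ≈ᵛ ρ (value D')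
      ρ-respects D D' (U , eq) r = x-y≈0⇒x≈y _ _ (K.trans (K.+-congˡ (K.sym (ρ-neg (value D') r)))
        (K.trans (K.sym (ρ-+ (value D) (MatT.-ᴹ value D') r))
          (K.trans (ρ-cong {value D MatT.-ᴹ value D'} {I U} (eq F[t].t) r) (ρ-I U r))))

      -- The difference of the values at t has zero remainder, so `decompose` exhibits it as an
      -- inner value.
      ρ-injective : ∀ D D' → ρ (value D) ≈ᵛ ρ (value D') → IsInner Φ ψ (λ a → δ D a MatT.-ᴹ δ D' a)
      ρ-injective D D' p with decompose (value D MatT.-ᴹ value D')
      ... | U , eq = inner⇒IsInner (_+ᴰ_ Φ ψ D (-ᴰ_ Φ ψ D')) U (≈ᴹ.trans eq
        (≈ᴹ.trans (+ᴹ-cong {N = I U} lift≈0 ≈ᴹ.refl) λ i j → T.+-identityˡ (I U i j)))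
        where
        rem : Vector K.Carrier (n ℕ.* d)
        rem = ρ (value D MatT.-ᴹ value D')
        c≈0 : ∀ r → rem r K.≈ K.0#
        c≈0 r = K.trans (ρ-+ (value D) (MatT.-ᴹ value D') r) (K.trans (K.+-cong (p r) (ρ-neg (value D') r)) (K.-‿inverseʳ _))
        lift≈0 : lift rem MatT.≈ᴹ MatT.0ᴹ
        lift≈0 zero j = K⟨τ⟩.mk (zeros (λ i → rem (combine i j)) λ i → c≈0 (combine i j))
          where
          zeros : ∀ {l} (f : Vector K.Carrier l) → (∀ i → f i K.≈ K.0#) → ∀ k → K⟨τ⟩.coeff (tabulate f) k K.≈ K.0#
          zeros {zero}  f z k       = K.refl
          zeros {suc l} f z zero    = z zero
          zeros {suc l} f z (suc k) = zeros (f ∘ suc) (z ∘ suc) k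

      neg-unique : ∀ x y → x K.+ y K.≈ K.0# → y K.≈ K.- x
      neg-unique = RingProperties.+-inverseʳ-unique K.ring

    extStructure : TModuleStructure (Ext Φ ψ)
    extStructure = record
      { dim = n ℕ.* d ; tModule = extTModule ; iso = ρ ∘ value
      ; isIso = record
        { isLeftModuleMonomorphism = record
          { isLeftModuleHomomorphism = record
            { +ᴹ-isGroupHomomorphism = record
              { isMonoidHomomorphism = record
                { isMagmaHomomorphism = record
                  { isRelHomomorphism = record { cong = λ {D} {D'} → ρ-respects D D' }
                  ; homo = λ D D' → ρ-+ (value D) (value D') }
                ; ε-homo = ρ-0 }
              ; ⁻¹-homo = λ D → ρ-neg (value D) }
            ; *ₗ-homo = λ a D → ρ-action a (value D) }
          ; injective = λ {D} {D'} → ρ-injective D D' }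
        ; surjective = λ c → derivation (lift c) , λ {D} D≈ r → K.trans (ρ-respects D (derivation (lift c)) D≈ r)
            (K.trans (ρ-cong (derivation-t (lift c)) r) (ρ-lift c r)) } }

    module _ {a s} (splitting : Splitting (Φ.N ᵀ) a s) where
      open Splitting splitting
      private
        -- The indices `combine zero j`, which hold the constant coefficients, are the first d; only
        -- these are split, and the other m coordinates are carried along.
        f = MK.extend m B
        h = MK.extend m B⁺
        g = MK.padRight m Λ
        k = MK.padDown m κ
        fᵀ = constᴹ f
        hᵀ = constᴹ h
        gᵀ = constᴹ g
        kᵀ = constᴹ k

        h*f≈1 : h MatK.*ᴹ f MatK.≈ᴹ MatK.1ᴹ
        h*f≈1 = MK.≈ᴹ.trans (MK.extend-* m B⁺ B) (MK.≈ᴹ.trans (MK.extend-cong m B⁺*B≈1) (MK.extend-1 m))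

        f*h+k*g≈1 : f MatK.*ᴹ h MatK.+ᴹ k MatK.*ᴹ g MatK.≈ᴹ MatK.1ᴹ
        f*h+k*g≈1 = MK.≈ᴹ.trans (MK.+ᴹ-cong {N = k MatK.*ᴹ g} (MK.extend-* m B B⁺) MK.≈ᴹ.refl) (MK.extend-+ m (B MatK.*ᴹ B⁺) κ Λ split)

        g*f≈0 : g MatK.*ᴹ f MatK.≈ᴹ MatK.0ᴹ
        g*f≈0 = MK.padRight-extend m Λ B Λ*B≈0

        -- The restriction of `Π` to the image of f, written in the coordinates given by the left
        -- inverse h.
        Π⁰ : MatT.Mat (a ℕ.+ m) (a ℕ.+ m)
        Π⁰ = hᵀ MatT.*ᴹ (Π MatT.*ᴹ fᵀ)

        Π⁰-constant : coeffᴹ Π⁰ 0 MatK.≈ᴹ MatK.scalar θ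
        Π⁰-constant = MK.≈ᴹ.trans (coeff₀-*ᴹ hᵀ (Π MatT.*ᴹ fᵀ)) (MK.≈ᴹ.trans
          (MK.*ᴹ-congˡ h (MK.≈ᴹ.trans (coeff₀-*ᴹ Π fᵀ) (MK.*ᴹ-congʳ f Π-constant)))
          (MK.≈ᴹ.trans (MK.≈ᴹ.sym (MatK.*ᴹ-assoc h (MatK.scalar θ) f)) (MK.≈ᴹ.trans
            (MK.*ᴹ-congʳ f h*θ) (MK.≈ᴹ.trans (MatK.*ᴹ-assoc (MatK.scalar θ) h f)
              (MK.≈ᴹ.trans (MK.*ᴹ-congˡ (MatK.scalar θ) h*f≈1) (MK.*ᴹ-identityʳ (MatK.scalar θ)))))))
          where
          h*θ : h MatK.*ᴹ MatK.scalar θ MatK.≈ᴹ MatK.scalar θ MatK.*ᴹ h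
          h*θ i j = K.trans (K.trans (ΣK.sum-cong-≋ λ l → K.trans (K.*-comm (h i l) (MatK.scalar θ l j)) (K.*-congʳ (MK.scalar-comm θ l j)))
            (MatK.scalar-*ᴹ θ (h ᵀ) j i)) (K.sym (MatK.scalar-*ᴹ θ h i j))

      ext₀TModule : TModule (a ℕ.+ m)
      ext₀TModule = tModuleOf Π⁰ Π⁰-constant

      private
        module Ext₀-T = TModule ext₀TModule

        g*Π*f≈0 : gᵀ MatT.*ᴹ (Π MatT.*ᴹ fᵀ) MatT.≈ᴹ MatT.0ᴹ
        g*Π*f≈0 = ≈ᴹ.trans (≈ᴹ.sym (MatT.*ᴹ-assoc gᵀ Π fᵀ)) (≈ᴹ.trans (*ᴹ-congʳ fᵀ (Λ-Π Λ Λ*N≈0))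
          (≈ᴹ.trans (·-*ᴹ (K⟨τ⟩.const θ) gᵀ fᵀ) λ i j → T.trans
            (T.*-congˡ {K⟨τ⟩.const θ} (≈ᴹ.trans (≈ᴹ.sym (constᴹ-* g f)) (≈ᴹ.trans (constᴹ-cong {N = MatK.0ᴹ} g*f≈0) λ i j → Skew.0∷[]≈[]) i j))
            (T.zeroʳ (K⟨τ⟩.const θ))))

        -- Stability of the image of f under `Π`: as f h = 1 - k g, the defect is k g Π f, and g Π f
        -- = θ g f = 0.
        f*Π⁰≈Π*f : fᵀ MatT.*ᴹ Π⁰ MatT.≈ᴹ Π MatT.*ᴹ fᵀ
        f*Π⁰≈Π*f = begin
          fᵀ MatT.*ᴹ (hᵀ MatT.*ᴹ Πf)
            ≈⟨ MatT.*ᴹ-assoc fᵀ hᵀ Πf ⟨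
          fᵀ MatT.*ᴹ hᵀ MatT.*ᴹ Πf
            ≈⟨ (λ i j → T.+-identityʳ ((fᵀ MatT.*ᴹ hᵀ MatT.*ᴹ Πf) i j)) ⟨
          fᵀ MatT.*ᴹ hᵀ MatT.*ᴹ Πf MatT.+ᴹ MatT.0ᴹ
            ≈⟨ +ᴹ-cong {M = fᵀ MatT.*ᴹ hᵀ MatT.*ᴹ Πf} ≈ᴹ.refl (≈ᴹ.trans (MatT.*ᴹ-assoc kᵀ gᵀ Πf)
                 (≈ᴹ.trans (*ᴹ-congˡ kᵀ g*Π*f≈0) (MatT.*ᴹ-zeroʳ kᵀ))) ⟨
          fᵀ MatT.*ᴹ hᵀ MatT.*ᴹ Πf MatT.+ᴹ kᵀ MatT.*ᴹ gᵀ MatT.*ᴹ Πf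
            ≈⟨ MatT.*ᴹ-distribʳ Πf (fᵀ MatT.*ᴹ hᵀ) (kᵀ MatT.*ᴹ gᵀ) ⟨
          (fᵀ MatT.*ᴹ hᵀ MatT.+ᴹ kᵀ MatT.*ᴹ gᵀ) MatT.*ᴹ Πf
            ≈⟨ *ᴹ-congʳ Πf fh+kg ⟩
          MatT.1ᴹ MatT.*ᴹ Πf
            ≈⟨ *ᴹ-identityˡ Πf ⟩
          Πf ∎
          where
          open SetoidReasoning (MatT.matSetoid (n ℕ.* d) (a ℕ.+ m))
          Πf = Π MatT.*ᴹ fᵀ
          fh+kg : fᵀ MatT.*ᴹ hᵀ MatT.+ᴹ kᵀ MatT.*ᴹ gᵀ MatT.≈ᴹ MatT.1ᴹ
          fh+kg = ≈ᴹ.trans (≈ᴹ.sym (+ᴹ-cong (constᴹ-* f h) (constᴹ-* k g)))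
            (≈ᴹ.trans (constᴹ-cong {M = f MatK.*ᴹ h MatK.+ᴹ k MatK.*ᴹ g} f*h+k*g≈1) (constᴹ-scalar K.1#))

      inclusion-isMorphism : IsMorphism ext₀TModule extTModule fᵀ
      inclusion-isMorphism = ≈ᴹ.trans (*ᴹ-congˡ fᵀ (tModuleOf-t Π⁰ Π⁰-constant))
        (≈ᴹ.trans f*Π⁰≈Π*f (*ᴹ-congʳ fᵀ (≈ᴹ.sym (tModuleOf-t Π Π-constant))))

      projection-isMorphism : IsMorphism extTModule (𝔾ₐ s) gᵀ
      projection-isMorphism = ≈ᴹ.trans (*ᴹ-congˡ gᵀ (tModuleOf-t Π Π-constant))
        (≈ᴹ.trans (Λ-Π Λ Λ*N≈0) (≈ᴹ.sym (MatT.scalar-*ᴹ (K⟨τ⟩.const θ) gᵀ)))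

      private
        w₀ : MatT.Mat 1 d → MatK.Mat d 1
        w₀ W j _ = K⟨τ⟩.coeff (W zero j) 0

        -- The defect of f h from the identity is k g, and g applied to ρ W is Λ applied to the
        -- constant coefficient of W.
        f*h-ρ : ∀ W → Λ MatK.*ᴹ w₀ W MatK.≈ᴹ MatK.0ᴹ → evalᴹ fᵀ (evalᴹ hᵀ (ρ W)) ≈ᵛ ρ W
        f*h-ρ W Λw≈0 r = begin
          evalᴹ fᵀ (evalᴹ hᵀ (ρ W)) r
            ≈⟨ K.+-identityʳ _ ⟨
          evalᴹ fᵀ (evalᴹ hᵀ (ρ W)) r K.+ K.0#
            ≈⟨ K.+-cong (C.evalᴹ-const-* f h (ρ W) r) (K.sym (K.trans (K.sym (C.evalᴹ-const-* k g (ρ W) r))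
                 (K.trans (E.evalᴹ-cong kᵀ (λ z → K.trans (Λ-ρ Λ Λ*N≈0 W z) (Λw≈0 z zero)) r) (E.evalᴹ-0 kᵀ r)))) ⟩
          evalᴹ (constᴹ (f MatK.*ᴹ h)) (ρ W) r K.+ evalᴹ (constᴹ (k MatK.*ᴹ g)) (ρ W) r
            ≈⟨ E.evalᴹ-+ˡ (constᴹ (f MatK.*ᴹ h)) (constᴹ (k MatK.*ᴹ g)) (ρ W) r ⟨
          evalᴹ (constᴹ (f MatK.*ᴹ h MatK.+ᴹ k MatK.*ᴹ g)) (ρ W) r
            ≈⟨ C.evalᴹ-const-1 (f MatK.*ᴹ h MatK.+ᴹ k MatK.*ᴹ g) f*h+k*g≈1 (ρ W) r ⟩
          ρ W r ∎
          where open SetoidReasoning K.setoid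

        h*f : ∀ x → evalᴹ hᵀ (evalᴹ fᵀ x) ≈ᵛ x
        h*f = C.evalᴹ-const-inverse h f h*f≈1

        iso₀ : Der₀ Φ ψ → Vector K.Carrier (a ℕ.+ m)
        iso₀ (D , _) = evalᴹ hᵀ (ρ (value D))

      inclusion-iso : ∀ (D : Der₀ Φ ψ) → ρ (value (proj₁ D)) ≈ᵛ evalᴹ fᵀ (iso₀ D)
      inclusion-iso (D , D₀) r = K.sym (f*h-ρ (value D)
        (MK.≈ᴹ.trans (MK.*ᴹ-congˡ Λ λ j _ → D₀ zero j) (MatK.*ᴹ-zeroʳ Λ)) r)

      private
        -- A class with Λ w₀ = 0 is represented by a derivation in Der₀: w₀ = Nᵀ v, and the inner
        -- derivation of the constant v has constant term Nᵀ v.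
        adjust : ∀ W → Λ MatK.*ᴹ w₀ W MatK.≈ᴹ MatK.0ᴹ → ∃ λ U → ∀ j → K⟨τ⟩.coeff ((W MatT.-ᴹ I U) zero j) 0 K.≈ K.0#
        adjust W Λw≈0 = U , λ j → K.trans (K⟨τ⟩.coeff-+ (W zero j) (T.- I U zero j) 0) (K.trans
          (K.+-cong (K.sym (N*v≈w j zero)) (K.trans (K⟨τ⟩.coeff-neg (I U zero j) 0) (K.-‿cong (I-constant j))))
          (K.-‿inverseʳ _))
          where
          w = w₀ W
          v : MatK.Mat d 1
          -- Since Λ w = 0, w = B B⁺ w, and B = Nᵀ V; this v is therefore a preimage of w under Nᵀ.
          v = V MatK.*ᴹ (B⁺ MatK.*ᴹ w)
          U : MatT.Mat 1 d
          U _ l = K⟨τ⟩.const (v l zero)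
          N*v≈w : Φ.N ᵀ MatK.*ᴹ v MatK.≈ᴹ w
          N*v≈w = begin
            Φ.N ᵀ MatK.*ᴹ v                                 ≈⟨ MatK.*ᴹ-assoc (Φ.N ᵀ) V (B⁺ MatK.*ᴹ w) ⟨
            Φ.N ᵀ MatK.*ᴹ V MatK.*ᴹ (B⁺ MatK.*ᴹ w)          ≈⟨ MK.*ᴹ-congʳ (B⁺ MatK.*ᴹ w) N*V≈B ⟩
            B MatK.*ᴹ (B⁺ MatK.*ᴹ w)                        ≈⟨ MatK.*ᴹ-assoc B B⁺ w ⟨
            B MatK.*ᴹ B⁺ MatK.*ᴹ w                          ≈⟨ (λ i j → K.+-identityʳ _) ⟨
            B MatK.*ᴹ B⁺ MatK.*ᴹ w MatK.+ᴹ MatK.0ᴹ          ≈⟨ MK.+ᴹ-cong {M = B MatK.*ᴹ B⁺ MatK.*ᴹ w} MK.≈ᴹ.refl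
                (MK.≈ᴹ.trans (MatK.*ᴹ-assoc κ Λ w) (MK.≈ᴹ.trans (MK.*ᴹ-congˡ κ Λw≈0) (MatK.*ᴹ-zeroʳ κ))) ⟨
            B MatK.*ᴹ B⁺ MatK.*ᴹ w MatK.+ᴹ κ MatK.*ᴹ Λ MatK.*ᴹ w ≈⟨ MatK.*ᴹ-distribʳ w (B MatK.*ᴹ B⁺) (κ MatK.*ᴹ Λ) ⟨
            (B MatK.*ᴹ B⁺ MatK.+ᴹ κ MatK.*ᴹ Λ) MatK.*ᴹ w    ≈⟨ MK.*ᴹ-congʳ w split ⟩
            MatK.1ᴹ MatK.*ᴹ w                               ≈⟨ MK.*ᴹ-identityˡ w ⟩
            w                                               ∎
            where open SetoidReasoning (MatK.matSetoid d 1)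
          I-constant : ∀ j → K⟨τ⟩.coeff (I U zero j) 0 K.≈ (Φ.N ᵀ MatK.*ᴹ v) j zero
          I-constant j = begin
            K⟨τ⟩.coeff (I U zero j) 0
              ≈⟨ K.trans (K⟨τ⟩.coeff-+ ((U MatT.*ᴹ Φ.at-t) zero j) (T.- (ψ.at-t MatT.*ᴹ U) zero j) 0)
                   (K.+-cong (coeff₀-*ᴹ U Φ.at-t zero j) (K.trans (K⟨τ⟩.coeff-neg ((ψ.at-t MatT.*ᴹ U) zero j) 0) (K.-‿cong ψU))) ⟩
            (vᵀ MatK.*ᴹ A_ 0) zero j K.- (vᵀ MatK.*ᴹ MatK.scalar θ) zero j
              ≈⟨ K.+-congˡ (MatK.*ᴹ-negʳ vᵀ (MatK.scalar θ) zero j) ⟨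
            (vᵀ MatK.*ᴹ A_ 0) zero j K.+ (vᵀ MatK.*ᴹ (MatK.-ᴹ MatK.scalar θ)) zero j
              ≈⟨ MatK.*ᴹ-distribˡ vᵀ (A_ 0) (MatK.-ᴹ MatK.scalar θ) zero j ⟨
            (vᵀ MatK.*ᴹ Φ.N) zero j
              ≈⟨ ΣK.sum-cong-≋ (λ l → K.*-comm (v l zero) (Φ.N l j)) ⟩
            (Φ.N ᵀ MatK.*ᴹ v) j zero ∎
            where
            open SetoidReasoning K.setoid
            vᵀ : MatK.Mat 1 d
            vᵀ = v ᵀ
            scalar-j : (vᵀ MatK.*ᴹ MatK.scalar θ) zero j K.≈ v j zero K.* θ
            scalar-j = K.trans (ΣK.sum-single (λ l → v l zero K.* MatK.scalar θ l j) j λ l l≢j → K.trans (K.*-congˡ (MK.scalar-off θ l≢j)) (K.zeroʳ _))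
              (K.*-congˡ (MK.scalar-diagonal θ j))
            ψU : K⟨τ⟩.coeff ((ψ.at-t MatT.*ᴹ U) zero j) 0 K.≈ (vᵀ MatK.*ᴹ MatK.scalar θ) zero j
            ψU = K.trans (coeff₀-*ᴹ ψ.at-t U zero j) (K.trans (K.+-identityʳ _)
              (K.trans (K.*-congʳ b₀≈θ) (K.trans (K.*-comm θ (v j zero)) (K.sym scalar-j))))

        iso₀-neg : ∀ W → evalᴹ hᵀ (ρ (MatT.-ᴹ W)) ≈ᵛ (λ i → K.- evalᴹ hᵀ (ρ W) i)
        iso₀-neg W i = neg-unique _ _ (K.trans (K.sym (E.evalᴹ-+ hᵀ (ρ W) (ρ (MatT.-ᴹ W)) i)) (K.trans
          (E.evalᴹ-cong hᵀ (λ r → K.trans (K.+-congˡ (ρ-neg W r)) (K.-‿inverseʳ (ρ W r))) i) (E.evalᴹ-0 hᵀ i)))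

        -- The action is computed inside Ext¹ and brought back: f intertwines the two t-modules and
        -- h is its left inverse.
        iso₀-action : ∀ b (D : Der₀ Φ ψ) → evalᴹ hᵀ (ρ (ψ.at b MatT.*ᴹ value (proj₁ D))) ≈ᵛ evalᴹ (Ext₀-T.at b) (iso₀ D)
        iso₀-action b D i = begin
          evalᴹ hᵀ (ρ (ψ.at b MatT.*ᴹ value (proj₁ D))) i
            ≈⟨ E.evalᴹ-cong hᵀ (λ r → K.trans (ρ-action b (value (proj₁ D)) r) (E.evalᴹ-cong (Ext-T.at b) (inclusion-iso D) r)) i ⟩
          evalᴹ hᵀ (evalᴹ (Ext-T.at b) (evalᴹ fᵀ (iso₀ D))) i
            ≈⟨ E.evalᴹ-cong hᵀ (λ r → K.trans (K.sym (E.evalᴹ-* (Ext-T.at b) fᵀ (iso₀ D) r))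
                 (K.trans (E.evalᴹ-congˡ (Ext-T.at b MatT.*ᴹ fᵀ) (≈ᴹ.sym (morphism-at ext₀TModule extTModule fᵀ inclusion-isMorphism b)) (iso₀ D) r)
                   (E.evalᴹ-* fᵀ (Ext₀-T.at b) (iso₀ D) r))) i ⟩
          evalᴹ hᵀ (evalᴹ fᵀ (evalᴹ (Ext₀-T.at b) (iso₀ D))) i
            ≈⟨ h*f (evalᴹ (Ext₀-T.at b) (iso₀ D)) i ⟩
          evalᴹ (Ext₀-T.at b) (iso₀ D) i ∎
          where open SetoidReasoning K.setoid

        -- The low row with coordinates f x need not have zero constant coefficient, although its
        -- class lies in Ext₀. Subtracting an inner value moves it into `Der₀` without changing ρ.
        iso₀-surjective : ∀ x → ∃ λ (D : Der₀ Φ ψ) → iso₀ D ≈ᵛ x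
        iso₀-surjective x with adjust (lift (evalᴹ fᵀ x)) Λw≈0
          where
          Λw≈0 : Λ MatK.*ᴹ w₀ (lift (evalᴹ fᵀ x)) MatK.≈ᴹ MatK.0ᴹ
          Λw≈0 z zero = K.trans (K.sym (Λ-ρ Λ Λ*N≈0 (lift (evalᴹ fᵀ x)) z))
            (K.trans (E.evalᴹ-cong gᵀ (ρ-lift (evalᴹ fᵀ x)) z) (C.evalᴹ-const-cancel g f x g*f≈0 z))
        ... | U , W₀≈0 = (derivation W , λ { zero j → K.trans (K⟨τ⟩.at (derivation-t W zero j) 0) (W₀≈0 j) })
          , λ i → K.trans (E.evalᴹ-cong hᵀ ρW≈c i) (h*f x i)
          where
          fx = evalᴹ fᵀ x
          W = lift fx MatT.-ᴹ I U
          ρW≈c : ρ (value (derivation W)) ≈ᵛ fx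
          ρW≈c r = K.trans (ρ-cong (derivation-t W) r) (K.trans (ρ-+ (lift fx) (MatT.-ᴹ I U) r)
            (K.trans (K.+-cong (ρ-lift fx r) (K.trans (ρ-neg (I U) r) (K.trans (K.-‿cong (ρ-I U r)) (RingProperties.-0#≈0# K.ring))))
              (K.+-identityʳ (fx r))))

      ext₀Structure : TModuleStructure (Ext₀ Φ ψ)
      ext₀Structure = record
        { dim = a ℕ.+ m ; tModule = ext₀TModule ; iso = iso₀
        ; isIso = record
          { isLeftModuleMonomorphism = record
            { isLeftModuleHomomorphism = record
              { +ᴹ-isGroupHomomorphism = record
                { isMonoidHomomorphism = record
                  { isMagmaHomomorphism = record
                    { isRelHomomorphism = record { cong = λ {D} {D'} → iso₀-respects D D' }
                    ; homo = λ (D , _) (D' , _) i → K.trans (E.evalᴹ-cong hᵀ (ρ-+ (value D) (value D')) i)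
                        (E.evalᴹ-+ hᵀ (ρ (value D)) (ρ (value D')) i) }
                  ; ε-homo = λ i → K.trans (E.evalᴹ-cong hᵀ ρ-0 i) (E.evalᴹ-0 hᵀ i) }
                ; ⁻¹-homo = λ (D , _) → iso₀-neg (value D) }
              ; *ₗ-homo = iso₀-action }
            ; injective = λ {D} {D'} p → ρ-injective (proj₁ D) (proj₁ D') λ r →
                K.trans (inclusion-iso D r) (K.trans (E.evalᴹ-cong fᵀ p r) (K.sym (inclusion-iso D' r))) }
          ; surjective = λ x → proj₁ (iso₀-surjective x) , λ {D} D≈ i →
              K.trans (iso₀-respects D (proj₁ (iso₀-surjective x)) D≈ i) (proj₂ (iso₀-surjective x) i) } }
        where
        iso₀-respects : ∀ (D D' : Der₀ Φ ψ) → IsInner Φ ψ (λ a → δ (proj₁ D) a MatT.-ᴹ δ (proj₁ D') a) → iso₀ D ≈ᵛ iso₀ D'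
        iso₀-respects (D , _) (D' , _) p = E.evalᴹ-cong hᵀ (ρ-respects D D' p)

    -- Ext₀ is built from one splitting, the quotient map from another; the two images of Nᵀ agree.
    module _ {a s a' s'} (splitting : Splitting (Φ.N ᵀ) a s) (splitting' : Splitting (Φ.N ᵀ) a' s') where
      private
        module X = Splitting splitting
        module Y = Splitting splitting'
        f  = MK.extend m X.B
        h  = MK.extend m X.B⁺
        f' = MK.extend m Y.B
        h' = MK.extend m Y.B⁺
        g' = MK.padRight m Y.Λ
        k' = MK.padDown m Y.κ

        h*f≈1 : h MatK.*ᴹ f MatK.≈ᴹ MatK.1ᴹ
        h*f≈1 = MK.≈ᴹ.trans (MK.extend-* m X.B⁺ X.B) (MK.≈ᴹ.trans (MK.extend-cong m X.B⁺*B≈1) (MK.extend-1 m))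

        g'*f≈0 : g' MatK.*ᴹ f MatK.≈ᴹ MatK.0ᴹ
        g'*f≈0 = MK.padRight-extend m Y.Λ X.B (MK.≈ᴹ.trans (MK.*ᴹ-congˡ Y.Λ (MK.≈ᴹ.sym X.N*V≈B))
          (MK.≈ᴹ.trans (MK.≈ᴹ.sym (MatK.*ᴹ-assoc Y.Λ (Φ.N ᵀ) X.V)) (MK.≈ᴹ.trans (MK.*ᴹ-congʳ X.V Y.Λ*N≈0) (MatK.*ᴹ-zeroˡ X.V))))

        g'*k'≈1 : g' MatK.*ᴹ k' MatK.≈ᴹ MatK.1ᴹ
        g'*k'≈1 = MK.≈ᴹ.trans (MK.padRight-padDown m Y.Λ Y.κ) Y.Λ*κ≈1

        -- The columns of `Y.B` lie in the image of Nᵀ, on which the projection B B⁺ of the first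
        -- splitting is the identity.
        f*h*f'≈f' : f MatK.*ᴹ (h MatK.*ᴹ f') MatK.≈ᴹ f'
        f*h*f'≈f' = MK.≈ᴹ.trans (MK.*ᴹ-congˡ f (MK.extend-* m X.B⁺ Y.B)) (MK.≈ᴹ.trans (MK.extend-* m X.B (X.B⁺ MatK.*ᴹ Y.B))
          (MK.extend-cong m (begin
            X.B MatK.*ᴹ (X.B⁺ MatK.*ᴹ Y.B)                    ≈⟨ MK.*ᴹ-congˡ X.B (MK.*ᴹ-congˡ X.B⁺ Y.N*V≈B) ⟨
            X.B MatK.*ᴹ (X.B⁺ MatK.*ᴹ (Φ.N ᵀ MatK.*ᴹ Y.V))    ≈⟨ MK.*ᴹ-congˡ X.B (MatK.*ᴹ-assoc X.B⁺ (Φ.N ᵀ) Y.V) ⟨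
            X.B MatK.*ᴹ (X.B⁺ MatK.*ᴹ Φ.N ᵀ MatK.*ᴹ Y.V)      ≈⟨ MatK.*ᴹ-assoc X.B (X.B⁺ MatK.*ᴹ Φ.N ᵀ) Y.V ⟨
            X.B MatK.*ᴹ (X.B⁺ MatK.*ᴹ Φ.N ᵀ) MatK.*ᴹ Y.V      ≈⟨ MK.*ᴹ-congʳ Y.V X.B*B⁺*N≈N ⟩
            Φ.N ᵀ MatK.*ᴹ Y.V                                 ≈⟨ Y.N*V≈B ⟩
            Y.B                                               ∎)))
          where open SetoidReasoning (MatK.matSetoid d a')

        -- In the decomposition of the identity by the second splitting, f' is replaced by f h f'. A
        -- vector killed by g' is thereby f applied to something, which gives the kernel on every
        -- K-algebra.
        fhf'h'+k'g'≈1 : f MatK.*ᴹ (h MatK.*ᴹ f' MatK.*ᴹ h') MatK.+ᴹ k' MatK.*ᴹ g' MatK.≈ᴹ MatK.1ᴹ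
        fhf'h'+k'g'≈1 = MK.≈ᴹ.trans (MK.+ᴹ-cong {N = k' MatK.*ᴹ g'}
            (MK.≈ᴹ.trans (MK.≈ᴹ.sym (MatK.*ᴹ-assoc f (h MatK.*ᴹ f') h')) (MK.≈ᴹ.trans (MK.*ᴹ-congʳ h' f*h*f'≈f') (MK.extend-* m Y.B Y.B⁺))) MK.≈ᴹ.refl)
          (MK.extend-+ m (Y.B MatK.*ᴹ Y.B⁺) Y.κ Y.Λ Y.split)

      isShortExact : IsShortExact (constᴹ f) (constᴹ g')
      isShortExact = record
        { injective = λ R x y p i → let open Algebraic R in
            trans (sym (evalᴹ-const-inverse h f h*f≈1 x i)) (trans (ER.evalᴹ-cong (constᴹ h) p i) (evalᴹ-const-inverse h f h*f≈1 y i))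
        ; kernel = λ R y → let open Algebraic R in mk⇔
            (λ gy≈0 → PR.evalᴹ (constᴹ (h MatK.*ᴹ f' MatK.*ᴹ h')) y , preimage y gy≈0)
            (λ (x , fx≈y) i → trans (ER.evalᴹ-cong (constᴹ g') (λ j → sym (fx≈y j)) i) (evalᴹ-const-cancel g' f x g'*f≈0 i))
        -- The section `k'` of g' is defined over K, so a point lifts over L itself and the
        -- extension is the identity.
        ; surjective = λ L φ y → L , Identity.ringHomomorphism (Field.ring L) ,
            let R = fieldExtension L (Composition.ringHomomorphism {M₁ = K.ring} {Field.ring L} {Field.ring L} φ (Identity.ringHomomorphism (Field.ring L)))
                open Algebraic R
            in PR.evalᴹ (constᴹ k') y , evalᴹ-const-inverse g' k' g'*k'≈1 y }
        where
        module Algebraic (R : KAlgebra) where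
          open KAlgebra R public hiding (zero)
          open ConstantMatrices S R public
          module ER = Evaluation S R
          module PR = Points R
          preimage : ∀ y → PR.evalᴹ (constᴹ g') y PR.≈ᵛ (λ _ → 0#) →
            PR.evalᴹ (constᴹ f) (PR.evalᴹ (constᴹ (h MatK.*ᴹ f' MatK.*ᴹ h')) y) PR.≈ᵛ y
          preimage y gy≈0 i = begin
            PR.evalᴹ (constᴹ f) (PR.evalᴹ (constᴹ hfh) y) i
              ≈⟨ +-identityʳ _ ⟨
            PR.evalᴹ (constᴹ f) (PR.evalᴹ (constᴹ hfh) y) i + 0#
              ≈⟨ +-cong (evalᴹ-const-* f hfh y i) (sym (trans (sym (evalᴹ-const-* k' g' y i))
                   (trans (ER.evalᴹ-cong (constᴹ k') gy≈0 i) (ER.evalᴹ-0 (constᴹ k') i)))) ⟩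
            PR.evalᴹ (constᴹ (f MatK.*ᴹ hfh)) y i + PR.evalᴹ (constᴹ (k' MatK.*ᴹ g')) y i
              ≈⟨ ER.evalᴹ-+ˡ (constᴹ (f MatK.*ᴹ hfh)) (constᴹ (k' MatK.*ᴹ g')) y i ⟨
            PR.evalᴹ (constᴹ (f MatK.*ᴹ hfh MatK.+ᴹ k' MatK.*ᴹ g')) y i
              ≈⟨ evalᴹ-const-1 (f MatK.*ᴹ hfh MatK.+ᴹ k' MatK.*ᴹ g') fhf'h'+k'g'≈1 y i ⟩
            y i ∎
            where
            open SetoidReasoning setoid
            hfh = h MatK.*ᴹ f' MatK.*ᴹ h'

      extSequence : ExtSequence Φ ψ (ext₀Structure splitting) extStructure (𝔾ₐ s')
      extSequence = record
        { f = constᴹ f ; g = constᴹ g'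
        ; f-isMorphism = inclusion-isMorphism splitting
        ; g-isMorphism = projection-isMorphism splitting'
        ; isShortExact = isShortExact
        ; inclusion    = inclusion-iso splitting }

theorem8p3 : ∀ {c₁ ℓ₁ c₂ ℓ₂} (S : Setting c₁ ℓ₁ c₂ ℓ₂) →
    let open TModules S in
    ∀ {d} (Φ : TModule d) (ψ : TModule 1) (n : ℕ) (Aₙ⁻¹ : MatK.Mat d d) →
    let A_ = coeffᴹ (TModule.at-t Φ)
        M  = Aₙ⁻¹ MatK.*ᴹ TModule.N Φ
    in
    (∀ j → n < j → A_ j MatK.≈ᴹ MatK.0ᴹ) →
    MatK.IsInverse (A_ n) Aₙ⁻¹ →
    TModule.rank ψ < TModule.rank Φ →
    Σ (TModuleStructure (Ext Φ ψ)) λ E →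
    Σ (TModuleStructure (Ext₀ Φ ψ)) λ E₀ →
      (∃ λ R → IsRowReduction M R) ×
      (∀ R → IsRowReduction M R → ExtSequence Φ ψ E₀ E (𝔾ₐ (zeroRows R)))
-- For n = 0 the rank of Φ would be 0, and no rank lies below it.
theorem8p3 S Φ ψ zero Aₙ⁻¹ high inverse rank< =
  contradiction (ℕ.<-≤-trans rank< (Degrees.degᴹ-≤ S (TModules.TModule.at-t Φ) zero high)) λ ()
theorem8p3 S {d} Φ ψ (suc n') Aₙ⁻¹ high inverse rank< =
  -- The structure on Ext₀ is chosen before R is given, so it comes from one fixed reduction; each R
  -- supplies only its quotient map.
  extStructure , ext₀Structure splitting₀ , (R₀ , reduction₀) ,
  λ R reduction → extSequence splitting₀ (splittingOf R reduction)
  where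
  open TModules S
  open Degrees S
  open LinearAlgebra K
  M = Aₙ⁻¹ MatK.*ᴹ TModule.N Φ
  -- The rank inequality enters here: deg ψ_t < deg Φ_t ≤ n.
  b-high : ∀ i → suc n' ≤ i → K⟨τ⟩.coeff (TModule.at-t ψ zero zero) i K.≈ K.0#
  b-high i n≤i = degᴹ-< (TModule.at-t ψ) i
    (ℕ.<-≤-trans rank< (ℕ.≤-trans (degᴹ-≤ (TModule.at-t Φ) (suc n') high) n≤i)) zero zero
  open ExtModules.Structures S Φ ψ n' Aₙ⁻¹ high inverse b-high
  P₀ = proj₁ (rowReduction M)
  R₀ = GL.mat P₀ MatK.*ᴹ M
  reduction₀ : IsRowReduction M R₀
  reduction₀ = record
    { P = GL.mat P₀ ; P⁻¹ = GL.mat⁻¹ P₀ ; P-invertible = GL.isInverse P₀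
    ; P*M≈R = λ i j → K.refl ; rowIndependent = proj₂ (rowReduction M) }
  splittingOf : ∀ R → IsRowReduction M R → Splitting (TModule.N Φ ᵀ) _ (zeroRows R)
  splittingOf R reduction = splitting {N = TModule.N Φ} inverse P-invertible P*M≈R rowIndependent
    where open IsRowReduction reduction
  splitting₀ = splittingOf R₀ reduction₀
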